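{- Let $\delta>0$ be a (constant) parameter. There exists an algorithm that, given probe access to a $q$-spin system $\mathcal S=(G=(V,E),\boldsymbol\lambda,\boldsymbol A)$ on a graph $G$ with maximum degree $\Delta\ge 1$ and with Gibbs distribution $\mu$, satisfying (i) (normalized) $\sum_{c\in[q]}\lambda_v(c)=1$ for all $v\in V$ and $\max_{i,j\in[q]}A_e(i,j)=1$ for all $e\in E$, and (ii) (soft constraints) $A_e(c_1,c_2)\ge 1-\frac{1-\delta}{2\Delta}$ for every edge $e\in E$ and all $c_1,c_2\in[q]$, and given a subset of vertices $\Lambda\subseteq V$, outputs a perfect sample $X\sim\mu_\Lambda$ (that is, $X\in[q]^\Lambda$ is distributed exactly according to $\mu_\Lambda$) in expected time $O(\Delta\log q\cdot|\Lambda|)$.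
   Context: Let $q\ge2$ be an integer. A $q$-spin system $\mathcal S=(G=(V,E),\boldsymbol\lambda=(\lambda_v)_{v\in V},\boldsymbol A=(A_e)_{e\in E})$ is defined on a finite graph $G=(V,E)$, with an external field $\lambda_v\in\mathbb R_{\ge0}^q$ at each vertex $v$ and an interaction matrix $A_e\in\mathbb R_{\ge0}^{q\times q}$ at each edge $e$. Its Gibbs distribution on $[q]^V$ is $\mu(\sigma)=w(\sigma)/Z$, where $w(\sigma)=\prod_{v\in V}\lambda_v(\sigma(v))\prod_{e=(u,v)\in E}A_e(\sigma(u),\sigma(v))$ and $Z=\sum_{\sigma\in[q]^V}w(\sigma)$. For $\Lambda\subseteq V$, the marginal distribution $\mu_\Lambda$ is $\mu_\Lambda(\tau)=\sum_{\sigma\in[q]^V:\sigma_\Lambda=\tau}\mu(\sigma)$ for $\tau\in[q]^\Lambda$. Probe access means: for each $v\in V$, each neighbor of $v$ can be accessed in $O(1)$ time, and each entry of every $\lambda_v$ and $A_e$ can be retrieved in $O(1)$ time.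
   Formalization: Besides probe access, the algorithm may draw a spin from any external field λ_v at cost ⌈log₂ q⌉; with entry probes alone the bound fails uniformly in q (single edge, A ≡ 1, λ_v a point mass at an unknown spin needs Ω(q) probes). -}

module Defs where

open import Algebra.Structures using (IsCommutativeRing)
open import Data.Bool.Base using (Bool; if_then_else_)
open import Data.Fin.Base using (Fin; toℕ; fromℕ<)
open import Data.List.Base
  using (List; []; _∷_; allFin; cartesianProductWith; concatMap; drop; filter; foldr; head; length; map)
open import Data.List.Membership.Propositional using (_∈_; _∉_)
open import Data.List.Relation.Unary.Unique.Propositional using (Unique)
open import Data.Maybe.Base using (Maybe; just; nothing; maybe′)
open import Data.Nat.Base as ℕ using (ℕ; zero; suc; _≡ᵇ_)
open import Data.Nat.Logarithm using (⌈log₂_⌉)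
open import Data.Nat.GeneralisedArithmetic using (fold)
import Data.Fin.Properties as Finₚ
import Data.Nat.Properties as ℕₚ
open import Data.Product.Base using (∃; ∃₂; _×_; _,_)
open import Data.Vec.Base as Vec using (Vec; lookup)
import Data.Vec.Properties as Vecₚ
open import Relation.Binary.PropositionalEquality.Core using (_≡_; _≢_)
open import Relation.Binary.Structures using (IsDecTotalOrder)
open import Relation.Nullary.Decidable.Core using (yes; no; does)

-- The real numbers, axiomatised as a complete ordered field; such a field is
-- unique up to isomorphism.  Decidability of the order and the Archimedean
-- property are classically redundant, but do not follow constructively.
record Reals : Set₁ where
  infix  9 _⁻¹
  infix  8 -_
  infixl 7 _*_ _/_
  infixl 6 _+_ _-_
  infix  4 _≤_ _<_

  field
    ℝ     : Set
    _+_   : ℝ → ℝ → ℝ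
    _*_   : ℝ → ℝ → ℝ
    -_    : ℝ → ℝ
    _⁻¹   : ℝ → ℝ
    0# 1# : ℝ
    _≤_   : ℝ → ℝ → Set

  fromℕ : ℕ → ℝ
  fromℕ = fold 0# (1# +_)

  field
    isCommutativeRing : IsCommutativeRing _≡_ _+_ _*_ -_ 0# 1#
    0≢1               : 0# ≢ 1#
    *-inverseʳ        : ∀ x → x ≢ 0# → x * x ⁻¹ ≡ 1#
    0⁻¹               : 0# ⁻¹ ≡ 0#   -- convention making _⁻¹ total
    isDecTotalOrder   : IsDecTotalOrder _≡_ _≤_
    +-monoˡ-≤         : ∀ z {x y} → x ≤ y → x + z ≤ y + z
    *-nonneg          : ∀ {x y} → 0# ≤ x → 0# ≤ y → 0# ≤ x * y
    archimedean       : ∀ x → ∃ λ n → x ≤ fromℕ n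
    complete          : (P : ℝ → Set) → ∃ P → (∃ λ b → ∀ x → P x → x ≤ b) →
                        ∃ λ s → (∀ x → P x → x ≤ s) ×
                                (∀ b → (∀ x → P x → x ≤ b) → s ≤ b)

  open IsDecTotalOrder isDecTotalOrder public using (_≤?_)

  _<_ : ℝ → ℝ → Set
  x < y = x ≤ y × x ≢ y

  _-_ _/_ : ℝ → ℝ → ℝ
  x - y = x + (- y)
  x / y = x * y ⁻¹

  ∑ ∏ : List ℝ → ℝ
  ∑ = foldr _+_ 0#
  ∏ = foldr _*_ 1#

  clamp : ℝ → ℝ
  clamp x = if does (x ≤? 0#) then 0# else if does (1# ≤? x) then 1# else x

  infix 4 _⟶_

  _⟶_ : (ℕ → ℝ) → ℝ → Set
  x ⟶ ℓ = ∀ ε → 0# < ε → ∃ λ N → ∀ t → N ℕ.≤ t → (x t - ℓ ≤ ε) × (ℓ - x t ≤ ε)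

-- Finite simple graphs on the vertex set Fin order, as (arbitrarily ordered)
-- adjacency lists.
record Graph : Set where
  field
    order      : ℕ
    neighbours : Fin order → List (Fin order)
    unique     : ∀ v → Unique (neighbours v)
    loopless   : ∀ v → v ∉ neighbours v
    symmetric  : ∀ {u v} → v ∈ neighbours u → u ∈ neighbours v

  V : Set
  V = Fin order

  degree : V → ℕ
  degree v = length (neighbours v)

  maxDegree : ℕ
  maxDegree = foldr ℕ._⊔_ 0 (map degree (allFin order))

  -- Each edge is listed once, oriented from its smaller endpoint.
  edges : List (V × V)
  edges = concatMap (λ u → map (u ,_) (filter (u Finₚ.<?_) (neighbours u))) (allFin order)

configurations : ∀ q n → List (Vec (Fin q) n)
configurations q zero    = Vec.[] ∷ []
configurations q (suc n) = cartesianProductWith Vec._∷_ (allFin q) (configurations q n)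

infixl 10 _[_↦_]

_[_↦_] : {X : Set} → (ℕ → X) → ℕ → X → (ℕ → X)
(f [ i ↦ x ]) j = if j ≡ᵇ i then x else f j

-- A table read at an arbitrary natural number, with a default value out of range.
at : {X : Set} {n : ℕ} → X → (Fin n → X) → ℕ → X
at {n = n} d f i with i ℕₚ.<? n
... | yes i<n = f (fromℕ< i<n)
... | no  _   = d

nth : {X : Set} → List X → ℕ → Maybe X
nth xs i = head (drop i xs)

module Sampling (𝓡 : Reals) where
  open Reals 𝓡

  -- A is given for ordered pairs of adjacent vertices: A u v and A v u are the
  -- interaction matrix of the edge {u , v} with rows indexed by the spin of u,
  -- respectively of v.  The matrix itself need not be symmetric.  The values of A
  -- at non-adjacent pairs play no role.
  record SpinSystem (q : ℕ) : Set where
    field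
      graph : Graph
    open Graph graph public
    field
      field-λ     : V → Fin q → ℝ
      A           : V → V → Fin q → Fin q → ℝ
      λ-nonneg    : ∀ v c → 0# ≤ field-λ v c
      A-nonneg    : ∀ {u v} → v ∈ neighbours u → ∀ a b → 0# ≤ A u v a b
      A-transpose : ∀ {u v} → v ∈ neighbours u → ∀ a b → A u v a b ≡ A v u b a

    Config : Set
    Config = Vec (Fin q) order

    weight : Config → ℝ
    weight σ = ∏ (map (λ v → field-λ v (lookup σ v)) (allFin order))
             * ∏ (map (λ (u , v) → A u v (lookup σ u) (lookup σ v)) edges)

    Z : ℝ
    Z = ∑ (map weight (configurations q order))

    gibbs : Config → ℝ
    gibbs σ = weight σ / Z

    -- A vertex subset is presented as a list of vertices (without repetitions),
    -- and a configuration on it as the list of the corresponding spins.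
    restrict : ∀ {k} → Config → Vec V k → Vec (Fin q) k
    restrict σ Λ = Vec.map (lookup σ) Λ

    marginal : ∀ {k} → Vec V k → Vec (Fin q) k → ℝ
    marginal Λ τ =
      ∑ (map gibbs (filter (λ σ → Vecₚ.≡-dec Finₚ._≟_ (restrict σ Λ) τ)
                           (configurations q order)))

  Normalized : ∀ {q} → SpinSystem q → Set
  Normalized {q} 𝓢 =
      (∀ v → ∑ (map (field-λ v) (allFin q)) ≡ 1#)
    × (∀ u v → v ∈ neighbours u →
         (∀ a b → A u v a b ≤ 1#) × (∃₂ λ a b → A u v a b ≡ 1#))
    where open SpinSystem 𝓢

  Soft : ∀ {q} → ℝ → SpinSystem q → Set
  Soft δ 𝓢 =
    ∀ u v → v ∈ neighbours u → ∀ a b →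
      1# - (1# - δ) / (fromℕ 2 * fromℕ maxDegree) ≤ A u v a b
    where open SpinSystem 𝓢

  -- A randomised real RAM.  There are natural registers, real registers, and a
  -- heap of naturals that is reachable only through natural registers.  In each
  -- constructor the destination comes first, and the other arguments are register
  -- indices, except for the literals in `set` and `setʳ` and the jump targets.
  data Instr : Set where
    set      : ℕ → ℕ → Instr
    add monus : ℕ → ℕ → ℕ → Instr
    load     : ℕ → ℕ → Instr
    store    : ℕ → ℕ → Instr
    jump     : ℕ → Instr
    jumpZero : ℕ → ℕ → Instr                    -- register, target
    setʳ     : ℕ → ℝ → Instr
    fromNat  : ℕ → ℕ → Instr
    addʳ subʳ mulʳ divʳ : ℕ → ℕ → ℕ → Instr
    jumpLeqʳ : ℕ → ℕ → ℕ → Instr                -- left, right, target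
    -- probes to the spin system
    deg      : ℕ → ℕ → Instr                    -- vertex
    nbr      : ℕ → ℕ → ℕ → Instr                -- vertex, position
    λ-entry  : ℕ → ℕ → ℕ → Instr                -- vertex, spin
    A-entry  : ℕ → ℕ → ℕ → ℕ → ℕ → Instr        -- two vertices, two spins
    -- randomness: a biased coin, and a spin drawn from the external field of a vertex
    coin     : ℕ → ℕ → Instr
    draw     : ℕ → ℕ → Instr

  Program : Set
  Program = List Instr

  record State : Set where
    constructor mkState
    field
      pc   : ℕ
      nat  : ℕ → ℕ
      real : ℕ → ℝ
      heap : ℕ → ℕ

  module Execution {q : ℕ} (𝓢 : SpinSystem q) where
    open SpinSystem 𝓢

    -- Every instruction takes unit time, except that drawing a spin from some λ_v
    -- takes time log q.  Reading entries of λ_v alone could not achieve a bound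
    -- uniform in q: a point mass at an unknown spin takes Ω(q) reads to locate.
    cost : Instr → ℕ
    cost (draw _ _) = ⌈log₂ q ⌉
    cost _          = 1

    -- Finitely supported distributions, as lists of weighted outcomes.
    step : Instr → State → List (ℝ × State)
    step i (mkState pc N R H) = go i
      where
      next : (ℕ → ℕ) → (ℕ → ℝ) → (ℕ → ℕ) → State
      next = mkState (suc pc)

      natₜ : ℕ → ℕ → List (ℝ × State)
      natₜ d x = (1# , next (N [ d ↦ x ]) R H) ∷ []

      realₜ : ℕ → ℝ → List (ℝ × State)
      realₜ d x = (1# , next N (R [ d ↦ x ]) H) ∷ []

      goto : ℕ → List (ℝ × State)
      goto l = (1# , mkState l N R H) ∷ []

      go : Instr → List (ℝ × State)
      go (set d k)            = natₜ d k
      go (add d a b)          = natₜ d (N a ℕ.+ N b)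
      go (monus d a b)        = natₜ d (N a ℕ.∸ N b)
      go (load d a)           = natₜ d (H (N a))
      go (store d a)          = (1# , next N R (H [ N d ↦ N a ])) ∷ []
      go (jump l)             = goto l
      go (jumpZero a l)       = goto (if N a ≡ᵇ 0 then l else suc pc)
      go (setʳ d x)           = realₜ d x
      go (fromNat d a)        = realₜ d (fromℕ (N a))
      go (addʳ d a b)         = realₜ d (R a + R b)
      go (subʳ d a b)         = realₜ d (R a - R b)
      go (mulʳ d a b)         = realₜ d (R a * R b)
      go (divʳ d a b)         = realₜ d (R a / R b)
      go (jumpLeqʳ a b l)     = goto (if does (R a ≤? R b) then l else suc pc)
      go (deg d v)            = natₜ d (at 0 degree (N v))
      go (nbr d v i)          =
        natₜ d (at 0 (λ x → maybe′ toℕ 0 (nth (neighbours x) (N i))) (N v))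
      go (λ-entry d v c)      =
        realₜ d (at 0# (λ x → at 0# (field-λ x) (N c)) (N v))
      go (A-entry d u v a b)  =
        realₜ d (at 0# (λ x → at 0# (λ y →
                   at 0# (λ s → at 0# (A x y s) (N b)) (N a)) (N v)) (N u))
      go (coin d a)           =
          (clamp (R a)      , next (N [ d ↦ 1 ]) R H)
        ∷ (1# - clamp (R a) , next (N [ d ↦ 0 ]) R H) ∷ []
      go (draw d v)           =
        at (natₜ d 0)
           (λ x → map (λ c → field-λ x c , next (N [ d ↦ toℕ c ]) R H) (allFin q))
           (N v)

    expect : (State → ℝ) → List (ℝ × State) → ℝ
    expect f ds = ∑ (map (λ (p , s) → p * f s) ds)

    -- The machine halts when the program counter leaves the program.  The output
    -- of a halted machine is in the first k heap cells.
    outputs? : ∀ {k} → Vec (Fin q) k → State → Bool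
    outputs? {k} τ s =
      does (Vecₚ.≡-dec ℕₚ._≟_ (Vec.tabulate {n = k} (λ i → State.heap s (toℕ i)))
                              (Vec.map toℕ τ))

    -- Probability that, started from the given state, the machine halts within t
    -- steps and outputs τ.
    Pr[_,_outputs_] : ∀ {k} → ℕ → Program → Vec (Fin q) k → State → ℝ
    Pr[ t , P outputs τ ] s with nth P (State.pc s)
    ... | nothing = if outputs? τ s then 1# else 0#
    Pr[ zero  , P outputs τ ] s | just i = 0#
    Pr[ suc t , P outputs τ ] s | just i = expect Pr[ t , P outputs τ ] (step i s)

    -- Expected time spent during the first t steps.
    expectedTime : ℕ → Program → State → ℝ
    expectedTime zero    P s = 0#
    expectedTime (suc t) P s with nth P (State.pc s)
    ... | nothing = 0#
    ... | just i  = fromℕ (cost i) + expect (expectedTime t P) (step i s)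

    -- The first four natural registers hold q, Δ, |V| and |Λ|, the first |Λ| heap
    -- cells hold the elements of Λ, and everything else is 0.
    initial : ∀ {k} → Vec V k → State
    initial {k} Λ = mkState 0 registers (λ _ → 0#) (at 0 (λ i → toℕ (lookup Λ i)))
      where
      registers : ℕ → ℕ
      registers 0 = q
      registers 1 = maxDegree
      registers 2 = order
      registers 3 = k
      registers _ = 0

    -- On input Λ, the output of P is distributed exactly according to μ_Λ.
    PerfectSample : ∀ {k} → Program → Vec V k → Set
    PerfectSample {k} P Λ =
      (τ : Vec (Fin q) k) → (λ t → Pr[ t , P outputs τ ] (initial Λ)) ⟶ marginal Λ τ

    -- By monotone convergence, the expected running time is the supremum over t
    -- of the expected time spent during the first t steps.
    ExpectedTime≤ : ∀ {k} → Program → Vec V k → ℝ → Set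
    ExpectedTime≤ P Λ B = ∀ t → expectedTime t P (initial Λ) ≤ B

  open Execution public using (PerfectSample; ExpectedTime≤)

{-# OPTIONS --safe #-}

-- Run the systematic scan Glauber dynamics from the infinite past.  An update of v
-- is rejection sampling: propose c from λ_v and accept it with probability
-- ∏ A_vu(c , σ_u).  As 1 - A ≤ θ = η / Δ, where 2 η = 1 - δ, each factor can be tested
-- by a coin of bias θ which, unless it comes up heads, settles the test without
-- reading σ_u; otherwise the spin of u is obtained by recursion into the past (coupling
-- towards the past, with memoization).  One proposal costs at most Δ θ = η expected
-- recursive calls and at most η expected repetitions, and 2 η = 1 - δ < 1 makes this
-- a subcritical branching process.
--
-- Correctness is a martingale argument.  Replace the kernel of each update by its law
-- given what the machine already knows: a point mass, the Glauber kernel, or the law of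
-- an unfinished trial.  The probability that this inhomogeneous chain, started from μ
-- sufficiently far in the past, ends in τ on Λ is preserved in expectation by each
-- step of the machine, equals μ_Λ(τ) at the start by stationarity, and dominates the
-- probability of output τ at the end.  So the output probabilities never exceed μ_Λ;
-- as the expected running time is finite they sum to 1 in the limit, hence converge.

module Submission where

open import Defs
open import Algebra.Bundles using (CommutativeRing)
import Algebra.Properties.Ring
import Algebra.Solver.Ring
open import Algebra.Solver.Ring.AlmostCommutativeRing as ACR using (_-Raw-AlmostCommutative⟶_)
open import Data.Bool.Base using (Bool; true; false; if_then_else_; T)
open import Data.Fin.Base as Fin using (Fin; zero; suc; toℕ; fromℕ<)
import Data.Fin.Properties as Finₚ
open import Data.Integer.Base as ℤ using (ℤ; -[1+_]; _⊖_)
import Data.Integer.Properties as ℤₚ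
open import Data.List.Base
  using (List; []; _∷_; _++_; allFin; cartesianProductWith; concatMap; drop; filter; foldr; head; length; map; take)
import Data.List.Membership.DecPropositional as DecMembership
open import Data.List.Membership.Propositional using (_∈_; _∉_)
open import Data.List.Membership.Propositional.Properties using (∈-allFin; ∈-cartesianProductWith⁺; ∈-++⁺ʳ)
import Data.List.Properties as Listₚ
import Data.List.Relation.Unary.All as All
open import Data.List.Relation.Unary.AllPairs using ([]; _∷_)
open import Data.List.Relation.Unary.Any using (here; there)
import Data.List.Relation.Unary.Unique.Propositional as List
open import Data.Maybe.Base as Maybe using (Maybe; just; nothing; maybe′; _>>=_)
import Data.Maybe.Properties as Maybeₚ
open import Data.Nat.Base as ℕ using (ℕ; zero; suc; NonZero; _≡ᵇ_)
import Data.Nat.DivMod as DivMod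
open import Data.Nat.DivMod using (_%_; m%n<n; m%n≤m; m<n⇒m%n≡m; [m+kn]%n≡m%n; m≡m%n+[m/n]*n)
open import Data.Nat.Induction using (<-rec)
open import Data.Nat.Logarithm using (⌈log₂_⌉; ⌈log₂⌉-mono-≤)
import Data.Nat.Properties as ℕₚ
open import Data.Nat.Solver using (module +-*-Solver)
open import Data.Product.Base using (Σ; ∃; _×_; _,_; proj₁; proj₂)
open import Data.Sum.Base using (inj₁; inj₂)
open import Data.Unit.Base using (⊤; tt)
open import Data.Vec.Base as Vec using (Vec; lookup; _[_]≔_)
import Data.Vec.Properties as Vecₚ
open import Data.Vec.Relation.Unary.Unique.Propositional using (Unique)
open import Function.Base using (_∘_; id)
open import Relation.Binary.Bundles using (Poset)
open import Relation.Binary.Definitions using (tri<; tri≈; tri>)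
open import Relation.Binary.PropositionalEquality
  using (_≡_; _≢_; refl; sym; trans; cong; cong₂; subst; subst₂; module ≡-Reasoning)
open import Relation.Binary.Structures using (IsDecTotalOrder)
open import Relation.Nullary.Decidable using (dec-true; dec-false)
open import Relation.Nullary.Decidable.Core using (Dec; does; yes; no; dec⇒maybe)
open import Relation.Nullary.Negation.Core using (¬_; contradiction)
open import Relation.Unary using (Decidable)

-- No limit of the run is ever formed: every statement concerns the first t steps and is about
-- finite sums, so all bounds are carried together through one induction on t (`Good`), at the
-- program points listed in `Cut`. Domination by the martingale, rather than equality with it, is
-- what survives truncation: a run that is cut off outputs nothing, while the martingale stays
-- nonnegative. The infinite past is replaced by the (t + 1) |V| most recent updates. A recursive
-- call goes back by less than one sweep and takes at least one step, so t steps never leave this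
-- window; by stationarity the initial value of the martingale is the same for every window. The
-- obstacle is a suspended trial, whose law depends on a spin that is not yet known. It is kept as a
-- kernel that reads this spin from the configuration, and is exchanged for a mixture with a
-- constant weight only when the spin has been pinned at an earlier time and no update of that
-- vertex intervenes.

-- Ordered-field arithmetic and a ring solver for the axiomatised reals.

module OrderedField (𝓡 : Reals) where
  open Reals 𝓡

  commutativeRing : CommutativeRing _ _
  commutativeRing = record { isCommutativeRing = isCommutativeRing }

  open CommutativeRing commutativeRing public
    using ( +-assoc; +-comm; +-identityˡ; +-identityʳ; *-assoc; *-comm; *-identityˡ; *-identityʳ
          ; zeroˡ; zeroʳ; distribˡ; distribʳ; -‿inverseʳ; ring )
  open Algebra.Properties.Ring ring public
    using (-‿involutive; -‿distribˡ-*; -‿+-comm; -0#≈0#)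

  fromℕ-+ : ∀ m n → fromℕ (m ℕ.+ n) ≡ fromℕ m + fromℕ n
  fromℕ-+ zero    n = sym (+-identityˡ _)
  fromℕ-+ (suc m) n = trans (cong (1# +_) (fromℕ-+ m n)) (sym (+-assoc _ _ _))

  fromℕ-* : ∀ m n → fromℕ (m ℕ.* n) ≡ fromℕ m * fromℕ n
  fromℕ-* zero    n = sym (zeroˡ _)
  fromℕ-* (suc m) n = begin
    fromℕ (n ℕ.+ m ℕ.* n)            ≡⟨ fromℕ-+ n (m ℕ.* n) ⟩
    fromℕ n + fromℕ (m ℕ.* n)        ≡⟨ cong₂ _+_ (sym (*-identityˡ _)) (fromℕ-* m n) ⟩
    1# * fromℕ n + fromℕ m * fromℕ n ≡⟨ distribʳ _ _ _ ⟨
    (1# + fromℕ m) * fromℕ n         ∎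
    where open ≡-Reasoning

  private
    fromℤ : ℤ → ℝ
    fromℤ (ℤ.+ n)    = fromℕ n
    fromℤ -[1+ n ] = - fromℕ (suc n)

    cancel₁ : ∀ x y → (1# + x) + (- (1# + y)) ≡ x + (- y)
    cancel₁ x y = begin
      (1# + x) + (- (1# + y))       ≡⟨ cong₂ _+_ (+-comm 1# x) (sym (-‿+-comm 1# y)) ⟩
      (x + 1#) + ((- 1#) + (- y))   ≡⟨ +-assoc x 1# _ ⟩
      x + (1# + ((- 1#) + (- y)))   ≡⟨ cong (x +_) (+-assoc 1# (- 1#) (- y)) ⟨
      x + ((1# + (- 1#)) + (- y))   ≡⟨ cong (λ z → x + (z + (- y))) (-‿inverseʳ 1#) ⟩
      x + (0# + (- y))              ≡⟨ cong (x +_) (+-identityˡ _) ⟩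
      x + (- y)                     ∎
      where open ≡-Reasoning

    fromℤ-⊖ : ∀ m n → fromℤ (m ⊖ n) ≡ fromℕ m + (- fromℕ n)
    fromℤ-⊖ m       zero    = sym (trans (cong (fromℕ m +_) -0#≈0#) (+-identityʳ _))
    fromℤ-⊖ zero    (suc n) = sym (+-identityˡ _)
    fromℤ-⊖ (suc m) (suc n) = begin
      fromℤ (suc m ⊖ suc n)             ≡⟨ cong fromℤ (ℤₚ.[1+m]⊖[1+n]≡m⊖n m n) ⟩
      fromℤ (m ⊖ n)                     ≡⟨ fromℤ-⊖ m n ⟩
      fromℕ m + (- fromℕ n)             ≡⟨ cancel₁ _ _ ⟨
      fromℕ (suc m) + (- fromℕ (suc n)) ∎
      where open ≡-Reasoning

    fromℤ-+ : ∀ i j → fromℤ (i ℤ.+ j) ≡ fromℤ i + fromℤ j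
    fromℤ-+ (ℤ.+ m)    (ℤ.+ n)    = fromℕ-+ m n
    fromℤ-+ (ℤ.+ m)    -[1+ n ] = fromℤ-⊖ m (suc n)
    fromℤ-+ -[1+ m ] (ℤ.+ n)    = trans (fromℤ-⊖ n (suc m)) (+-comm _ _)
    fromℤ-+ -[1+ m ] -[1+ n ] = begin
      - fromℕ (suc (suc (m ℕ.+ n)))         ≡⟨ cong (λ z → - fromℕ z) (cong suc (ℕₚ.+-suc m n)) ⟨
      - fromℕ (suc m ℕ.+ suc n)             ≡⟨ cong -_ (fromℕ-+ (suc m) (suc n)) ⟩
      - (fromℕ (suc m) + fromℕ (suc n))     ≡⟨ -‿+-comm _ _ ⟨
      (- fromℕ (suc m)) + (- fromℕ (suc n)) ∎
      where open ≡-Reasoning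

    fromℤ-neg : ∀ i → fromℤ (ℤ.- i) ≡ - fromℤ i
    fromℤ-neg (ℤ.+ zero)  = sym -0#≈0#
    fromℤ-neg (ℤ.+ suc n) = refl
    fromℤ-neg -[1+ n ]  = sym (-‿involutive _)

    fromℤ-*⁺ : ∀ m j → fromℤ ((ℤ.+ m) ℤ.* j) ≡ fromℕ m * fromℤ j
    fromℤ-*⁺ zero    j = sym (zeroˡ _)
    fromℤ-*⁺ (suc m) j = begin
      fromℤ ((ℤ.+ suc m) ℤ.* j)              ≡⟨ cong fromℤ (ℤₚ.suc-* (ℤ.+ m) j) ⟩
      fromℤ (j ℤ.+ (ℤ.+ m) ℤ.* j)            ≡⟨ fromℤ-+ j ((ℤ.+ m) ℤ.* j) ⟩
      fromℤ j + fromℤ ((ℤ.+ m) ℤ.* j)        ≡⟨ cong₂ _+_ (sym (*-identityˡ _)) (fromℤ-*⁺ m j) ⟩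
      1# * fromℤ j + fromℕ m * fromℤ j   ≡⟨ distribʳ _ _ _ ⟨
      (1# + fromℕ m) * fromℤ j           ∎
      where open ≡-Reasoning

    fromℤ-* : ∀ i j → fromℤ (i ℤ.* j) ≡ fromℤ i * fromℤ j
    fromℤ-* (ℤ.+ m)    j = fromℤ-*⁺ m j
    fromℤ-* -[1+ m ] j = begin
      fromℤ (-[1+ m ] ℤ.* j)       ≡⟨ cong fromℤ (ℤₚ.neg-distribˡ-* (ℤ.+ suc m) j) ⟨
      fromℤ (ℤ.- ((ℤ.+ suc m) ℤ.* j))  ≡⟨ fromℤ-neg ((ℤ.+ suc m) ℤ.* j) ⟩
      - fromℤ ((ℤ.+ suc m) ℤ.* j)      ≡⟨ cong -_ (fromℤ-*⁺ (suc m) j) ⟩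
      - (fromℕ (suc m) * fromℤ j)  ≡⟨ -‿distribˡ-* _ _ ⟩
      (- fromℕ (suc m)) * fromℤ j  ∎
      where open ≡-Reasoning

    almostCommutativeRing : ACR.AlmostCommutativeRing _ _
    almostCommutativeRing = ACR.fromCommutativeRing commutativeRing

    -- Agrees with fromℤ, but unlike fromℕ 1 the value at ℤ.+ 1 computes to 1#.
    ⟦_⟧ℤ : ℤ → ℝ
    ⟦ ℤ.+ 1 ⟧ℤ       = 1#
    ⟦ -[1+ 0 ] ⟧ℤ  = - 1#
    ⟦ i ⟧ℤ         = fromℤ i

    ⟦⟧ℤ≡fromℤ : ∀ i → ⟦ i ⟧ℤ ≡ fromℤ i
    ⟦⟧ℤ≡fromℤ (ℤ.+ 0)             = refl
    ⟦⟧ℤ≡fromℤ (ℤ.+ 1)             = sym (+-identityʳ 1#)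
    ⟦⟧ℤ≡fromℤ (ℤ.+ suc (suc n))   = refl
    ⟦⟧ℤ≡fromℤ -[1+ 0 ]          = cong -_ (sym (+-identityʳ 1#))
    ⟦⟧ℤ≡fromℤ -[1+ suc n ]      = refl

    homo₂ : ∀ (_∙_ : ℤ → ℤ → ℤ) (_∘_ : ℝ → ℝ → ℝ) → (∀ i j → fromℤ (i ∙ j) ≡ fromℤ i ∘ fromℤ j) →
            ∀ i j → ⟦ i ∙ j ⟧ℤ ≡ ⟦ i ⟧ℤ ∘ ⟦ j ⟧ℤ
    homo₂ _∙_ _∘_ homo i j =
      trans (⟦⟧ℤ≡fromℤ (i ∙ j)) (trans (homo i j) (sym (cong₂ _∘_ (⟦⟧ℤ≡fromℤ i) (⟦⟧ℤ≡fromℤ j))))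

    -- Integers serve as coefficients because their arithmetic and equality compute, unlike those of
    -- `ℝ`; identities between numerals are then settled by normalisation.
    ℤ-morphism : ℤ.+-*-rawRing -Raw-AlmostCommutative⟶ almostCommutativeRing
    ℤ-morphism = record
      { ⟦_⟧    = ⟦_⟧ℤ
      ; +-homo = homo₂ ℤ._+_ _+_ fromℤ-+
      ; *-homo = homo₂ ℤ._*_ _*_ fromℤ-*
      ; -‿homo = λ i → trans (⟦⟧ℤ≡fromℤ (ℤ.- i)) (trans (fromℤ-neg i) (cong -_ (sym (⟦⟧ℤ≡fromℤ i))))
      ; 0-homo = refl
      ; 1-homo = refl
      }

  open Algebra.Solver.Ring ℤ.+-*-rawRing almostCommutativeRing ℤ-morphism
    (λ i j → Maybe.map (cong ⟦_⟧ℤ) (dec⇒maybe (i ℤₚ.≟ j))) public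
    using (Polynomial; solve; _:+_; _:*_; _:-_; :-_; _:=_; con)

  -- `lit 1` denotes `1#` and every other `lit n` denotes `fromℕ n`. As `fromℕ 1` unfolds to
  -- `1# + 0#`, it is written `lit 1 :+ lit 0` in the goals below.
  lit : ∀ {n} → ℕ → Polynomial n
  lit n = con (ℤ.+ n)

  open IsDecTotalOrder isDecTotalOrder public
    using (antisym; total; isPartialOrder)
    renaming (refl to ≤-refl; trans to ≤-trans; reflexive to ≤-reflexive; _≟_ to _≟ℝ_)

  poset : Poset _ _ _
  poset = record { isPartialOrder = isPartialOrder }

  module ≤-Reasoning where
    open import Relation.Binary.Reasoning.PartialOrder poset public
      hiding (step-≈; step-≈˘; step-≈-⟩; step-≈-⟨)

  +-mono-≤ : ∀ {a b c d} → a ≤ b → c ≤ d → a + c ≤ b + d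
  +-mono-≤ {a} {b} {c} {d} a≤b c≤d = begin
    a + c ≤⟨ +-monoˡ-≤ c a≤b ⟩
    b + c ≡⟨ +-comm b c ⟩
    c + b ≤⟨ +-monoˡ-≤ b c≤d ⟩
    d + b ≡⟨ +-comm d b ⟩
    b + d ∎
    where open ≤-Reasoning

  +-monoʳ-≤ : ∀ z {x y} → x ≤ y → z + x ≤ z + y
  +-monoʳ-≤ z = +-mono-≤ ≤-refl

  +-nonneg : ∀ {a b} → 0# ≤ a → 0# ≤ b → 0# ≤ a + b
  +-nonneg 0≤a 0≤b = ≤-trans (≤-reflexive (sym (+-identityˡ 0#))) (+-mono-≤ 0≤a 0≤b)

  x≤x+y : ∀ {x y} → 0# ≤ y → x ≤ x + y
  x≤x+y {x} 0≤y = ≤-trans (≤-reflexive (sym (+-identityʳ x))) (+-monoʳ-≤ x 0≤y)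

  x≤y+x : ∀ {x y} → 0# ≤ y → x ≤ y + x
  x≤y+x 0≤y = ≤-trans (x≤x+y 0≤y) (≤-reflexive (+-comm _ _))

  x≤y⇒0≤y-x : ∀ {x y} → x ≤ y → 0# ≤ y - x
  x≤y⇒0≤y-x {x} x≤y = ≤-trans (≤-reflexive (sym (-‿inverseʳ x))) (+-monoˡ-≤ (- x) x≤y)

  0≤y-x⇒x≤y : ∀ {x y} → 0# ≤ y - x → x ≤ y
  0≤y-x⇒x≤y {x} {y} 0≤y-x = begin
    x           ≤⟨ x≤y+x 0≤y-x ⟩
    (y - x) + x ≡⟨ solve 2 (λ x y → (y :- x) :+ x := y) refl x y ⟩
    y           ∎
    where open ≤-Reasoning

  x-y≤x : ∀ {x y} → 0# ≤ y → x - y ≤ x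
  x-y≤x {x} {y} 0≤y = 0≤y-x⇒x≤y
    (≤-trans 0≤y (≤-reflexive (solve 2 (λ x y → y := x :- (x :- y)) refl x y)))

  neg-mono-≤ : ∀ {x y} → x ≤ y → - y ≤ - x
  neg-mono-≤ {x} {y} x≤y = 0≤y-x⇒x≤y
    (≤-trans (x≤y⇒0≤y-x x≤y) (≤-reflexive (solve 2 (λ x y → y :- x := :- x :- (:- y)) refl x y)))

  *-monoˡ-≤ : ∀ {z x y} → 0# ≤ z → x ≤ y → z * x ≤ z * y
  *-monoˡ-≤ {z} {x} {y} 0≤z x≤y = 0≤y-x⇒x≤y
    (≤-trans (*-nonneg 0≤z (x≤y⇒0≤y-x x≤y))
             (≤-reflexive (solve 3 (λ x y z → z :* (y :- x) := z :* y :- z :* x) refl x y z)))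

  *-monoʳ-≤ : ∀ {z x y} → 0# ≤ z → x ≤ y → x * z ≤ y * z
  *-monoʳ-≤ {z} {x} {y} 0≤z x≤y =
    ≤-trans (≤-reflexive (*-comm x z)) (≤-trans (*-monoˡ-≤ 0≤z x≤y) (≤-reflexive (*-comm z y)))

  0≤1 : 0# ≤ 1#
  0≤1 with total 0# 1#
  ... | inj₁ 0≤1 = 0≤1
  ... | inj₂ 1≤0 = ≤-trans (*-nonneg 0≤-1 0≤-1) (≤-reflexive (solve 0 ((:- lit 1) :* (:- lit 1) := lit 1) refl))
    where
    0≤-1 : 0# ≤ - 1#
    0≤-1 = ≤-trans (x≤y⇒0≤y-x 1≤0) (≤-reflexive (+-identityˡ _))

  0<1 : 0# < 1#
  0<1 = 0≤1 , 0≢1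

  fromℕ-nonneg : ∀ n → 0# ≤ fromℕ n
  fromℕ-nonneg zero    = ≤-refl
  fromℕ-nonneg (suc n) = +-nonneg 0≤1 (fromℕ-nonneg n)

  fromℕ-mono : ∀ {m n} → m ℕ.≤ n → fromℕ m ≤ fromℕ n
  fromℕ-mono {n = n} ℕ.z≤n = fromℕ-nonneg n
  fromℕ-mono (ℕ.s≤s m≤n)   = +-monoʳ-≤ 1# (fromℕ-mono m≤n)

  fromℕ-1 : fromℕ 1 ≡ 1#
  fromℕ-1 = +-identityʳ 1#

  1≤fromℕ : ∀ {n} → 1 ℕ.≤ n → 1# ≤ fromℕ n
  1≤fromℕ 1≤n = ≤-trans (≤-reflexive (sym fromℕ-1)) (fromℕ-mono 1≤n)

  <-≤-trans : ∀ {x y z} → x < y → y ≤ z → x < z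
  <-≤-trans {x} (x≤y , x≢y) y≤z =
    ≤-trans x≤y y≤z , λ x≡z → x≢y (antisym x≤y (subst (_ ≤_) (sym x≡z) y≤z))

  ≰⇒≥ : ∀ {x y} → ¬ x ≤ y → y ≤ x
  ≰⇒≥ {x} {y} x≰y with total x y
  ... | inj₁ x≤y = contradiction x≤y x≰y
  ... | inj₂ y≤x = y≤x

  <⇒≢0 : ∀ {x} → 0# < x → x ≢ 0#
  <⇒≢0 (_ , 0≢x) x≡0 = 0≢x (sym x≡0)

  *-pos : ∀ {x y} → 0# < x → 0# < y → 0# < x * y
  *-pos {x} {y} 0<x@(0≤x , _) (0≤y , 0≢y) = *-nonneg 0≤x 0≤y , λ 0≡xy → 0≢y (begin
    0#              ≡⟨ zeroʳ (x ⁻¹) ⟨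
    x ⁻¹ * 0#       ≡⟨ cong (x ⁻¹ *_) 0≡xy ⟩
    x ⁻¹ * (x * y)  ≡⟨ solve 3 (λ x′ x y → x′ :* (x :* y) := (x :* x′) :* y) refl (x ⁻¹) x y ⟩
    (x * x ⁻¹) * y  ≡⟨ cong (_* y) (*-inverseʳ x (<⇒≢0 0<x)) ⟩
    1# * y          ≡⟨ *-identityˡ y ⟩
    y               ∎)
    where open ≡-Reasoning

  ⁻¹-nonneg : ∀ {x} → 0# ≤ x → 0# ≤ x ⁻¹
  ⁻¹-nonneg {x} 0≤x with x ≟ℝ 0# | total 0# (x ⁻¹)
  ... | yes x≡0 | _           = ≤-reflexive (sym (trans (cong _⁻¹ x≡0) 0⁻¹))
  ... | no  _   | inj₁ 0≤x⁻¹  = 0≤x⁻¹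
  ... | no  x≢0 | inj₂ x⁻¹≤0  = contradiction (antisym 0≤1 (begin
    1#        ≡⟨ *-inverseʳ x x≢0 ⟨
    x * x ⁻¹  ≤⟨ *-monoˡ-≤ 0≤x x⁻¹≤0 ⟩
    x * 0#    ≡⟨ zeroʳ x ⟩
    0#        ∎)) 0≢1
    where open ≤-Reasoning

  /-nonneg : ∀ {x y} → 0# ≤ x → 0# ≤ y → 0# ≤ x / y
  /-nonneg 0≤x 0≤y = *-nonneg 0≤x (⁻¹-nonneg 0≤y)

  y*[x/y]≡x : ∀ {x y} → y ≢ 0# → y * (x / y) ≡ x
  y*[x/y]≡x {x} {y} y≢0 = begin
    y * (x * y ⁻¹) ≡⟨ solve 3 (λ x y y′ → y :* (x :* y′) := (y :* y′) :* x) refl x y (y ⁻¹) ⟩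
    (y * y ⁻¹) * x ≡⟨ cong (_* x) (*-inverseʳ y y≢0) ⟩
    1# * x         ≡⟨ *-identityˡ x ⟩
    x              ∎
    where open ≡-Reasoning

  *-cancelˡ : ∀ {z x y} → z ≢ 0# → z * x ≡ z * y → x ≡ y
  *-cancelˡ {z} {x} {y} z≢0 eq = trans (sym (lem x)) (trans (cong (z ⁻¹ *_) eq) (lem y))
    where
    lem : ∀ w → z ⁻¹ * (z * w) ≡ w
    lem w = trans (solve 3 (λ z z′ w → z′ :* (z :* w) := z :* (w :* z′)) refl z (z ⁻¹) w) (y*[x/y]≡x z≢0)

  *-cancelˡ-≤ : ∀ {z x y} → 0# < z → z * x ≤ z * y → x ≤ y
  *-cancelˡ-≤ {z} {x} {y} 0<z@(0≤z , _) zx≤zy with total x y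
  ... | inj₁ x≤y = x≤y
  ... | inj₂ y≤x = ≤-reflexive (*-cancelˡ (<⇒≢0 0<z) (antisym zx≤zy (*-monoˡ-≤ 0≤z y≤x)))

  /-* : ∀ x {y z} → y ≢ 0# → z ≢ 0# → x / (y * z) ≡ x / y / z
  /-* x {y} {z} y≢0 z≢0 = *-cancelˡ y≢0 (*-cancelˡ z≢0 (begin
    z * (y * (x / (y * z)))  ≡⟨ solve 3 (λ y z w → z :* (y :* w) := (y :* z) :* w) refl y z (x / (y * z)) ⟩
    (y * z) * (x / (y * z))  ≡⟨ y*[x/y]≡x yz≢0 ⟩
    x                        ≡⟨ y*[x/y]≡x y≢0 ⟨
    y * (x / y)              ≡⟨ cong (y *_) (y*[x/y]≡x z≢0) ⟨
    y * (z * (x / y / z))    ≡⟨ solve 3 (λ y z w → y :* (z :* w) := z :* (y :* w)) refl y z (x / y / z) ⟩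
    z * (y * (x / y / z))    ∎))
    where
    open ≡-Reasoning
    yz≢0 : y * z ≢ 0#
    yz≢0 yz≡0 = z≢0 (*-cancelˡ y≢0 (trans yz≡0 (sym (zeroʳ y))))

  x≤zy⇒x/y≤z : ∀ {x y z} → 0# < y → x ≤ z * y → x / y ≤ z
  x≤zy⇒x/y≤z {x} {y} {z} 0<y@(0≤y , _) x≤zy = begin
    x / y        ≤⟨ *-monoʳ-≤ (⁻¹-nonneg 0≤y) x≤zy ⟩
    z * y * y ⁻¹ ≡⟨ *-assoc z y (y ⁻¹) ⟩
    z * (y / y)  ≡⟨ cong (z *_) (*-inverseʳ y (<⇒≢0 0<y)) ⟩
    z * 1#       ≡⟨ *-comm z 1# ⟩
    1# * z       ≡⟨ *-identityˡ z ⟩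
    z            ∎
    where open ≤-Reasoning

  clamp-nonneg : ∀ x → 0# ≤ clamp x
  clamp-nonneg x with x ≤? 0# | 1# ≤? x
  ... | yes _  | _     = ≤-refl
  ... | no _   | yes _ = 0≤1
  ... | no x≰0 | no _  = ≰⇒≥ x≰0

  clamp≤1 : ∀ x → clamp x ≤ 1#
  clamp≤1 x with x ≤? 0# | 1# ≤? x
  ... | yes _ | _      = 0≤1
  ... | no _  | yes _  = ≤-refl
  ... | no _  | no 1≰x = ≰⇒≥ 1≰x

  clamp-mixture-nonneg : ∀ x {a b} → 0# ≤ a → 0# ≤ b → 0# ≤ clamp x * a + (1# - clamp x) * b
  clamp-mixture-nonneg x 0≤a 0≤b =
    +-nonneg (*-nonneg (clamp-nonneg x) 0≤a) (*-nonneg (x≤y⇒0≤y-x (clamp≤1 x)) 0≤b)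

  clamp-id : ∀ {x} → 0# ≤ x → x ≤ 1# → clamp x ≡ x
  clamp-id {x} 0≤x x≤1 with x ≤? 0# | 1# ≤? x
  ... | yes x≤0 | _       = antisym 0≤x x≤0
  ... | no _    | yes 1≤x = antisym 1≤x x≤1
  ... | no _    | no _    = refl

-- Finite sums, products and indicators.

map-allFin : ∀ {X : Set} n (f : Fin (suc n) → X) →
             map f (allFin (suc n)) ≡ f zero ∷ map (f ∘ suc) (allFin n)
map-allFin n f = cong (f zero ∷_)
  (trans (Listₚ.map-tabulate suc f) (sym (Listₚ.map-tabulate id (f ∘ suc))))

module FiniteSums (𝓡 : Reals) where
  open Reals 𝓡
  open OrderedField 𝓡
  private
    variable
      X Y : Set

    _∈?_ : ∀ {n} (x : Fin n) (xs : List (Fin n)) → Dec (x ∈ xs)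
    _∈?_ = DecMembership._∈?_ Finₚ._≟_

  𝟙 : {P : Set} → Dec P → ℝ
  𝟙 P? = if does P? then 1# else 0#

  𝟙-yes : {P : Set} (P? : Dec P) → P → 𝟙 P? ≡ 1#
  𝟙-yes (yes _) _ = refl
  𝟙-yes (no ¬p) p = contradiction p ¬p

  𝟙-no : {P : Set} (P? : Dec P) → ¬ P → 𝟙 P? ≡ 0#
  𝟙-no (yes p) ¬p = contradiction p ¬p
  𝟙-no (no _)  _  = refl

  𝟙-nonneg : {P : Set} (P? : Dec P) → 0# ≤ 𝟙 P?
  𝟙-nonneg (yes _) = 0≤1
  𝟙-nonneg (no _)  = ≤-refl

  𝟙-⇔ : {P Q : Set} (P? : Dec P) (Q? : Dec Q) → (P → Q) → (Q → P) → 𝟙 P? ≡ 𝟙 Q?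
  𝟙-⇔ (yes p) Q? f g = sym (𝟙-yes Q? (f p))
  𝟙-⇔ (no ¬p) Q? f g = sym (𝟙-no Q? (¬p ∘ g))

  ∑-cong : {f g : X → ℝ} (xs : List X) → (∀ x → f x ≡ g x) → ∑ (map f xs) ≡ ∑ (map g xs)
  ∑-cong xs f≗g = cong ∑ (Listₚ.map-cong f≗g xs)

  ∑-++ : ∀ as bs → ∑ (as ++ bs) ≡ ∑ as + ∑ bs
  ∑-++ []       bs = sym (+-identityˡ _)
  ∑-++ (a ∷ as) bs = trans (cong (a +_) (∑-++ as bs)) (sym (+-assoc a _ _))

  ∑-0 : (xs : List X) → ∑ (map (λ _ → 0#) xs) ≡ 0#
  ∑-0 []       = refl
  ∑-0 (x ∷ xs) = trans (+-identityˡ _) (∑-0 xs)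

  ∑-+ : (f g : X → ℝ) (xs : List X) →
        ∑ (map (λ x → f x + g x) xs) ≡ ∑ (map f xs) + ∑ (map g xs)
  ∑-+ f g []       = sym (+-identityˡ 0#)
  ∑-+ f g (x ∷ xs) = trans (cong (f x + g x +_) (∑-+ f g xs))
    (solve 4 (λ a b c d → a :+ b :+ (c :+ d) := (a :+ c) :+ (b :+ d)) refl (f x) (g x) _ _)

  ∑-*ˡ : ∀ c (f : X → ℝ) (xs : List X) → ∑ (map (λ x → c * f x) xs) ≡ c * ∑ (map f xs)
  ∑-*ˡ c f []       = sym (zeroʳ c)
  ∑-*ˡ c f (x ∷ xs) = trans (cong (c * f x +_) (∑-*ˡ c f xs)) (sym (distribˡ c _ _))

  ∑-*ʳ : ∀ c (f : X → ℝ) (xs : List X) → ∑ (map (λ x → f x * c) xs) ≡ ∑ (map f xs) * c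
  ∑-*ʳ c f xs = trans (∑-cong xs (λ x → *-comm (f x) c)) (trans (∑-*ˡ c f xs) (*-comm c _))

  ∑-swap : (f : X → Y → ℝ) (xs : List X) (ys : List Y) →
           ∑ (map (λ x → ∑ (map (f x) ys)) xs) ≡ ∑ (map (λ y → ∑ (map (λ x → f x y) xs)) ys)
  ∑-swap f []       ys = sym (∑-0 ys)
  ∑-swap f (x ∷ xs) ys = trans (cong (∑ (map (f x) ys) +_) (∑-swap f xs ys))
                               (sym (∑-+ (f x) _ ys))

  ∑-mono : {f g : X → ℝ} (xs : List X) → (∀ x → f x ≤ g x) → ∑ (map f xs) ≤ ∑ (map g xs)
  ∑-mono []       f≤g = ≤-refl
  ∑-mono (x ∷ xs) f≤g = +-mono-≤ (f≤g x) (∑-mono xs f≤g)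

  ∑-nonneg : {f : X → ℝ} (xs : List X) → (∀ x → 0# ≤ f x) → 0# ≤ ∑ (map f xs)
  ∑-nonneg []       0≤f = ≤-refl
  ∑-nonneg (x ∷ xs) 0≤f = +-nonneg (0≤f x) (∑-nonneg xs 0≤f)

  term≤∑ : {f : X → ℝ} {xs : List X} {x : X} → (∀ x → 0# ≤ f x) → x ∈ xs → f x ≤ ∑ (map f xs)
  term≤∑ {xs = _ ∷ xs} 0≤f (here refl)  = x≤x+y (∑-nonneg xs 0≤f)
  term≤∑ {xs = y ∷ _}  0≤f (there x∈xs) = ≤-trans (term≤∑ 0≤f x∈xs) (x≤y+x (0≤f y))

  ∑-filter : {P : X → Set} (P? : Decidable P) (f : X → ℝ) (xs : List X) →
             ∑ (map f (filter P? xs)) ≡ ∑ (map (λ x → 𝟙 (P? x) * f x) xs)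
  ∑-filter P? f []       = refl
  ∑-filter P? f (x ∷ xs) with P? x
  ... | yes _ = cong₂ _+_ (sym (*-identityˡ _)) (∑-filter P? f xs)
  ... | no  _ = trans (∑-filter P? f xs)
    (sym (trans (cong (_+ ∑ (map (λ x → 𝟙 (P? x) * f x) xs)) (zeroˡ (f x))) (+-identityˡ _)))

  ∑-allFin : ∀ n (f : Fin (suc n) → ℝ) →
             ∑ (map f (allFin (suc n))) ≡ f zero + ∑ (map (f ∘ suc) (allFin n))
  ∑-allFin n f = cong ∑ (map-allFin n f)

  ∑-𝟙 : ∀ {n} (f : Fin n → ℝ) (a : Fin n) → ∑ (map (λ x → 𝟙 (x Finₚ.≟ a) * f x) (allFin n)) ≡ f a
  ∑-𝟙 {suc n} f zero = begin
    ∑ (map (λ x → 𝟙 (x Finₚ.≟ zero) * f x) (allFin (suc n)))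
      ≡⟨ ∑-allFin n _ ⟩
    1# * f zero + ∑ (map (λ x → 0# * f (suc x)) (allFin n))
      ≡⟨ cong₂ _+_ (*-identityˡ _) (trans (∑-cong (allFin n) (λ x → zeroˡ _)) (∑-0 (allFin n))) ⟩
    f zero + 0#
      ≡⟨ +-identityʳ _ ⟩
    f zero ∎
    where open ≡-Reasoning
  ∑-𝟙 {suc n} f (suc a) = begin
    ∑ (map (λ x → 𝟙 (x Finₚ.≟ suc a) * f x) (allFin (suc n)))
      ≡⟨ ∑-allFin n _ ⟩
    0# * f zero + ∑ (map (λ x → 𝟙 (suc x Finₚ.≟ suc a) * f (suc x)) (allFin n))
      ≡⟨ cong₂ _+_ (zeroˡ _) (∑-cong (allFin n) (λ x → cong (_* f (suc x))
           (𝟙-⇔ (suc x Finₚ.≟ suc a) (x Finₚ.≟ a) Finₚ.suc-injective (cong suc)))) ⟩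
    0# + ∑ (map (λ x → 𝟙 (x Finₚ.≟ a) * f (suc x)) (allFin n))
      ≡⟨ +-identityˡ _ ⟩
    ∑ (map (λ x → 𝟙 (x Finₚ.≟ a) * f (suc x)) (allFin n))
      ≡⟨ ∑-𝟙 (f ∘ suc) a ⟩
    f (suc a) ∎
    where open ≡-Reasoning

  ∑-cartesianProduct : {Z : Set} (_∙_ : X → Y → Z) (f : Z → ℝ) (xs : List X) (ys : List Y) →
    ∑ (map f (cartesianProductWith _∙_ xs ys)) ≡ ∑ (map (λ x → ∑ (map (λ y → f (x ∙ y)) ys)) xs)
  ∑-cartesianProduct _∙_ f []       ys = refl
  ∑-cartesianProduct _∙_ f (x ∷ xs) ys = begin
    ∑ (map f (map (x ∙_) ys ++ cartesianProductWith _∙_ xs ys))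
      ≡⟨ cong ∑ (Listₚ.map-++ f (map (x ∙_) ys) _) ⟩
    ∑ (map f (map (x ∙_) ys) ++ map f (cartesianProductWith _∙_ xs ys))
      ≡⟨ ∑-++ (map f (map (x ∙_) ys)) _ ⟩
    ∑ (map f (map (x ∙_) ys)) + ∑ (map f (cartesianProductWith _∙_ xs ys))
      ≡⟨ cong₂ _+_ (cong ∑ (sym (Listₚ.map-∘ ys))) (∑-cartesianProduct _∙_ f xs ys) ⟩
    ∑ (map (λ y → f (x ∙ y)) ys) + ∑ (map (λ x → ∑ (map (λ y → f (x ∙ y)) ys)) xs) ∎
    where open ≡-Reasoning

  ∑-configurations : ∀ q n (f : Vec (Fin q) (suc n) → ℝ) →
    ∑ (map f (configurations q (suc n))) ≡
    ∑ (map (λ c → ∑ (map (λ σ → f (c Vec.∷ σ)) (configurations q n))) (allFin q))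
  ∑-configurations q n f = ∑-cartesianProduct Vec._∷_ f (allFin q) (configurations q n)

  ∑-configurations-𝟙 : ∀ {q k} (τ : Vec (Fin q) k) →
    ∑ (map (λ τ′ → 𝟙 (Vecₚ.≡-dec Finₚ._≟_ τ τ′)) (configurations q k)) ≡ 1#
  ∑-configurations-𝟙 {q} Vec.[] = +-identityʳ 1#
  ∑-configurations-𝟙 {q} {suc k} (c Vec.∷ τ) = begin
    ∑ (map (λ τ′ → 𝟙 (Vecₚ.≡-dec Finₚ._≟_ (c Vec.∷ τ) τ′)) (configurations q (suc k)))
      ≡⟨ ∑-configurations q k _ ⟩
    ∑ (map (λ c′ → ∑ (map (λ τ′ → 𝟙 (Vecₚ.≡-dec Finₚ._≟_ (c Vec.∷ τ) (c′ Vec.∷ τ′))) S)) (allFin q))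
      ≡⟨ ∑-cong (allFin q) (λ c′ → trans (∑-cong S (split c′)) (∑-*ˡ _ _ S)) ⟩
    ∑ (map (λ c′ → 𝟙 (c′ Finₚ.≟ c) * ∑ (map (λ τ′ → 𝟙 (Vecₚ.≡-dec Finₚ._≟_ τ τ′)) S)) (allFin q))
      ≡⟨ ∑-𝟙 (λ _ → ∑ (map (λ τ′ → 𝟙 (Vecₚ.≡-dec Finₚ._≟_ τ τ′)) S)) c ⟩
    ∑ (map (λ τ′ → 𝟙 (Vecₚ.≡-dec Finₚ._≟_ τ τ′)) S)
      ≡⟨ ∑-configurations-𝟙 τ ⟩
    1# ∎
    where
    open ≡-Reasoning
    S = configurations q k
    split : ∀ c′ τ′ → 𝟙 (Vecₚ.≡-dec Finₚ._≟_ (c Vec.∷ τ) (c′ Vec.∷ τ′)) ≡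
                      𝟙 (c′ Finₚ.≟ c) * 𝟙 (Vecₚ.≡-dec Finₚ._≟_ τ τ′)
    split c′ τ′ with c′ Finₚ.≟ c
    ... | yes refl = trans (𝟙-⇔ (Vecₚ.≡-dec Finₚ._≟_ (c Vec.∷ τ) (c Vec.∷ τ′)) (Vecₚ.≡-dec Finₚ._≟_ τ τ′)
                                  Vecₚ.∷-injectiveʳ (cong (c Vec.∷_))) (sym (*-identityˡ _))
    ... | no  c′≢c = trans (𝟙-no (Vecₚ.≡-dec Finₚ._≟_ (c Vec.∷ τ) (c′ Vec.∷ τ′)) (c′≢c ∘ sym ∘ Vecₚ.∷-injectiveˡ))
                           (sym (zeroˡ _))

  -- Resampling the spin at v while recording the old one is an involution on
  -- (configuration, spin) pairs.
  ∑-resample : ∀ {q n} (v : Fin n) (h : Vec (Fin q) n → Fin q → ℝ) →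
    ∑ (map (λ σ → ∑ (map (λ x → h (σ [ v ]≔ x) (lookup σ v)) (allFin q))) (configurations q n)) ≡
    ∑ (map (λ σ → ∑ (map (h σ) (allFin q))) (configurations q n))
  ∑-resample {q} {suc n} zero h = begin
    ∑ (map (λ σ → ∑ (map (λ x → h (σ [ zero ]≔ x) (lookup σ zero)) Q)) (configurations q (suc n)))
      ≡⟨ ∑-configurations q n _ ⟩
    ∑ (map (λ y → ∑ (map (λ σ → ∑ (map (λ x → h (x Vec.∷ σ) y) Q)) S)) Q)
      ≡⟨ ∑-cong Q (λ y → ∑-swap (λ σ x → h (x Vec.∷ σ) y) S Q) ⟩
    ∑ (map (λ y → ∑ (map (λ x → ∑ (map (λ σ → h (x Vec.∷ σ) y) S)) Q)) Q)
      ≡⟨ ∑-swap _ Q Q ⟩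
    ∑ (map (λ x → ∑ (map (λ y → ∑ (map (λ σ → h (x Vec.∷ σ) y) S)) Q)) Q)
      ≡⟨ ∑-cong Q (λ x → ∑-swap (λ y σ → h (x Vec.∷ σ) y) Q S) ⟩
    ∑ (map (λ x → ∑ (map (λ σ → ∑ (map (h (x Vec.∷ σ)) Q)) S)) Q)
      ≡⟨ ∑-configurations q n _ ⟨
    ∑ (map (λ σ → ∑ (map (h σ) Q)) (configurations q (suc n))) ∎
    where
    open ≡-Reasoning
    Q = allFin q
    S = configurations q n
  ∑-resample {q} {suc n} (suc v) h = begin
    ∑ (map (λ σ → ∑ (map (λ x → h (σ [ suc v ]≔ x) (lookup σ (suc v))) Q)) (configurations q (suc n)))
      ≡⟨ ∑-configurations q n _ ⟩
    ∑ (map (λ y → ∑ (map (λ σ → ∑ (map (λ x → h (y Vec.∷ (σ [ v ]≔ x)) (lookup σ v)) Q)) S)) Q)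
      ≡⟨ ∑-cong Q (λ y → ∑-resample v (λ σ → h (y Vec.∷ σ))) ⟩
    ∑ (map (λ y → ∑ (map (λ σ → ∑ (map (h (y Vec.∷ σ)) Q)) S)) Q)
      ≡⟨ ∑-configurations q n _ ⟨
    ∑ (map (λ σ → ∑ (map (h σ) Q)) (configurations q (suc n))) ∎
    where
    open ≡-Reasoning
    Q = allFin q
    S = configurations q n

  ∏-cong : {f g : X → ℝ} (xs : List X) → (∀ x → f x ≡ g x) → ∏ (map f xs) ≡ ∏ (map g xs)
  ∏-cong xs f≗g = cong ∏ (Listₚ.map-cong f≗g xs)

  ∏-1 : (xs : List X) → ∏ (map (λ _ → 1#) xs) ≡ 1#
  ∏-1 []       = refl
  ∏-1 (x ∷ xs) = trans (*-identityˡ _) (∏-1 xs)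

  ∏-++ : ∀ as bs → ∏ (as ++ bs) ≡ ∏ as * ∏ bs
  ∏-++ []       bs = sym (*-identityˡ _)
  ∏-++ (a ∷ as) bs = trans (cong (a *_) (∏-++ as bs)) (sym (*-assoc a _ _))

  ∏-* : (f g : X → ℝ) (xs : List X) →
        ∏ (map (λ x → f x * g x) xs) ≡ ∏ (map f xs) * ∏ (map g xs)
  ∏-* f g []       = sym (*-identityˡ 1#)
  ∏-* f g (x ∷ xs) = trans (cong (f x * g x *_) (∏-* f g xs))
    (solve 4 (λ a b c d → a :* b :* (c :* d) := (a :* c) :* (b :* d)) refl (f x) (g x) _ _)

  ∏-pos : {f : X → ℝ} (xs : List X) → (∀ {x} → x ∈ xs → 0# < f x) → 0# < ∏ (map f xs)
  ∏-pos []       0<f = 0<1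
  ∏-pos (x ∷ xs) 0<f = *-pos (0<f (here refl)) (∏-pos xs (0<f ∘ there))

  ∏-nonneg : {f : X → ℝ} (xs : List X) → (∀ {x} → x ∈ xs → 0# ≤ f x) → 0# ≤ ∏ (map f xs)
  ∏-nonneg []       0≤f = 0≤1
  ∏-nonneg (x ∷ xs) 0≤f = *-nonneg (0≤f (here refl)) (∏-nonneg xs (0≤f ∘ there))

  ∏-concatMap : (f : Y → ℝ) (g : X → List Y) (xs : List X) →
                ∏ (map f (concatMap g xs)) ≡ ∏ (map (λ x → ∏ (map f (g x))) xs)
  ∏-concatMap f g []       = refl
  ∏-concatMap f g (x ∷ xs) = begin
    ∏ (map f (g x ++ concatMap g xs))              ≡⟨ cong ∏ (Listₚ.map-++ f (g x) _) ⟩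
    ∏ (map f (g x) ++ map f (concatMap g xs))      ≡⟨ ∏-++ (map f (g x)) _ ⟩
    ∏ (map f (g x)) * ∏ (map f (concatMap g xs))   ≡⟨ cong (∏ (map f (g x)) *_) (∏-concatMap f g xs) ⟩
    ∏ (map f (g x)) * ∏ (map (λ x → ∏ (map f (g x))) xs) ∎
    where open ≡-Reasoning

  ∏-allFin : ∀ n (f : Fin (suc n) → ℝ) →
             ∏ (map f (allFin (suc n))) ≡ f zero * ∏ (map (f ∘ suc) (allFin n))
  ∏-allFin n f = cong ∏ (map-allFin n f)

  -- Changing a single factor, in cross-multiplied form: `f v` and `g v` may be zero (external
  -- fields may vanish), so no quotient is taken.
  ∏-replace : ∀ {n} (v : Fin n) (f g : Fin n → ℝ) → (∀ u → u ≢ v → f u ≡ g u) →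
              ∏ (map f (allFin n)) * g v ≡ ∏ (map g (allFin n)) * f v
  ∏-replace {suc n} zero f g f≗g = begin
    ∏ (map f (allFin (suc n))) * g zero
      ≡⟨ cong (_* g zero) (∏-allFin n f) ⟩
    f zero * ∏ (map (f ∘ suc) (allFin n)) * g zero
      ≡⟨ cong (λ z → f zero * z * g zero) (∏-cong (allFin n) (λ u → f≗g (suc u) λ ())) ⟩
    f zero * ∏ (map (g ∘ suc) (allFin n)) * g zero
      ≡⟨ solve 3 (λ a b c → a :* b :* c := c :* b :* a) refl (f zero) _ (g zero) ⟩
    g zero * ∏ (map (g ∘ suc) (allFin n)) * f zero
      ≡⟨ cong (_* f zero) (∏-allFin n g) ⟨
    ∏ (map g (allFin (suc n))) * f zero ∎
    where open ≡-Reasoning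
  ∏-replace {suc n} (suc v) f g f≗g = begin
    ∏ (map f (allFin (suc n))) * g (suc v)
      ≡⟨ cong (_* g (suc v)) (∏-allFin n f) ⟩
    f zero * ∏ (map (f ∘ suc) (allFin n)) * g (suc v)
      ≡⟨ trans (*-assoc _ _ _) (cong₂ _*_ (f≗g zero λ ())
           (∏-replace v (f ∘ suc) (g ∘ suc) (λ u u≢v → f≗g (suc u) (u≢v ∘ Finₚ.suc-injective)))) ⟩
    g zero * (∏ (map (g ∘ suc) (allFin n)) * f (suc v))
      ≡⟨ *-assoc _ _ _ ⟨
    g zero * ∏ (map (g ∘ suc) (allFin n)) * f (suc v)
      ≡⟨ cong (_* f (suc v)) (∏-allFin n g) ⟨
    ∏ (map g (allFin (suc n))) * f (suc v) ∎
    where open ≡-Reasoning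

  ∏-single : ∀ {n} (v : Fin n) (f : Fin n → ℝ) → (∀ u → u ≢ v → f u ≡ 1#) →
             ∏ (map f (allFin n)) ≡ f v
  ∏-single {n} v f f≗1 = begin
    ∏ (map f (allFin n))               ≡⟨ *-identityˡ _ ⟨
    1# * ∏ (map f (allFin n))          ≡⟨ *-comm _ _ ⟩
    ∏ (map f (allFin n)) * 1#          ≡⟨ ∏-replace v f (λ _ → 1#) f≗1 ⟩
    ∏ (map (λ _ → 1#) (allFin n)) * f v ≡⟨ cong (_* f v) (∏-1 (allFin n)) ⟩
    1# * f v                           ≡⟨ *-identityˡ _ ⟩
    f v                                ∎
    where open ≡-Reasoning

  -- The multiplicative counterpart of `𝟙`: a missing factor is 1, so a product over a sublist
  -- becomes a product over all of `Fin n`.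
  guard : {P : Set} → Dec P → ℝ → ℝ
  guard P? x = if does P? then x else 1#

  guard-yes : {P : Set} (P? : Dec P) {x : ℝ} → P → guard P? x ≡ x
  guard-yes (yes _) _ = refl
  guard-yes (no ¬p) p = contradiction p ¬p

  guard-no : {P : Set} (P? : Dec P) {x : ℝ} → ¬ P → guard P? x ≡ 1#
  guard-no (yes p) ¬p = contradiction p ¬p
  guard-no (no _)  _  = refl

  guard-elim : (B : ℝ → Set) {P : Set} (P? : Dec P) {x : ℝ} → (P → B x) → B 1# → B (guard P? x)
  guard-elim B (yes p) Bx B1 = Bx p
  guard-elim B (no _)  Bx B1 = B1

  ∏-filter : {P : X → Set} (P? : Decidable P) (f : X → ℝ) (xs : List X) →
             ∏ (map f (filter P? xs)) ≡ ∏ (map (λ x → guard (P? x) (f x)) xs)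
  ∏-filter P? f []       = refl
  ∏-filter P? f (x ∷ xs) with P? x
  ... | yes _ = cong (f x *_) (∏-filter P? f xs)
  ... | no  _ = trans (∏-filter P? f xs) (sym (*-identityˡ _))

  ∏-unique : ∀ {n} {xs : List (Fin n)} → List.Unique xs → (f : Fin n → ℝ) →
             ∏ (map f xs) ≡ ∏ (map (λ w → guard (w ∈? xs) (f w)) (allFin n))
  ∏-unique {n} [] f = sym (∏-1 (allFin n))
  ∏-unique {n} {x ∷ xs} (x∉xs ∷ uniq) f = begin
    f x * ∏ (map f xs)
      ≡⟨ cong₂ _*_ (sym (trans (∏-single x at-x (λ w w≢x → guard-no (w Finₚ.≟ x) w≢x)) (guard-yes (x Finₚ.≟ x) refl)))
                   (∏-unique uniq f) ⟩
    ∏ (map at-x (allFin n)) * ∏ (map (λ w → guard (w ∈? xs) (f w)) (allFin n))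
      ≡⟨ ∏-* at-x _ (allFin n) ⟨
    ∏ (map (λ w → at-x w * guard (w ∈? xs) (f w)) (allFin n))
      ≡⟨ ∏-cong (allFin n) split ⟩
    ∏ (map (λ w → guard (w ∈? (x ∷ xs)) (f w)) (allFin n)) ∎
    where
    open ≡-Reasoning
    at-x : Fin n → ℝ
    at-x w = guard (w Finₚ.≟ x) (f w)
    split : ∀ w → at-x w * guard (w ∈? xs) (f w) ≡ guard (w ∈? (x ∷ xs)) (f w)
    split w with w Finₚ.≟ x
    ... | yes refl = trans (cong (f w *_) (guard-no (w ∈? xs) λ w∈xs → All.lookup x∉xs w∈xs refl))
                           (*-identityʳ _)
    ... | no w≢x with w ∈? xs
    ...   | yes _ = *-identityˡ _
    ...   | no  _ = *-identityˡ _

∈-configurations : ∀ {q n} (σ : Vec (Fin q) n) → σ ∈ configurations q n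
∈-configurations Vec.[]      = here refl
∈-configurations (c Vec.∷ σ) = ∈-cartesianProductWith⁺ Vec._∷_ (∈-allFin c) (∈-configurations σ)

-- The Glauber kernel and its stationarity under the Gibbs distribution.

module Hypotheses (𝓡 : Reals) where
  open Reals 𝓡
  open Sampling 𝓡

  -- Enough for the Glauber kernels to exist and be stationary; the coins of the sampler rest on
  -- `NearlyFree`. Fields may vanish at some spins, edge factors may not.
  record Positive {q : ℕ} (𝓢 : SpinSystem q) : Set where
    open SpinSystem 𝓢
    field
      ∑λ≡1  : ∀ v → ∑ (map (field-λ v) (allFin q)) ≡ 1#
      A-pos : ∀ {v u} → u ∈ neighbours v → ∀ a b → 0# < A v u a b

  record NearlyFree {q : ℕ} (𝓢 : SpinSystem q) (θ : ℝ) : Set where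
    open SpinSystem 𝓢
    field
      positive : Positive 𝓢
      A≤1      : ∀ {v u} → u ∈ neighbours v → ∀ a b → A v u a b ≤ 1#
      1-A≤θ    : ∀ {v u} → u ∈ neighbours v → ∀ a b → 1# - A v u a b ≤ θ
      0≤θ      : 0# ≤ θ
      θ≤1      : θ ≤ 1#

module Glauber (𝓡 : Reals) {q : ℕ} (𝓢 : Sampling.SpinSystem 𝓡 q) (positive : Hypotheses.Positive 𝓡 𝓢) where
  open Reals 𝓡
  open Sampling 𝓡
  open SpinSystem 𝓢
  open Hypotheses.Positive positive
  open OrderedField 𝓡
  open FiniteSums 𝓡

  likelihood : V → Fin q → Config → ℝ
  likelihood v c σ = ∏ (map (λ u → A v u c (lookup σ u)) (neighbours v))

  normalizer : V → Config → ℝ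
  normalizer v σ = ∑ (map (λ c → field-λ v c * likelihood v c σ) (allFin q))

  -- The heat-bath update: the conditional law of the spin at `v` given the spins of its neighbours.
  glauber : V → Config → Fin q → ℝ
  glauber v σ x = field-λ v x * likelihood v x σ / normalizer v σ

  likelihood-pos : ∀ v c σ → 0# < likelihood v c σ
  likelihood-pos v c σ = ∏-pos (neighbours v) (λ u∈N → A-pos u∈N c _)

  -- The entries of a field sum to 1, so they are not all zero; decidable equality on `ℝ` turns this
  -- into a search through the spins.
  likely-spin : ∀ v → ∃ λ c → 0# < field-λ v c
  likely-spin v with Finₚ.¬∀⟶∃¬ q (λ c → field-λ v c ≡ 0#) (λ c → field-λ v c ≟ℝ 0#) not-all-0
    where
    not-all-0 : ¬ (∀ c → field-λ v c ≡ 0#)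
    not-all-0 λ≡0 = 0≢1 (trans (sym (trans (∑-cong (allFin q) λ≡0) (∑-0 (allFin q)))) (∑λ≡1 v))
  ... | c , λ≢0 = c , λ-nonneg v c , λ≢0 ∘ sym

  normalizer-pos : ∀ v σ → 0# < normalizer v σ
  normalizer-pos v σ with likely-spin v
  ... | c , 0<λ = <-≤-trans (*-pos 0<λ (likelihood-pos v c σ))
    (term≤∑ (λ c → *-nonneg (λ-nonneg v c) (proj₁ (likelihood-pos v c σ))) (∈-allFin c))

  glauber-nonneg : ∀ v σ x → 0# ≤ glauber v σ x
  glauber-nonneg v σ x =
    /-nonneg (*-nonneg (λ-nonneg v x) (proj₁ (likelihood-pos v x σ))) (proj₁ (normalizer-pos v σ))

  ∑-glauber : ∀ v σ → ∑ (map (glauber v σ) (allFin q)) ≡ 1#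
  ∑-glauber v σ = trans (∑-*ʳ _ _ (allFin q)) (*-inverseʳ _ (<⇒≢0 (normalizer-pos v σ)))

  likelihood-[]≔ : ∀ v c σ x → likelihood v c (σ [ v ]≔ x) ≡ likelihood v c σ
  likelihood-[]≔ v c σ x = go (neighbours v) (loopless v)
    where
    go : ∀ us → v ∉ us → ∏ (map (λ u → A v u c (lookup (σ [ v ]≔ x) u)) us) ≡
                         ∏ (map (λ u → A v u c (lookup σ u)) us)
    go []       v∉us = refl
    go (u ∷ us) v∉us = cong₂ _*_ (cong (A v u c) (Vecₚ.lookup∘update′ (v∉us ∘ here ∘ sym) σ x)) (go us (v∉us ∘ there))

  normalizer-[]≔ : ∀ v σ x → normalizer v (σ [ v ]≔ x) ≡ normalizer v σ
  normalizer-[]≔ v σ x = ∑-cong (allFin q) (λ c → cong (field-λ v c *_) (likelihood-[]≔ v c σ x))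

  glauber-[]≔ : ∀ v σ x y → glauber v (σ [ v ]≔ x) y ≡ glauber v σ y
  glauber-[]≔ v σ x y = cong₂ _/_ (cong (field-λ v y *_) (likelihood-[]≔ v y σ x)) (normalizer-[]≔ v σ x)

  private
    _∈?_ : (v : V) (vs : List V) → Dec (v ∈ vs)
    _∈?_ = DecMembership._∈?_ Finₚ._≟_

    -- Entry (u , w) of a square matrix of factors: the interaction if uw is an edge oriented from u
    -- to w, and 1 otherwise. Edge weights become products over all ordered pairs, in which one row
    -- and one column can be isolated.
    pair : Config → V → V → ℝ
    pair σ u w = guard (w ∈? neighbours u) (guard (u Finₚ.<? w) (A u w (lookup σ u) (lookup σ w)))

    pair-loop : ∀ σ v → pair σ v v ≡ 1#
    pair-loop σ v = guard-no (v ∈? neighbours v) (loopless v)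

    edges-pairs : ∀ σ → ∏ (map (λ (u , w) → A u w (lookup σ u) (lookup σ w)) edges) ≡
                        ∏ (map (λ u → ∏ (map (pair σ u) (allFin order))) (allFin order))
    edges-pairs σ = trans (∏-concatMap _ _ (allFin order)) (∏-cong (allFin order) row)
      where
      row : ∀ u → ∏ (map (λ (u , w) → A u w (lookup σ u) (lookup σ w))
                         (map (u ,_) (filter (u Finₚ.<?_) (neighbours u)))) ≡
                  ∏ (map (pair σ u) (allFin order))
      row u = begin
        ∏ (map (λ (u , w) → A u w (lookup σ u) (lookup σ w)) (map (u ,_) (filter (u Finₚ.<?_) (neighbours u))))
          ≡⟨ cong ∏ (Listₚ.map-∘ (filter (u Finₚ.<?_) (neighbours u))) ⟨
        ∏ (map (λ w → A u w (lookup σ u) (lookup σ w)) (filter (u Finₚ.<?_) (neighbours u)))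
          ≡⟨ ∏-filter (u Finₚ.<?_) _ (neighbours u) ⟩
        ∏ (map (λ w → guard (u Finₚ.<? w) (A u w (lookup σ u) (lookup σ w))) (neighbours u))
          ≡⟨ ∏-unique (unique u) _ ⟩
        ∏ (map (pair σ u) (allFin order)) ∎
        where open ≡-Reasoning

    -- Each neighbour w contributes to exactly one of the entries (v , w) and (w , v), according to
    -- the order of v and w; `A-transpose` matches the second case.
    likelihood-pairs : ∀ σ v → likelihood v (lookup σ v) σ ≡
                       ∏ (map (λ w → pair σ v w) (allFin order)) * ∏ (map (λ w → pair σ w v) (allFin order))
    likelihood-pairs σ v = begin
      ∏ (map (λ w → A v w (lookup σ v) (lookup σ w)) (neighbours v))
        ≡⟨ ∏-unique (unique v) _ ⟩
      ∏ (map (λ w → guard (w ∈? neighbours v) (A v w (lookup σ v) (lookup σ w))) (allFin order))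
        ≡⟨ ∏-cong (allFin order) split ⟩
      ∏ (map (λ w → pair σ v w * pair σ w v) (allFin order))
        ≡⟨ ∏-* _ _ (allFin order) ⟩
      ∏ (map (λ w → pair σ v w) (allFin order)) * ∏ (map (λ w → pair σ w v) (allFin order)) ∎
      where
      open ≡-Reasoning
      split : ∀ w → guard (w ∈? neighbours v) (A v w (lookup σ v) (lookup σ w)) ≡ pair σ v w * pair σ w v
      split w with w ∈? neighbours v
      ... | no w∉N = sym (trans (*-identityˡ _) (guard-no (v ∈? neighbours w) (w∉N ∘ symmetric)))
      ... | yes w∈N with Finₚ.<-cmp v w
      ...   | tri< v<w _ w≮v = sym (begin
              guard (v Finₚ.<? w) a * guard (v ∈? neighbours w) (guard (w Finₚ.<? v) b)
                ≡⟨ cong₂ _*_ (guard-yes (v Finₚ.<? w) v<w)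
                     (trans (guard-yes (v ∈? neighbours w) (symmetric w∈N)) (guard-no (w Finₚ.<? v) w≮v)) ⟩
              a * 1#  ≡⟨ *-identityʳ a ⟩
              a       ∎)
              where
              a = A v w (lookup σ v) (lookup σ w)
              b = A w v (lookup σ w) (lookup σ v)
      ...   | tri≈ _ refl _  = contradiction w∈N (loopless v)
      ...   | tri> v≮w _ w<v = sym (begin
              guard (v Finₚ.<? w) a * guard (v ∈? neighbours w) (guard (w Finₚ.<? v) b)
                ≡⟨ cong₂ _*_ (guard-no (v Finₚ.<? w) v≮w)
                     (trans (guard-yes (v ∈? neighbours w) (symmetric w∈N)) (guard-yes (w Finₚ.<? v) w<v)) ⟩
              1# * b  ≡⟨ *-identityˡ b ⟩
              b       ≡⟨ A-transpose (symmetric w∈N) _ _ ⟩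
              a       ∎)
              where
              a = A v w (lookup σ v) (lookup σ w)
              b = A w v (lookup σ w) (lookup σ v)

    pair-cong : ∀ {σ σ′ u w} → lookup σ u ≡ lookup σ′ u → lookup σ w ≡ lookup σ′ w → pair σ u w ≡ pair σ′ u w
    pair-cong {u = u} {w} p r =
      cong₂ (λ a b → guard (w ∈? neighbours u) (guard (u Finₚ.<? w) (A u w a b))) p r

  -- Row u ≠ v of the matrix of edge factors changes only at (u , v), and row v is
  -- itself part of the likelihood at v.
  edges-[]≔ : ∀ σ v x → let edgeWeight = λ σ → ∏ (map (λ (u , w) → A u w (lookup σ u) (lookup σ w)) edges) in
    edgeWeight (σ [ v ]≔ x) * likelihood v (lookup σ v) σ ≡ edgeWeight σ * likelihood v x σ
  edges-[]≔ σ v x = begin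
    ∏ (map (λ (u , w) → A u w (lookup σ′ u) (lookup σ′ w)) edges) * likelihood v (lookup σ v) σ
      ≡⟨ cong₂ _*_ (edges-pairs σ′) (likelihood-pairs σ v) ⟩
    ∏ (map (row σ′) Vs) * (row σ v * col σ)
      ≡⟨ solve 3 (λ a b c → a :* (b :* c) := a :* c :* b) refl _ (row σ v) (col σ) ⟩
    ∏ (map (row σ′) Vs) * col σ * row σ v
      ≡⟨ cong₂ _*_ (∏-* (row σ′) (λ u → pair σ u v) Vs) (trans (cong (row σ v *_) (pair-loop σ′ v)) (*-identityʳ _)) ⟨
    ∏ (map (λ u → row σ′ u * pair σ u v) Vs) * (row σ v * pair σ′ v v)
      ≡⟨ ∏-replace v (λ u → row σ′ u * pair σ u v) (λ u → row σ u * pair σ′ u v) change ⟩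
    ∏ (map (λ u → row σ u * pair σ′ u v) Vs) * (row σ′ v * pair σ v v)
      ≡⟨ cong₂ _*_ (∏-* (row σ) (λ u → pair σ′ u v) Vs) (trans (cong (row σ′ v *_) (pair-loop σ v)) (*-identityʳ _)) ⟩
    ∏ (map (row σ) Vs) * col σ′ * row σ′ v
      ≡⟨ solve 3 (λ a b c → a :* (b :* c) := a :* c :* b) refl _ (row σ′ v) (col σ′) ⟨
    ∏ (map (row σ) Vs) * (row σ′ v * col σ′)
      ≡⟨ cong₂ _*_ (edges-pairs σ) (likelihood-pairs σ′ v) ⟨
    ∏ (map (λ (u , w) → A u w (lookup σ u) (lookup σ w)) edges) * likelihood v (lookup σ′ v) σ′
      ≡⟨ cong (∏ (map (λ (u , w) → A u w (lookup σ u) (lookup σ w)) edges) *_)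
              (trans (cong (λ c → likelihood v c σ′) (Vecₚ.lookup∘update v σ x)) (likelihood-[]≔ v x σ x)) ⟩
    ∏ (map (λ (u , w) → A u w (lookup σ u) (lookup σ w)) edges) * likelihood v x σ ∎
    where
    open ≡-Reasoning
    Vs = allFin order
    σ′ = σ [ v ]≔ x
    row : Config → V → ℝ
    row σ u = ∏ (map (pair σ u) Vs)
    col : Config → ℝ
    col σ = ∏ (map (λ u → pair σ u v) Vs)
    unchanged : ∀ {u} → u ≢ v → lookup σ′ u ≡ lookup σ u
    unchanged u≢v = Vecₚ.lookup∘update′ u≢v σ x
    change : ∀ u → u ≢ v → row σ′ u * pair σ u v ≡ row σ u * pair σ′ u v
    change u u≢v = ∏-replace v (pair σ′ u) (pair σ u)
      (λ w w≢v → pair-cong {σ′} {σ} (unchanged u≢v) (unchanged w≢v))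

  weight-[]≔ : ∀ σ v x → weight (σ [ v ]≔ x) * (field-λ v (lookup σ v) * likelihood v (lookup σ v) σ) ≡
                         weight σ * (field-λ v x * likelihood v x σ)
  weight-[]≔ σ v x = begin
    weight σ′ * (field-λ v (lookup σ v) * likelihood v (lookup σ v) σ)
      ≡⟨ exchange _ _ _ _ ⟩
    (fields σ′ * field-λ v (lookup σ v)) * (edgeWeight σ′ * likelihood v (lookup σ v) σ)
      ≡⟨ cong₂ _*_ fields-[]≔ (edges-[]≔ σ v x) ⟩
    (fields σ * field-λ v x) * (edgeWeight σ * likelihood v x σ)
      ≡⟨ exchange _ _ _ _ ⟨
    weight σ * (field-λ v x * likelihood v x σ) ∎
    where
    open ≡-Reasoning
    σ′ = σ [ v ]≔ x
    fields edgeWeight : Config → ℝ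
    fields σ = ∏ (map (λ u → field-λ u (lookup σ u)) (allFin order))
    edgeWeight σ = ∏ (map (λ (u , w) → A u w (lookup σ u) (lookup σ w)) edges)
    exchange : ∀ a b c d → (a * b) * (c * d) ≡ (a * c) * (b * d)
    exchange = solve 4 (λ a b c d → (a :* b) :* (c :* d) := (a :* c) :* (b :* d)) refl
    fields-[]≔ : fields σ′ * field-λ v (lookup σ v) ≡ fields σ * field-λ v x
    fields-[]≔ = trans
      (∏-replace v (λ u → field-λ u (lookup σ′ u)) (λ u → field-λ u (lookup σ u))
                 (λ u u≢v → cong (field-λ u) (Vecₚ.lookup∘update′ u≢v σ x)))
      (cong (λ c → fields σ * field-λ v c) (Vecₚ.lookup∘update v σ x))

  -- The normalizer ignores the spin at `v`, so both sides share it and `weight-[]≔` divides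
  -- through. For the same reason it does not matter that the reverse rate is taken at `σ` instead
  -- of the updated configuration (`glauber-[]≔`).
  detailed-balance : ∀ σ v x → weight σ * glauber v σ x ≡ weight (σ [ v ]≔ x) * glauber v σ (lookup σ v)
  detailed-balance σ v x = trans (sym (*-assoc _ _ _))
    (trans (cong (_* normalizer v σ ⁻¹) (sym (weight-[]≔ σ v x))) (*-assoc _ _ _))

  weight-nonneg : ∀ σ → 0# ≤ weight σ
  weight-nonneg σ = *-nonneg
    (∏-nonneg (allFin order) (λ {v} _ → λ-nonneg v (lookup σ v)))
    (subst (0# ≤_) (sym (edges-pairs σ))
      (∏-nonneg (allFin order) (λ {u} _ → ∏-nonneg (allFin order) λ {w} _ → pair-nonneg u w)))
    where
    pair-nonneg : ∀ u w → 0# ≤ pair σ u w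
    pair-nonneg u w = guard-elim (0# ≤_) (w ∈? neighbours u)
      (λ w∈N → guard-elim (0# ≤_) (u Finₚ.<? w) (λ _ → A-nonneg w∈N _ _) 0≤1) 0≤1

  Z-pos : 0# < Z
  Z-pos = <-≤-trans
    (*-pos (∏-pos (allFin order) (λ {v} _ → λσ-pos v)) (subst (0# <_) (sym (edges-pairs σ))
      (∏-pos (allFin order) (λ {u} _ → ∏-pos (allFin order) λ {w} _ → pair-pos u w))))
    (term≤∑ weight-nonneg (∈-configurations σ))
    where
    σ : Config
    -- A configuration of positive weight: a spin of positive field at every vertex, the edge
    -- factors being positive anyway.
    σ = Vec.tabulate (proj₁ ∘ likely-spin)
    λσ-pos : ∀ v → 0# < field-λ v (lookup σ v)
    λσ-pos v = subst (λ c → 0# < field-λ v c) (sym (Vecₚ.lookup∘tabulate _ v)) (proj₂ (likely-spin v))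
    pair-pos : ∀ u w → 0# < pair σ u w
    pair-pos u w = guard-elim (0# <_) (w ∈? neighbours u)
      (λ w∈N → guard-elim (0# <_) (u Finₚ.<? w) (λ _ → A-pos w∈N _ _) 0<1) 0<1

  𝔼 : (Config → ℝ) → ℝ
  𝔼 f = ∑ (map (λ σ → gibbs σ * f σ) (configurations q order))

  gibbs-nonneg : ∀ σ → 0# ≤ gibbs σ
  gibbs-nonneg σ = /-nonneg (weight-nonneg σ) (proj₁ Z-pos)

  ∑-gibbs : ∑ (map gibbs (configurations q order)) ≡ 1#
  ∑-gibbs = trans (∑-*ʳ _ _ (configurations q order)) (*-inverseʳ _ (<⇒≢0 Z-pos))

  𝔼-cong : ∀ {f g} → (∀ σ → f σ ≡ g σ) → 𝔼 f ≡ 𝔼 g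
  𝔼-cong f≗g = ∑-cong (configurations q order) (λ σ → cong (gibbs σ *_) (f≗g σ))

  𝔼-nonneg : ∀ {f} → (∀ σ → 0# ≤ f σ) → 0# ≤ 𝔼 f
  𝔼-nonneg 0≤f = ∑-nonneg (configurations q order) (λ σ → *-nonneg (gibbs-nonneg σ) (0≤f σ))

  𝔼-1 : 𝔼 (λ _ → 1#) ≡ 1#
  𝔼-1 = trans (∑-cong (configurations q order) (λ σ → *-identityʳ _)) ∑-gibbs

  -- Detailed balance rewrites the flow from (σ , new spin) as the flow of the reversed move,
  -- `∑-resample` reindexes the sum by reversed moves, and the rates out of each configuration sum
  -- to 1.
  glauber-stationary : ∀ v (g : Config → ℝ) →
    𝔼 (λ σ → ∑ (map (λ x → glauber v σ x * g (σ [ v ]≔ x)) (allFin q))) ≡ 𝔼 g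
  glauber-stationary v g = begin
    𝔼 (λ σ → ∑ (map (λ x → glauber v σ x * g (σ [ v ]≔ x)) (allFin q)))
      ≡⟨ ∑-cong S (λ σ → trans (sym (∑-*ˡ (gibbs σ) _ (allFin q))) (∑-cong (allFin q) (flip σ))) ⟩
    ∑ (map (λ σ → ∑ (map (λ x → h (σ [ v ]≔ x) (lookup σ v)) (allFin q))) S)
      ≡⟨ ∑-resample v h ⟩
    ∑ (map (λ σ → ∑ (map (λ x → gibbs σ * glauber v σ x * g σ) (allFin q))) S)
      ≡⟨ ∑-cong S total-rate ⟩
    𝔼 g ∎
    where
    open ≡-Reasoning
    S = configurations q order
    h : Config → Fin q → ℝ
    h σ x = gibbs σ * glauber v σ x * g σ
    total-rate : ∀ σ → ∑ (map (h σ) (allFin q)) ≡ gibbs σ * g σ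
    total-rate σ = trans (∑-*ʳ (g σ) _ (allFin q)) (cong (_* g σ)
      (trans (∑-*ˡ (gibbs σ) _ (allFin q)) (trans (cong (gibbs σ *_) (∑-glauber v σ)) (*-identityʳ _))))
    flip : ∀ σ x → gibbs σ * (glauber v σ x * g (σ [ v ]≔ x)) ≡ h (σ [ v ]≔ x) (lookup σ v)
    flip σ x = begin
      weight σ * Z ⁻¹ * (glauber v σ x * g (σ [ v ]≔ x))
        ≡⟨ solve 4 (λ w z p g → w :* z :* (p :* g) := (w :* p) :* z :* g) refl (weight σ) (Z ⁻¹) _ _ ⟩
      weight σ * glauber v σ x * Z ⁻¹ * g (σ [ v ]≔ x)
        ≡⟨ cong (λ y → y * Z ⁻¹ * g (σ [ v ]≔ x)) (detailed-balance σ v x) ⟩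
      weight (σ [ v ]≔ x) * glauber v σ (lookup σ v) * Z ⁻¹ * g (σ [ v ]≔ x)
        ≡⟨ cong (λ y → weight (σ [ v ]≔ x) * y * Z ⁻¹ * g (σ [ v ]≔ x)) (glauber-[]≔ v σ x (lookup σ v)) ⟨
      weight (σ [ v ]≔ x) * glauber v (σ [ v ]≔ x) (lookup σ v) * Z ⁻¹ * g (σ [ v ]≔ x)
        ≡⟨ solve 4 (λ w z p g → (w :* p) :* z :* g := w :* z :* p :* g) refl (weight (σ [ v ]≔ x)) (Z ⁻¹) _ _ ⟩
      gibbs (σ [ v ]≔ x) * glauber v (σ [ v ]≔ x) (lookup σ v) * g (σ [ v ]≔ x) ∎

-- Function update and the arithmetic of update slots.

[↦]-same : {X : Set} (f : ℕ → X) {i j : ℕ} {x : X} → j ≡ i → (f [ i ↦ x ]) j ≡ x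
[↦]-same f {i} {j} j≡i with j ≡ᵇ i in eq
... | true  = refl
... | false = contradiction (subst T eq (ℕₚ.≡⇒≡ᵇ j i j≡i)) λ ()

[↦]-other : {X : Set} (f : ℕ → X) {i j : ℕ} {x : X} → j ≢ i → (f [ i ↦ x ]) j ≡ f j
[↦]-other f {i} {j} j≢i with j ≡ᵇ i in eq
... | true  = contradiction (ℕₚ.≡ᵇ⇒≡ j i (subst T (sym eq) _)) j≢i
... | false = refl

-- Time runs backwards: slot m is the m-th update counted from the present, and the
-- scan updates the vertices cyclically, so that slot a v is the update of v in the
-- a-th most recent sweep.
module Slots (n : ℕ) .{{_ : NonZero n}} where

  vertexOf : ℕ → Fin n
  vertexOf m = fromℕ< (m%n<n m n)

  slot : ℕ → Fin n → ℕ
  slot a v = toℕ v ℕ.+ a ℕ.* n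

  toℕ-vertexOf : ∀ m → toℕ (vertexOf m) ≡ m % n
  toℕ-vertexOf m = Finₚ.toℕ-fromℕ< (m%n<n m n)

  vertexOf-slot : ∀ a v → vertexOf (slot a v) ≡ v
  vertexOf-slot a v = Finₚ.toℕ-injective (begin
    toℕ (vertexOf (slot a v))    ≡⟨ toℕ-vertexOf (slot a v) ⟩
    (toℕ v ℕ.+ a ℕ.* n) % n      ≡⟨ [m+kn]%n≡m%n (toℕ v) a n ⟩
    toℕ v % n                    ≡⟨ m<n⇒m%n≡m (Finₚ.toℕ<n v) ⟩
    toℕ v                        ∎)
    where open ≡-Reasoning

  slot-vertexOf : ∀ m → slot (m DivMod./ n) (vertexOf m) ≡ m
  slot-vertexOf m = trans (cong (ℕ._+ (m DivMod./ n) ℕ.* n) (toℕ-vertexOf m)) (sym (m≡m%n+[m/n]*n m n))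

  -- The sweep in which u was last updated before slot a v.
  previous : ℕ → Fin n → Fin n → ℕ
  previous a v u = if does (v Finₚ.<? u) then a else suc a

  previous-> : ∀ a {v u} → v Fin.< u → previous a v u ≡ a
  previous-> a {v} {u} v<u = cong (if_then a else suc a) (dec-true (v Finₚ.<? u) v<u)

  previous-≤ : ∀ a {v u} → ¬ v Fin.< u → previous a v u ≡ suc a
  previous-≤ a {v} {u} v≮u = cong (if_then a else suc a) (dec-false (v Finₚ.<? u) v≮u)

  slot<slot-previous : ∀ a {v u} → u ≢ v → slot a v ℕ.< slot (previous a v u) u
  slot<slot-previous a {v} {u} u≢v with v Finₚ.<? u
  ... | yes v<u rewrite previous-> a v<u = ℕₚ.+-monoˡ-< (a ℕ.* n) v<u
  ... | no v≮u rewrite previous-≤ a v≮u = begin-strict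
    toℕ v ℕ.+ a ℕ.* n             <⟨ ℕₚ.+-monoˡ-< (a ℕ.* n) (Finₚ.toℕ<n v) ⟩
    n ℕ.+ a ℕ.* n                 ≤⟨ ℕₚ.m≤n+m _ (toℕ u) ⟩
    toℕ u ℕ.+ (n ℕ.+ a ℕ.* n)     ∎
    where open ℕₚ.≤-Reasoning

  -- Bounds how far a single recursive call reaches: less than one sweep. This is what lets a finite
  -- window stand in for the infinite past.
  slot-previous<slot+n : ∀ a {v u} → u ≢ v → slot (previous a v u) u ℕ.< slot a v ℕ.+ n
  slot-previous<slot+n a {v} {u} u≢v with v Finₚ.<? u
  ... | yes v<u rewrite previous-> a v<u = begin-strict
    toℕ u ℕ.+ a ℕ.* n             <⟨ ℕₚ.+-monoˡ-< (a ℕ.* n) (Finₚ.toℕ<n u) ⟩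
    n ℕ.+ a ℕ.* n                 ≤⟨ ℕₚ.m≤n+m _ (toℕ v) ⟩
    toℕ v ℕ.+ (n ℕ.+ a ℕ.* n)     ≡⟨ cong (toℕ v ℕ.+_) (ℕₚ.+-comm n _) ⟩
    toℕ v ℕ.+ (a ℕ.* n ℕ.+ n)     ≡⟨ ℕₚ.+-assoc (toℕ v) _ n ⟨
    toℕ v ℕ.+ a ℕ.* n ℕ.+ n       ∎
    where open ℕₚ.≤-Reasoning
  ... | no v≮u rewrite previous-≤ a v≮u = begin-strict
    toℕ u ℕ.+ (n ℕ.+ a ℕ.* n)     <⟨ ℕₚ.+-monoˡ-< _ (ℕₚ.≤∧≢⇒< (ℕₚ.≮⇒≥ v≮u) (u≢v ∘ Finₚ.toℕ-injective)) ⟩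
    toℕ v ℕ.+ (n ℕ.+ a ℕ.* n)     ≡⟨ cong (toℕ v ℕ.+_) (ℕₚ.+-comm n _) ⟩
    toℕ v ℕ.+ (a ℕ.* n ℕ.+ n)     ≡⟨ ℕₚ.+-assoc (toℕ v) _ n ⟨
    toℕ v ℕ.+ a ℕ.* n ℕ.+ n       ∎
    where open ℕₚ.≤-Reasoning

  private
    slot-<⇒< : ∀ a b (u : Fin n) → slot a u ℕ.< slot b u → a ℕ.< b
    slot-<⇒< a b u lt = ℕₚ.*-cancelʳ-< n a b (ℕₚ.+-cancelˡ-< (toℕ u) _ _ lt)

    <⇒slot-< : ∀ {a b} (u v : Fin n) → a ℕ.< b → slot a u ℕ.< slot b v
    <⇒slot-< {a} {b} u v a<b = begin-strict
      toℕ u ℕ.+ a ℕ.* n     <⟨ ℕₚ.+-monoˡ-< (a ℕ.* n) (Finₚ.toℕ<n u) ⟩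
      n ℕ.+ a ℕ.* n         ≤⟨ ℕₚ.*-monoˡ-≤ n a<b ⟩
      b ℕ.* n               ≤⟨ ℕₚ.m≤n+m _ (toℕ v) ⟩
      slot b v              ∎
      where open ℕₚ.≤-Reasoning

  -- Hence the spin that u receives in its previous slot is the one that the update in slot a v
  -- sees. A slot of u below that one belongs to a more recent sweep, and so cannot exceed slot a v.
  no-update-between : ∀ a {v u j} → u ≢ v → slot a v ℕ.< j → j ℕ.< slot (previous a v u) u → vertexOf j ≢ u
  no-update-between a {v} {u} {j} u≢v lo hi refl with v Finₚ.<? u
  ... | yes v<u = ℕₚ.<-asym lo (subst (ℕ._< slot a v) (slot-vertexOf j) (<⇒slot-< u v (slot-<⇒< (j DivMod./ n) a u
    (subst₂ ℕ._<_ (sym (slot-vertexOf j)) (cong (λ b → slot b u) (previous-> a v<u)) hi))))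
  ... | no v≮u = ℕₚ.<-asym lo (subst (ℕ._< slot a v) (slot-vertexOf j) (ℕₚ.+-mono-<-≤
    (ℕₚ.≤∧≢⇒< (ℕₚ.≮⇒≥ v≮u) (u≢v ∘ Finₚ.toℕ-injective))
    (ℕₚ.*-monoˡ-≤ n (ℕ.s≤s⁻¹ (slot-<⇒< (j DivMod./ n) (suc a) u
      (subst₂ ℕ._<_ (sym (slot-vertexOf j)) (cong (λ b → slot b u) (previous-≤ a v≮u)) hi))))))

-- Inhomogeneous chains over a finite window, and the laws of unfinished trials.

module Process (𝓡 : Reals) {q : ℕ} (𝓢 : Sampling.SpinSystem 𝓡 q)
  .{{_ : NonZero (Graph.order (Sampling.SpinSystem.graph 𝓢))}}
  (θ : Reals.ℝ 𝓡) (nearlyFree : Hypotheses.NearlyFree 𝓡 𝓢 θ) where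
  open Reals 𝓡
  open Sampling 𝓡
  open SpinSystem 𝓢
  open Hypotheses.NearlyFree nearlyFree
  open Hypotheses.Positive positive
  open OrderedField 𝓡
  open FiniteSums 𝓡
  open Glauber 𝓡 𝓢 positive public
  open Slots order public

  Kernel : Set
  Kernel = Config → Fin q → ℝ

  -- The expectation of `F` at the present, given `σ` just before slot m - 1 is run. Slots count
  -- backwards, so slot m - 1 acts first and slot 0 last.
  evolve : (ℕ → Kernel) → ℕ → (Config → ℝ) → Config → ℝ
  evolve K zero    F σ = F σ
  evolve K (suc m) F σ =
    ∑ (map (λ x → K m σ x * evolve K m F (σ [ vertexOf m ]≔ x)) (allFin q))

  evolve-cong : ∀ {K K′} m F → (∀ {j} → j ℕ.< m → ∀ σ x → K j σ x ≡ K′ j σ x) →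
                ∀ σ → evolve K m F σ ≡ evolve K′ m F σ
  evolve-cong zero    F K≗K′ σ = refl
  evolve-cong (suc m) F K≗K′ σ = ∑-cong (allFin q) λ x →
    cong₂ _*_ (K≗K′ ℕₚ.≤-refl σ x) (evolve-cong m F (λ j<m → K≗K′ (ℕₚ.m<n⇒m<1+n j<m)) _)

  evolve-nonneg : ∀ {K} m {F} → (∀ j σ x → 0# ≤ K j σ x) → (∀ σ → 0# ≤ F σ) →
                  ∀ σ → 0# ≤ evolve K m F σ
  evolve-nonneg zero    0≤K 0≤F σ = 0≤F σ
  evolve-nonneg (suc m) 0≤K 0≤F σ = ∑-nonneg (allFin q) λ x →
    *-nonneg (0≤K m σ x) (evolve-nonneg m 0≤K 0≤F _)

  set-same : ∀ (K : ℕ → Kernel) m κ σ x → (K [ m ↦ κ ]) m σ x ≡ κ σ x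
  set-same K m κ σ x = cong (λ κ → κ σ x) ([↦]-same K {m} {m} {κ} refl)

  set-other : ∀ (K : ℕ → Kernel) {m j} κ → j ≢ m → ∀ σ x → (K [ m ↦ κ ]) j σ x ≡ K j σ x
  set-other K κ j≢m σ x = cong (λ κ → κ σ x) ([↦]-other K j≢m)

  set-cong : ∀ (K : ℕ → Kernel) m {κ κ′ : Kernel} → (∀ σ x → κ σ x ≡ κ′ σ x) → ∀ i σ x →
             (K [ m ↦ κ ]) i σ x ≡ (K [ m ↦ κ′ ]) i σ x
  set-cong K m κ≗κ′ i σ x with i ≡ᵇ m
  ... | true  = κ≗κ′ σ x
  ... | false = refl

  set-id : ∀ (K : ℕ → Kernel) {m κ} → (∀ σ x → κ σ x ≡ K m σ x) → ∀ i σ x → (K [ m ↦ κ ]) i σ x ≡ K i σ x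
  set-id K {m} {κ} κ≗Km i σ x with i ℕₚ.≟ m
  ... | yes refl = trans (set-same K m κ σ x) (κ≗Km σ x)
  ... | no i≢m   = set-other K κ i≢m σ x

  -- A slot below `M` is used exactly once on every path, so `evolve` is linear in its kernel. This
  -- turns a random choice of the machine into an average of conditional laws.
  evolve-mixture : {I : Set} (is : List I) (p : I → ℝ) (κ : I → Kernel) (K : ℕ → Kernel) →
    ∀ {m} M F → m ℕ.< M → ∀ σ →
    evolve (K [ m ↦ (λ σ x → ∑ (map (λ i → p i * κ i σ x) is)) ]) M F σ ≡
    ∑ (map (λ i → p i * evolve (K [ m ↦ κ i ]) M F σ) is)
  evolve-mixture is p κ K {m} (suc M) F m<1+M σ with m ℕₚ.≟ M
  ... | yes refl = begin
    ∑ (map (λ x → (K [ m ↦ mix ]) m σ x * evolve (K [ m ↦ mix ]) m F (next x)) Q)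
      ≡⟨ ∑-cong Q (λ x → cong₂ _*_ (set-same K m mix σ x)
                                    (evolve-cong m F (λ j<m σ x → set-other K _ (ℕₚ.<⇒≢ j<m) σ x) (next x))) ⟩
    ∑ (map (λ x → ∑ (map (λ i → p i * κ i σ x) is) * below x) Q)
      ≡⟨ ∑-cong Q (λ x → trans (sym (∑-*ʳ (below x) _ is)) (∑-cong is (λ i → *-assoc (p i) _ _))) ⟩
    ∑ (map (λ x → ∑ (map (λ i → p i * (κ i σ x * below x)) is)) Q)
      ≡⟨ ∑-swap _ Q is ⟩
    ∑ (map (λ i → ∑ (map (λ x → p i * (κ i σ x * below x)) Q)) is)
      ≡⟨ ∑-cong is (λ i → ∑-*ˡ (p i) _ Q) ⟩
    ∑ (map (λ i → p i * ∑ (map (λ x → κ i σ x * below x) Q)) is)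
      ≡⟨ ∑-cong is (λ i → cong (p i *_) (∑-cong Q (λ x → cong₂ _*_ (set-same K m (κ i) σ x)
                                    (evolve-cong m F (λ j<m σ x → set-other K _ (ℕₚ.<⇒≢ j<m) σ x) (next x))))) ⟨
    ∑ (map (λ i → p i * evolve (K [ m ↦ κ i ]) (suc m) F σ) is) ∎
    where
    open ≡-Reasoning
    Q = allFin q
    mix : Kernel
    mix σ x = ∑ (map (λ i → p i * κ i σ x) is)
    next : Fin q → Config
    next x = σ [ vertexOf m ]≔ x
    below : Fin q → ℝ
    below x = evolve K m F (next x)
  ... | no m≢M = begin
    ∑ (map (λ x → (K [ m ↦ mix ]) M σ x * evolve (K [ m ↦ mix ]) M F (next x)) Q)
      ≡⟨ ∑-cong Q (λ x → cong₂ _*_ (set-other K _ (m≢M ∘ sym) σ x)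
                                    (evolve-mixture is p κ K M F m<M (next x))) ⟩
    ∑ (map (λ x → K M σ x * ∑ (map (λ i → p i * ev i x) is)) Q)
      ≡⟨ ∑-cong Q (λ x → trans (sym (∑-*ˡ (K M σ x) _ is)) (∑-cong is (λ i → exchange (K M σ x) (p i) (ev i x)))) ⟩
    ∑ (map (λ x → ∑ (map (λ i → p i * (K M σ x * ev i x)) is)) Q)
      ≡⟨ ∑-swap _ Q is ⟩
    ∑ (map (λ i → ∑ (map (λ x → p i * (K M σ x * ev i x)) Q)) is)
      ≡⟨ ∑-cong is (λ i → ∑-*ˡ (p i) _ Q) ⟩
    ∑ (map (λ i → p i * ∑ (map (λ x → K M σ x * ev i x) Q)) is)
      ≡⟨ ∑-cong is (λ i → cong (p i *_) (∑-cong Q (λ x → cong (_* ev i x) (set-other K _ (m≢M ∘ sym) σ x)))) ⟨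
    ∑ (map (λ i → p i * evolve (K [ m ↦ κ i ]) (suc M) F σ) is) ∎
    where
    open ≡-Reasoning
    Q = allFin q
    m<M : m ℕ.< M
    m<M = ℕₚ.≤∧≢⇒< (ℕ.s≤s⁻¹ m<1+M) m≢M
    mix : Kernel
    mix σ x = ∑ (map (λ i → p i * κ i σ x) is)
    next : Fin q → Config
    next x = σ [ vertexOf M ]≔ x
    ev = λ i x → evolve (K [ m ↦ κ i ]) M F (next x)
    exchange : ∀ a b c → a * (b * c) ≡ b * (a * c)
    exchange = solve 3 (λ a b c → a :* (b :* c) := b :* (a :* c)) refl

  pinned : Fin q → Kernel
  pinned s _ x = 𝟙 (x Finₚ.≟ s)

  pinned-term : ∀ s (f g : Fin q → ℝ) x → f s ≡ g s → 𝟙 (x Finₚ.≟ s) * f x ≡ 𝟙 (x Finₚ.≟ s) * g x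
  pinned-term s f g x fs≡gs with x Finₚ.≟ s
  ... | yes refl = cong (1# *_) fs≡gs
  ... | no _     = trans (zeroˡ _) (sym (zeroˡ _))

  -- A kernel only matters on the configurations in which the vertices it reads
  -- carry the spins already determined.
  evolve-look-up : ∀ (K : ℕ → Kernel) {m m′ M u s} {κ κ′ : Kernel} F →
    vertexOf m′ ≡ u → m ℕ.< m′ → m′ ℕ.< M →
    (∀ {j} → m ℕ.< j → j ℕ.< m′ → vertexOf j ≢ u) →
    (∀ σ x → K m′ σ x ≡ pinned s σ x) →
    (∀ σ → lookup σ u ≡ s → ∀ x → κ σ x ≡ κ′ σ x) →
    ∀ σ → evolve (K [ m ↦ κ ]) M F σ ≡ evolve (K [ m ↦ κ′ ]) M F σ
  evolve-look-up K {m} {m′} {M} {u} {s} {κ} {κ′} F refl m<m′ m′<M quiet pin κ≗κ′ = λ σ →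
    trans (cong (λ M → evolve (K [ m ↦ κ ]) M F σ) (sym (ℕₚ.m∸n+n≡m m′<M)))
    (trans (above (M ℕ.∸ suc m′) σ) (cong (λ M → evolve (K [ m ↦ κ′ ]) M F σ) (ℕₚ.m∸n+n≡m m′<M)))
    where
    same-off-m : ∀ {j} → j ≢ m → ∀ σ x → (K [ m ↦ κ ]) j σ x ≡ (K [ m ↦ κ′ ]) j σ x
    same-off-m j≢m σ x = trans (set-other K κ j≢m σ x) (sym (set-other K κ′ j≢m σ x))

    within : ∀ j → m ℕ.< j → j ℕ.≤ m′ → ∀ σ → lookup σ u ≡ s →
             evolve (K [ m ↦ κ ]) j F σ ≡ evolve (K [ m ↦ κ′ ]) j F σ
    within (suc j) m<1+j j<m′ σ σu≡s with m ℕₚ.≟ j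
    ... | yes refl = ∑-cong (allFin q) λ x → cong₂ _*_
      (trans (set-same K m κ σ x)
        (trans (κ≗κ′ σ σu≡s x) (sym (set-same K m κ′ σ x))))
      (evolve-cong j F (λ i<j → same-off-m (ℕₚ.<⇒≢ i<j)) _)
    ... | no m≢j = ∑-cong (allFin q) λ x → cong₂ _*_ (same-off-m (m≢j ∘ sym) σ x)
      (within j m<j (ℕₚ.<⇒≤ j<m′) _ (trans (Vecₚ.lookup∘update′ (quiet m<j j<m′ ∘ sym) σ x) σu≡s))
      where
      m<j : m ℕ.< j
      m<j = ℕₚ.≤∧≢⇒< (ℕ.s≤s⁻¹ m<1+j) m≢j

    above : ∀ d σ → evolve (K [ m ↦ κ ]) (d ℕ.+ suc m′) F σ ≡ evolve (K [ m ↦ κ′ ]) (d ℕ.+ suc m′) F σ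
    above zero σ = begin
      ∑ (map (λ x → (K [ m ↦ κ ]) m′ σ x * ev κ x) (allFin q))
        ≡⟨ ∑-cong (allFin q) (λ x → cong (_* ev κ x) (is-pinned κ x)) ⟩
      ∑ (map (λ x → 𝟙 (x Finₚ.≟ s) * ev κ x) (allFin q))
        ≡⟨ ∑-cong (allFin q) (λ x → pinned-term s (ev κ) (ev κ′) x
             (within m′ m<m′ ℕₚ.≤-refl _ (Vecₚ.lookup∘update (vertexOf m′) σ s))) ⟩
      ∑ (map (λ x → 𝟙 (x Finₚ.≟ s) * ev κ′ x) (allFin q))
        ≡⟨ ∑-cong (allFin q) (λ x → cong (_* ev κ′ x) (is-pinned κ′ x)) ⟨
      ∑ (map (λ x → (K [ m ↦ κ′ ]) m′ σ x * ev κ′ x) (allFin q)) ∎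
      where
      open ≡-Reasoning
      ev : Kernel → Fin q → ℝ
      ev κ x = evolve (K [ m ↦ κ ]) m′ F (σ [ vertexOf m′ ]≔ x)
      is-pinned : ∀ κ x → (K [ m ↦ κ ]) m′ σ x ≡ 𝟙 (x Finₚ.≟ s)
      is-pinned κ x = trans (set-other K κ (ℕₚ.<⇒≢ m<m′ ∘ sym) σ x) (pin σ x)
    above (suc d) σ = ∑-cong (allFin q) λ x → cong₂ _*_
      (same-off-m (ℕₚ.<⇒≢ (ℕₚ.<-≤-trans m<m′ (ℕₚ.≤-trans (ℕₚ.n≤1+n m′) (ℕₚ.m≤n+m _ d))) ∘ sym) σ x) (above d _)

  -- The kernel of every slot when exactly the spins of the slots in memo are known.
  resolved : (ℕ → Maybe (Fin q)) → ℕ → Kernel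
  resolved memo m = maybe′ pinned (glauber (vertexOf m)) (memo m)

  resolved-just : ∀ memo {m s} → memo m ≡ just s → resolved memo m ≡ pinned s
  resolved-just memo {m} eq = cong (maybe′ pinned (glauber (vertexOf m))) eq

  resolved-nothing : ∀ memo {m} → memo m ≡ nothing → resolved memo m ≡ glauber (vertexOf m)
  resolved-nothing memo {m} eq = cong (maybe′ pinned (glauber (vertexOf m))) eq

  evolve-stationary : ∀ m F → 𝔼 (evolve (resolved (λ _ → nothing)) m F) ≡ 𝔼 F
  evolve-stationary zero    F = refl
  evolve-stationary (suc m) F =
    trans (glauber-stationary (vertexOf m) (evolve (resolved (λ _ → nothing)) m F)) (evolve-stationary m F)

  -- Slot `toℕ v` is the last update of v, so a spin known there overrides all earlier history and
  -- is never changed afterwards. The condition m ≤ `toℕ v` says that this last update has already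
  -- been run.
  evolve-determined : ∀ memo F →
    (∀ σ → (∀ v {s} → memo (toℕ v) ≡ just s → lookup σ v ≡ s) → F σ ≡ 1#) →
    ∀ m σ → (∀ v {s} → memo (toℕ v) ≡ just s → m ℕ.≤ toℕ v → lookup σ v ≡ s) →
    evolve (resolved memo) m F σ ≡ 1#
  evolve-determined memo F F≡1 zero    σ σ∼memo = F≡1 σ (λ v eq → σ∼memo v eq ℕ.z≤n)
  evolve-determined memo F F≡1 (suc m) σ σ∼memo with memo m in eq
  ... | nothing = trans (∑-cong (allFin q) (λ x → trans (cong (glauber (vertexOf m) σ x *_)
            (evolve-determined memo F F≡1 m _ (agrees x))) (*-identityʳ _)))
          (∑-glauber (vertexOf m) σ)
    where
    agrees : ∀ x v {s} → memo (toℕ v) ≡ just s → m ℕ.≤ toℕ v → lookup (σ [ vertexOf m ]≔ x) v ≡ s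
    agrees x v memo-v m≤v with m ℕₚ.≟ toℕ v
    ... | yes refl = contradiction (trans (sym memo-v) eq) λ ()
    ... | no m≢v = trans (Vecₚ.lookup∘update′ v≢ σ x) (σ∼memo v memo-v (ℕₚ.≤∧≢⇒< m≤v m≢v))
      where
      v≢ : v ≢ vertexOf m
      v≢ v≡ = ℕₚ.<⇒≱ (ℕₚ.≤∧≢⇒< m≤v m≢v)
        (subst (ℕ._≤ m) (sym (trans (cong toℕ v≡) (toℕ-vertexOf m))) (m%n≤m m order))
  ... | just s = trans (∑-cong (allFin q) (λ x → pinned-term s
            (λ x → evolve (resolved memo) m F (σ [ vertexOf m ]≔ x)) (λ _ → 1#) x
            (evolve-determined memo F F≡1 m (σ [ vertexOf m ]≔ s) agrees)))
          (∑-𝟙 (λ _ → 1#) s)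
    where
    agrees : ∀ v {s′} → memo (toℕ v) ≡ just s′ → m ℕ.≤ toℕ v → lookup (σ [ vertexOf m ]≔ s) v ≡ s′
    agrees v memo-v m≤v with v Finₚ.≟ vertexOf m
    ... | yes refl = trans (Vecₚ.lookup∘update (vertexOf m) σ s)
            (Maybeₚ.just-injective (trans (sym eq) (trans (cong memo (ℕₚ.≤-antisym m≤v
              (subst (ℕ._≤ m) (sym (toℕ-vertexOf m)) (m%n≤m m order)))) memo-v)))
    ... | no v≢ = trans (Vecₚ.lookup∘update′ v≢ σ s) (σ∼memo v memo-v (ℕₚ.≤∧≢⇒< m≤v λ { refl →
            v≢ (Finₚ.toℕ-injective (sym (trans (toℕ-vertexOf (toℕ v)) (m<n⇒m%n≡m (Finₚ.toℕ<n v))))) }))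

  -- The law of the outcome of a trial with proposal c at v that must still survive
  -- the neighbours us; a rejected trial is followed by a fresh one.
  trial : V → Fin q → List V → Kernel
  trial v c []       σ x = pinned c σ x
  trial v c (u ∷ us) σ x =
    A v u c (lookup σ u) * trial v c us σ x + (1# - A v u c (lookup σ u)) * glauber v σ x

  trial-closed : ∀ v c us σ x → let a = ∏ (map (λ u → A v u c (lookup σ u)) us) in
    trial v c us σ x ≡ a * pinned c σ x + (1# - a) * glauber v σ x
  trial-closed v c []       σ x =
    solve 2 (λ d g → d := lit 1 :* d :+ (lit 1 :- lit 1) :* g) refl (pinned c σ x) (glauber v σ x)
  trial-closed v c (u ∷ us) σ x = trans
    (cong (λ y → A v u c (lookup σ u) * y + (1# - A v u c (lookup σ u)) * glauber v σ x) (trial-closed v c us σ x))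
    (solve 4 (λ b a d g → b :* (a :* d :+ (lit 1 :- a) :* g) :+ (lit 1 :- b) :* g :=
                          b :* a :* d :+ (lit 1 :- b :* a) :* g) refl
           (A v u c (lookup σ u)) (∏ (map (λ u → A v u c (lookup σ u)) us)) (pinned c σ x) (glauber v σ x))

  -- The fixed-point equation of rejection sampling. With g the Glauber probability of x and n the
  -- normalizer, a proposal is accepted as x with probability n g and is rejected with probability 1
  -- - n, after which x again has probability g: n g + (1 - n) g = g.
  glauber-trial : ∀ v σ x →
    glauber v σ x ≡ ∑ (map (λ c → field-λ v c * trial v c (neighbours v) σ x) (allFin q))
  glauber-trial v σ x = sym (begin
    ∑ (map (λ c → λv c * trial v c (neighbours v) σ x) Q)
      ≡⟨ ∑-cong Q (λ c → trans (cong (λv c *_) (trial-closed v c (neighbours v) σ x))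
           (solve 4 (λ l a d g → l :* (a :* d :+ (lit 1 :- a) :* g) :=
                                 d :* (l :* a) :+ (l :* g :+ (:- g) :* (l :* a))) refl
              (λv c) (ℓ c) (pinned c σ x) g)) ⟩
    ∑ (map (λ c → pinned c σ x * (λv c * ℓ c) + (λv c * g + (- g) * (λv c * ℓ c))) Q)
      ≡⟨ trans (∑-+ _ _ Q) (cong₂ _+_ hit (trans (∑-+ _ _ Q) (cong₂ _+_
           (trans (∑-*ʳ g λv Q) (trans (cong (_* g) (∑λ≡1 v)) (*-identityˡ g))) (∑-*ˡ (- g) _ Q)))) ⟩
    λv x * ℓ x + (g + (- g) * normalizer v σ)
      ≡⟨ cong (λ y → y + (g + (- g) * normalizer v σ)) (y*[x/y]≡x (<⇒≢0 (normalizer-pos v σ))) ⟨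
    normalizer v σ * g + (g + (- g) * normalizer v σ)
      ≡⟨ solve 2 (λ n g → n :* g :+ (g :+ (:- g) :* n) := g) refl (normalizer v σ) g ⟩
    g ∎)
    where
    open ≡-Reasoning
    Q = allFin q
    g = glauber v σ x
    λv = field-λ v
    ℓ : Fin q → ℝ
    ℓ c = likelihood v c σ
    hit : ∑ (map (λ c → pinned c σ x * (λv c * ℓ c)) Q) ≡ λv x * ℓ x
    hit = trans (∑-cong Q (λ c → cong (_* (λv c * ℓ c)) (𝟙-⇔ (x Finₚ.≟ c) (c Finₚ.≟ x) sym sym)))
                (∑-𝟙 (λ c → λv c * ℓ c) x)

  -- The bias of the second coin, tossed once the first one, of bias θ, has come up heads: together
  -- they reject with probability 1 - A. The clamp mirrors the semantics of `coin`.
  rejection : V → Fin q → V → Fin q → ℝ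
  rejection v c u s = clamp ((1# - A v u c s) / θ)

  -- If θ is zero, the bounds force A = 1 and both sides vanish, whatever the quotient by zero is.
  -- Otherwise the quotient lies in the unit interval and the clamp does nothing.
  θ*rejection : ∀ {v u} → u ∈ neighbours v → ∀ c s → θ * rejection v c u s ≡ 1# - A v u c s
  θ*rejection {v} {u} u∈N c s with θ ≟ℝ 0#
  ... | yes θ≡0 = trans (trans (cong (_* rejection v c u s) θ≡0) (zeroˡ _))
    (antisym (x≤y⇒0≤y-x (A≤1 u∈N c s)) (≤-trans (1-A≤θ u∈N c s) (≤-reflexive θ≡0)))
  ... | no θ≢0 = trans (cong (θ *_) (clamp-id
      (/-nonneg (x≤y⇒0≤y-x (A≤1 u∈N c s)) 0≤θ)
      (x≤zy⇒x/y≤z (0≤θ , θ≢0 ∘ sym) (≤-trans (1-A≤θ u∈N c s) (≤-reflexive (sym (*-identityˡ θ)))))))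
    (y*[x/y]≡x θ≢0)

  -- The same law while the trial waits for the spin of its next neighbour u.
  waiting : V → Fin q → V → List V → Kernel
  waiting v c u us σ x =
    rejection v c u (lookup σ u) * glauber v σ x + (1# - rejection v c u (lookup σ u)) * trial v c us σ x

  trial-waiting : ∀ {v u} → u ∈ neighbours v → ∀ c us σ x →
    trial v c (u ∷ us) σ x ≡ θ * waiting v c u us σ x + (1# - θ) * trial v c us σ x
  trial-waiting {v} {u} u∈N c us σ x = begin
    a * t + (1# - a) * g
      ≡⟨ solve 3 (λ a t g → a :* t :+ (lit 1 :- a) :* g := t :+ (lit 1 :- a) :* (g :- t)) refl a t g ⟩
    t + (1# - a) * (g - t)
      ≡⟨ cong (λ y → t + y * (g - t)) (θ*rejection u∈N c (lookup σ u)) ⟨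
    t + (θ * r) * (g - t)
      ≡⟨ solve 4 (λ t g o r → t :+ (o :* r) :* (g :- t) :=
                              o :* (r :* g :+ (lit 1 :- r) :* t) :+ (lit 1 :- o) :* t) refl t g θ r ⟩
    θ * waiting v c u us σ x + (1# - θ) * t ∎
    where
    open ≡-Reasoning
    a = A v u c (lookup σ u)
    r = rejection v c u (lookup σ u)
    t = trial v c us σ x
    g = glauber v σ x

  trial-nonneg : ∀ v c {us} → (∀ {u} → u ∈ us → u ∈ neighbours v) → ∀ σ x → 0# ≤ trial v c us σ x
  trial-nonneg v c {[]}     us⊆N σ x = 𝟙-nonneg (x Finₚ.≟ c)
  trial-nonneg v c {u ∷ us} us⊆N σ x = +-nonneg
    (*-nonneg (A-nonneg (us⊆N (here refl)) c _) (trial-nonneg v c (us⊆N ∘ there) σ x))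
    (*-nonneg (x≤y⇒0≤y-x (A≤1 (us⊆N (here refl)) c _)) (glauber-nonneg v σ x))

  waiting-nonneg : ∀ v c u {us} → (∀ {u} → u ∈ us → u ∈ neighbours v) → ∀ σ x → 0# ≤ waiting v c u us σ x
  waiting-nonneg v c u us⊆N σ x = clamp-mixture-nonneg _ (glauber-nonneg v σ x) (trial-nonneg v c us⊆N σ x)

  resolved-nonneg : ∀ memo m σ x → 0# ≤ resolved memo m σ x
  resolved-nonneg memo m σ x with memo m
  ... | just s  = 𝟙-nonneg (x Finₚ.≟ s)
  ... | nothing = glauber-nonneg (vertexOf m) σ x

-- Bounds on output probabilities and time along executions of the machine.

at-toℕ : {X : Set} {n : ℕ} {d : X} {f : Fin n → X} (i : Fin n) → at d f (toℕ i) ≡ f i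
at-toℕ {n = n} {f = f} i with toℕ i ℕₚ.<? n
... | yes i<n = cong f (Finₚ.fromℕ<-toℕ i i<n)
... | no i≮n  = contradiction (Finₚ.toℕ<n i) i≮n

at-≡ : {X : Set} {n : ℕ} {d : X} {f : Fin n → X} {m : ℕ} {i : Fin n} → m ≡ toℕ i → at d f m ≡ f i
at-≡ {i = i} refl = at-toℕ i

at-≥ : {X : Set} {n : ℕ} {d : X} {f : Fin n → X} {m : ℕ} → n ℕ.≤ m → at d f m ≡ d
at-≥ {n = n} {m = m} n≤m with m ℕₚ.<? n
... | yes m<n = contradiction n≤m (ℕₚ.<⇒≱ m<n)
... | no _    = refl

map-toℕ-injective : ∀ {q k} (σ τ : Vec (Fin q) k) → Vec.map toℕ σ ≡ Vec.map toℕ τ → σ ≡ τ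
map-toℕ-injective Vec.[]      Vec.[]      _  = refl
map-toℕ-injective (x Vec.∷ σ) (y Vec.∷ τ) eq = cong₂ Vec._∷_
  (Finₚ.toℕ-injective (Vecₚ.∷-injectiveˡ eq)) (map-toℕ-injective σ τ (Vecₚ.∷-injectiveʳ eq))

module Bounds (𝓡 : Reals) {q : ℕ} (𝓢 : Sampling.SpinSystem 𝓡 q) (P : Sampling.Program 𝓡) (k : ℕ) where
  open Reals 𝓡
  open Sampling 𝓡
  open SpinSystem 𝓢
  open Execution 𝓢
  open OrderedField 𝓡
  open FiniteSums 𝓡

  halting : ℕ → State → ℝ
  halting t s = ∑ (map (λ τ → Pr[ t , P outputs τ ] s) (configurations q k))

  -- The field markov turns a bound on the running time into convergence of the
  -- halting probability, in the manner of Markov's inequality.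
  record Good (t : ℕ) (s : State) (r : Vec (Fin q) k → ℝ) (e : ℝ) : Set where
    field
      output≤        : ∀ τ → Pr[ t , P outputs τ ] s ≤ r τ
      time≤          : expectedTime t P s ≤ e
      halting-nonneg : 0# ≤ halting t s
      markov         : fromℕ t * (1# - halting t s) ≤ expectedTime t P s

  good-weaken : ∀ {t s r r′ e e′} → (∀ τ → r τ ≤ r′ τ) → e ≤ e′ → Good t s r e → Good t s r′ e′
  good-weaken r≤r′ e≤e′ g = record
    { output≤        = λ τ → ≤-trans (output≤ τ) (r≤r′ τ)
    ; time≤          = ≤-trans time≤ e≤e′
    ; halting-nonneg = halting-nonneg
    ; markov         = markov
    }
    where open Good g

  private
    Pr-zero : ∀ s {i} (τ : Vec (Fin q) k) → nth P (State.pc s) ≡ just i → Pr[ 0 , P outputs τ ] s ≡ 0#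
    Pr-zero s τ eq with nth P (State.pc s)
    Pr-zero s τ refl | just i = refl

    Pr-suc : ∀ {t s i} (τ : Vec (Fin q) k) → nth P (State.pc s) ≡ just i →
             Pr[ suc t , P outputs τ ] s ≡ expect Pr[ t , P outputs τ ] (step i s)
    Pr-suc {s = s} τ eq with nth P (State.pc s)
    Pr-suc τ refl | just i = refl

    Pr-halt : ∀ t s (τ : Vec (Fin q) k) → nth P (State.pc s) ≡ nothing →
              Pr[ t , P outputs τ ] s ≡ (if outputs? τ s then 1# else 0#)
    Pr-halt zero    s τ eq with nth P (State.pc s)
    Pr-halt zero    s τ refl | nothing = refl
    Pr-halt (suc t) s τ eq with nth P (State.pc s)
    Pr-halt (suc t) s τ refl | nothing = refl

    time-suc : ∀ {t s i} → nth P (State.pc s) ≡ just i →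
               expectedTime (suc t) P s ≡ fromℕ (cost i) + expect (expectedTime t P) (step i s)
    time-suc {s = s} eq with nth P (State.pc s)
    time-suc refl | just i = refl

    time-halt : ∀ t {s} → nth P (State.pc s) ≡ nothing → expectedTime t P s ≡ 0#
    time-halt zero    eq = refl
    time-halt (suc t) {s} eq with nth P (State.pc s)
    time-halt (suc t) refl | nothing = refl

  good-zero : ∀ {s i r e} → nth P (State.pc s) ≡ just i → (∀ τ → 0# ≤ r τ) → 0# ≤ e → Good 0 s r e
  good-zero {s} eq 0≤r 0≤e = record
    { output≤        = λ τ → ≤-trans (≤-reflexive (Pr-zero s τ eq)) (0≤r τ)
    ; time≤          = 0≤e
    ; halting-nonneg = ∑-nonneg (configurations q k) (λ τ → ≤-reflexive (sym (Pr-zero s τ eq)))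
    ; markov         = ≤-reflexive (zeroˡ _)
    }

  good-halt : ∀ t {s r e} (τ₀ : Vec (Fin q) k) → nth P (State.pc s) ≡ nothing →
              Vec.tabulate (λ i → State.heap s (toℕ i)) ≡ Vec.map toℕ τ₀ →
              (∀ τ → 0# ≤ r τ) → 1# ≤ r τ₀ → 0# ≤ e → Good t s r e
  good-halt t {s} {r} τ₀ eq out 0≤r 1≤r 0≤e = record
    { output≤        = λ τ → ≤-trans (≤-reflexive (output τ)) (bound τ)
    ; time≤          = ≤-trans (≤-reflexive (time-halt t eq)) 0≤e
    ; halting-nonneg = ≤-trans 0≤1 (≤-reflexive (sym halting≡1))
    ; markov         = ≤-reflexive (trans
        (trans (cong (λ h → fromℕ t * (1# - h)) halting≡1) (trans (cong (fromℕ t *_) (-‿inverseʳ 1#)) (zeroʳ _)))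
        (sym (time-halt t eq)))
    }
    where
    τ₀≟_ : (τ : Vec (Fin q) k) → Dec (τ₀ ≡ τ)
    τ₀≟_ = Vecₚ.≡-dec Finₚ._≟_ τ₀
    output : ∀ τ → Pr[ t , P outputs τ ] s ≡ 𝟙 (τ₀≟ τ)
    output τ = trans (Pr-halt t s τ eq) (𝟙-⇔
      (Vecₚ.≡-dec ℕₚ._≟_ (Vec.tabulate (λ i → State.heap s (toℕ i))) (Vec.map toℕ τ)) (τ₀≟ τ)
      (λ out′ → map-toℕ-injective τ₀ τ (trans (sym out) out′))
      (λ { refl → out }))
    bound : ∀ τ → 𝟙 (τ₀≟ τ) ≤ r τ
    bound τ with τ₀≟ τ
    ... | yes refl = 1≤r
    ... | no _     = 0≤r τ
    halting≡1 : halting t s ≡ 1#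
    halting≡1 = trans (∑-cong (configurations q k) output) (∑-configurations-𝟙 τ₀)

  expect-map : {I : Set} (f : State → ℝ) (p : I → ℝ) (next : I → State) (is : List I) →
               expect f (map (λ j → p j , next j) is) ≡ ∑ (map (λ j → p j * f (next j)) is)
  expect-map f p next is = cong ∑ (sym (Listₚ.map-∘ is))

  -- For `markov`, (t + 1)(1 - h) is split into (1 - h) and t (1 - h). The first part is at most 1,
  -- by `halting-nonneg`, and so is paid by the cost of this very step; the second is an average of
  -- the bounds for the successors.
  good-step : {I : Set} (is : List I) (p : I → ℝ) (next : I → State)
    {r : I → Vec (Fin q) k → ℝ} {e : I → ℝ} → ∀ {t s i} →
    nth P (State.pc s) ≡ just i → step i s ≡ map (λ j → p j , next j) is → 1 ℕ.≤ cost i →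
    (∀ j → 0# ≤ p j) → ∑ (map p is) ≡ 1# →
    (∀ j → Good t (next j) (r j) (e j)) →
    Good (suc t) s (λ τ → ∑ (map (λ j → p j * r j τ) is))
                   (fromℕ (cost i) + ∑ (map (λ j → p j * e j) is))
  good-step is p next {r} {e} {t} {s} {i} eq step≡ 1≤cost 0≤p ∑p≡1 good = record
    { output≤ = λ τ → ≤-trans (≤-reflexive (output τ))
        (∑-mono is (λ j → *-monoˡ-≤ (0≤p j) (Good.output≤ (good j) τ)))
    ; time≤ = ≤-trans (≤-reflexive time)
        (+-monoʳ-≤ _ (∑-mono is (λ j → *-monoˡ-≤ (0≤p j) (Good.time≤ (good j)))))
    ; halting-nonneg = 0≤halting
    ; markov = begin
        (1# + fromℕ t) * (1# - halting (suc t) s)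
          ≡⟨ solve 2 (λ t h → (lit 1 :+ t) :* (lit 1 :- h) := (lit 1 :- h) :+ (t :* lit 1 :+ (:- t) :* h))
               refl (fromℕ t) _ ⟩
        (1# - halting (suc t) s) + (fromℕ t * 1# + (- fromℕ t) * halting (suc t) s)
          ≤⟨ +-mono-≤ (≤-trans (x-y≤x 0≤halting) (1≤fromℕ 1≤cost)) (≤-reflexive unfinished) ⟩
        fromℕ (cost i) + ∑ (map (λ j → p j * (fromℕ t * (1# - halting t (next j)))) is)
          ≤⟨ +-monoʳ-≤ _ (∑-mono is (λ j → *-monoˡ-≤ (0≤p j) (Good.markov (good j)))) ⟩
        fromℕ (cost i) + ∑ (map (λ j → p j * expectedTime t P (next j)) is)
          ≡⟨ time ⟨
        expectedTime (suc t) P s ∎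
    }
    where
    open ≤-Reasoning
    S = configurations q k
    output : ∀ τ → Pr[ suc t , P outputs τ ] s ≡ ∑ (map (λ j → p j * Pr[ t , P outputs τ ] (next j)) is)
    output τ = trans (Pr-suc {t} τ eq) (trans (cong (expect _) step≡) (expect-map _ p next is))
    time : expectedTime (suc t) P s ≡ fromℕ (cost i) + ∑ (map (λ j → p j * expectedTime t P (next j)) is)
    time = trans (time-suc {t} eq) (cong (fromℕ (cost i) +_) (trans (cong (expect _) step≡) (expect-map _ p next is)))
    halting-suc : halting (suc t) s ≡ ∑ (map (λ j → p j * halting t (next j)) is)
    halting-suc = trans (∑-cong S output) (trans (∑-swap _ S is) (∑-cong is (λ j → ∑-*ˡ (p j) _ S)))
    0≤halting : 0# ≤ halting (suc t) s
    0≤halting = subst (0# ≤_) (sym halting-suc) (∑-nonneg is (λ j → *-nonneg (0≤p j) (Good.halting-nonneg (good j))))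
    unfinished : fromℕ t * 1# + (- fromℕ t) * halting (suc t) s ≡
                 ∑ (map (λ j → p j * (fromℕ t * (1# - halting t (next j)))) is)
    unfinished = trans (cong₂ (λ a b → fromℕ t * a + (- fromℕ t) * b) (sym ∑p≡1) halting-suc)
      (trans (sym (cong₂ _+_ (∑-*ˡ (fromℕ t) p is) (∑-*ˡ (- fromℕ t) _ is)))
      (trans (sym (∑-+ _ _ is)) (∑-cong is (λ j →
        solve 3 (λ t p h → t :* p :+ (:- t) :* (p :* h) := p :* (t :* (lit 1 :- h))) refl (fromℕ t) (p j) _))))

  -- Defined on the deterministic instructions only, so that `run` executes straight-line code by
  -- computation and its result can be checked by `refl`.
  next : Instr → State → Maybe State
  next (coin _ _) s = nothing
  next (draw _ _) s = nothing
  next i          s = Maybe.map proj₂ (head (step i s))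

  run : ℕ → State → Maybe State
  run zero    s = just s
  run (suc n) s = nth P (State.pc s) >>= λ i → next i s >>= run n

  next-step : ∀ i {s s′} → next i s ≡ just s′ → step i s ≡ (1# , s′) ∷ [] × cost i ≡ 1
  next-step (set _ _)             refl = refl , refl
  next-step (add _ _ _)           refl = refl , refl
  next-step (monus _ _ _)         refl = refl , refl
  next-step (load _ _)            refl = refl , refl
  next-step (store _ _)           refl = refl , refl
  next-step (jump _)              refl = refl , refl
  next-step (jumpZero _ _)        refl = refl , refl
  next-step (setʳ _ _)            refl = refl , refl
  next-step (fromNat _ _)         refl = refl , refl
  next-step (addʳ _ _ _)          refl = refl , refl
  next-step (subʳ _ _ _)          refl = refl , refl
  next-step (mulʳ _ _ _)          refl = refl , refl
  next-step (divʳ _ _ _)          refl = refl , refl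
  next-step (jumpLeqʳ _ _ _)      refl = refl , refl
  next-step (deg _ _)             refl = refl , refl
  next-step (nbr _ _ _)           refl = refl , refl
  next-step (λ-entry _ _ _)       refl = refl , refl
  next-step (A-entry _ _ _ _ _)   refl = refl , refl

  infix  4 _⟶⟨_⟩_
  infixr 5 _then_

  -- A record instead of the bare equation, so that the end points remain visible to unification
  -- when stretches are chained.
  record _⟶⟨_⟩_ (s : State) (n : ℕ) (s′ : State) : Set where
    constructor ran
    field
      run≡ : run n s ≡ just s′

  steps : ∀ n {s s′} → run n s ≡ just s′ → s ⟶⟨ n ⟩ s′
  steps n = ran

  _then_ : ∀ {m n s s′ s″} → s ⟶⟨ m ⟩ s′ → s′ ⟶⟨ n ⟩ s″ → s ⟶⟨ m ℕ.+ n ⟩ s″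
  _then_ {m} {n} {s} (ran eq) (ran eq′) = ran (compose m {n} {s} eq eq′)
    where
    compose : ∀ m {n s s′ s″} → run m s ≡ just s′ → run n s′ ≡ just s″ → run (m ℕ.+ n) s ≡ just s″
    compose zero    refl eq′ = eq′
    compose (suc m) {n} {s} eq eq′ with nth P (State.pc s)
    ... | just i with next i s
    ...   | just s₁ = compose m {n} eq eq′

  -- The value of the tested register is known only up to a proof, so `run` is stuck at a
  -- conditional jump; this lemma and the next one step over it.
  jumpZero-0 : ∀ {pc N R H a l} → nth P pc ≡ just (jumpZero a l) → N a ≡ 0 →
               mkState pc N R H ⟶⟨ 1 ⟩ mkState l N R H
  jumpZero-0 {pc} eq Na≡0 = ran (run≡ {pc} eq Na≡0)
    where
    run≡ : ∀ {pc N R H a l} → nth P pc ≡ just (jumpZero a l) → N a ≡ 0 →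
           run 1 (mkState pc N R H) ≡ just (mkState l N R H)
    run≡ {pc} eq Na≡0 rewrite eq | Na≡0 = refl

  jumpZero-suc : ∀ {pc N R H a l x} → nth P pc ≡ just (jumpZero a l) → N a ≡ suc x →
                 mkState pc N R H ⟶⟨ 1 ⟩ mkState (suc pc) N R H
  jumpZero-suc {pc} eq Na≡suc = ran (run≡ {pc} eq Na≡suc)
    where
    run≡ : ∀ {pc N R H a l x} → nth P pc ≡ just (jumpZero a l) → N a ≡ suc x →
           run 1 (mkState pc N R H) ≡ just (mkState (suc pc) N R H)
    run≡ {pc} eq Na≡suc rewrite eq | Na≡suc = refl

  -- A stretch has at least one step, so its end is needed only for strictly smaller t, which is
  -- what makes an induction from cut to cut possible. If the steps run out inside the stretch,
  -- nothing has been output and nonnegativity of the bounds suffices.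
  good-run : ∀ {n t s s′ r e} → s ⟶⟨ suc n ⟩ s′ → (∀ τ → 0# ≤ r τ) → 0# ≤ e →
             (∀ {t′} → t′ ℕ.< t → Good t′ s′ r e) → Good t s r (fromℕ (suc n) + e)
  good-run {n} {t} {s} (ran eq) 0≤r 0≤e good with nth P (State.pc s) in pc≡
  ... | just i with next i s in next≡
  good-run {n} {zero}  (ran eq) 0≤r 0≤e good | just i | just s₁ =
    good-zero pc≡ 0≤r (+-nonneg (fromℕ-nonneg (suc n)) 0≤e)
  good-run {n} {suc t} {s} {s′} {r} {e} (ran eq) 0≤r 0≤e good | just i | just s₁ =
    good-weaken (λ τ → ≤-reflexive (solve 1 (λ r → lit 1 :* r :+ lit 0 := r) refl (r τ)))
      (≤-reflexive (trans (cong (λ c → fromℕ c + (1# * (fromℕ n + e) + 0#)) (proj₂ (next-step i next≡)))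
        (solve 2 (λ n e → (lit 1 :+ lit 0) :+ (lit 1 :* (n :+ e) :+ lit 0) := lit 1 :+ n :+ e) refl (fromℕ n) e)))
      (good-step (tt ∷ []) (λ _ → 1#) (λ _ → s₁) {λ _ → r} {λ _ → fromℕ n + e} pc≡ (proj₁ (next-step i next≡))
        (ℕₚ.≤-reflexive (sym (proj₂ (next-step i next≡)))) (λ _ → 0≤1) (+-identityʳ 1#)
        (λ { _ → continue n eq }))
    where
    continue : ∀ n → run n s₁ ≡ just s′ → Good t s₁ r (fromℕ n + e)
    continue zero    refl = good-weaken (λ _ → ≤-refl) (≤-reflexive (sym (+-identityˡ e))) (good ℕₚ.≤-refl)
    continue (suc n) eq   = good-run {n} (ran eq) 0≤r 0≤e (λ t′<t → good (ℕₚ.m<n⇒m<1+n t′<t))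

  good-branch : ∀ {I : Set} (is : List I) (p : I → ℝ) (next : I → State)
    {r : I → Vec (Fin q) k → ℝ} {e : I → ℝ} {t s i} →
    nth P (State.pc s) ≡ just i → step i s ≡ map (λ j → p j , next j) is → 1 ℕ.≤ cost i →
    (∀ j → 0# ≤ p j) → ∑ (map p is) ≡ 1# → (∀ j τ → 0# ≤ r j τ) → (∀ j → 0# ≤ e j) →
    (∀ {t′} → t′ ℕ.< t → ∀ j → Good t′ (next j) (r j) (e j)) →
    Good t s (λ τ → ∑ (map (λ j → p j * r j τ) is))
             (fromℕ (cost i) + ∑ (map (λ j → p j * e j) is))
  good-branch is p next {t = zero} {i = i} eq step≡ 1≤cost 0≤p ∑p≡1 0≤r 0≤e good = good-zero eq
    (λ τ → ∑-nonneg is (λ j → *-nonneg (0≤p j) (0≤r j τ)))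
    (+-nonneg (fromℕ-nonneg (cost i)) (∑-nonneg is (λ j → *-nonneg (0≤p j) (0≤e j))))
  good-branch is p next {t = suc t} eq step≡ 1≤cost 0≤p ∑p≡1 0≤r 0≤e good =
    good-step is p next eq step≡ 1≤cost 0≤p ∑p≡1 (good ℕₚ.≤-refl)

  good-coin : ∀ {t pc N R H d a r₁ r₀ e₁ e₀} → nth P pc ≡ just (coin d a) →
    (∀ τ → 0# ≤ r₁ τ) → 0# ≤ e₁ → (∀ τ → 0# ≤ r₀ τ) → 0# ≤ e₀ →
    (∀ {t′} → t′ ℕ.< t → Good t′ (mkState (suc pc) (N [ d ↦ 1 ]) R H) r₁ e₁) →
    (∀ {t′} → t′ ℕ.< t → Good t′ (mkState (suc pc) (N [ d ↦ 0 ]) R H) r₀ e₀) →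
    let p = clamp (R a) in
    Good t (mkState pc N R H) (λ τ → p * r₁ τ + (1# - p) * r₀ τ) (fromℕ 1 + (p * e₁ + (1# - p) * e₀))
  good-coin {t} {pc} {N} {R} {H} {d} {a} {r₁} {r₀} {e₁} {e₀} eq 0≤r₁ 0≤e₁ 0≤r₀ 0≤e₀ good₁ good₀ =
    good-weaken (λ τ → ≤-reflexive (cong (p * r₁ τ +_) (+-identityʳ _)))
                (≤-reflexive (cong (λ y → fromℕ 1 + (p * e₁ + y)) (+-identityʳ _)))
      (good-branch (true ∷ false ∷ []) prob next′ {λ b → if b then r₁ else r₀} {λ b → if b then e₁ else e₀}
        eq refl ℕₚ.≤-refl
        (λ { true → clamp-nonneg (R a) ; false → x≤y⇒0≤y-x (clamp≤1 (R a)) })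
        (solve 1 (λ p → p :+ ((lit 1 :- p) :+ lit 0) := lit 1) refl p)
        (λ { true → 0≤r₁ ; false → 0≤r₀ }) (λ { true → 0≤e₁ ; false → 0≤e₀ })
        (λ { t′<t true → good₁ t′<t ; t′<t false → good₀ t′<t }))
    where
    p = clamp (R a)
    prob : Bool → ℝ
    prob b = if b then p else 1# - p
    next′ : Bool → State
    next′ b = mkState (suc pc) (N [ d ↦ (if b then 1 else 0) ]) R H

  -- No output probability exceeds its limit, so a single deficit is at most the sum of all
  -- deficits, which is 1 minus the halting probability and hence at most B / t.
  good⇒⟶ : ∀ {s μ B} → (∀ t → Good t s μ B) → ∑ (map μ (configurations q k)) ≡ 1# →
            ∀ τ → (λ t → Pr[ t , P outputs τ ] s) ⟶ μ τ
  good⇒⟶ {s} {μ} {B} good ∑μ≡1 τ ε 0<ε@(0≤ε , _) with archimedean (B / ε)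
  -- `suc N` instead of `N` keeps t positive, as the estimate is obtained by cancelling `fromℕ t`.
  ... | N , B/ε≤N = suc N , λ t N<t → upper t , lower t N<t
    where
    open ≤-Reasoning
    gap : ∀ t τ → 0# ≤ μ τ - Pr[ t , P outputs τ ] s
    gap t τ = x≤y⇒0≤y-x (Good.output≤ (good t) τ)
    upper : ∀ t → Pr[ t , P outputs τ ] s - μ τ ≤ ε
    upper t = ≤-trans (0≤y-x⇒x≤y (≤-trans (gap t τ) (≤-reflexive
      (solve 2 (λ m p → m :- p := lit 0 :- (p :- m)) refl (μ τ) (Pr[ t , P outputs τ ] s))))) 0≤ε
    lower : ∀ t → suc N ℕ.≤ t → μ τ - Pr[ t , P outputs τ ] s ≤ ε
    lower t N<t = *-cancelˡ-≤ (<-≤-trans 0<1 (1≤fromℕ (ℕₚ.≤-trans (ℕ.s≤s ℕ.z≤n) N<t))) (begin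
      fromℕ t * (μ τ - Pr[ t , P outputs τ ] s)
        ≤⟨ *-monoˡ-≤ (fromℕ-nonneg t) (term≤∑ (gap t) (∈-configurations τ)) ⟩
      fromℕ t * ∑ (map (λ τ → μ τ - Pr[ t , P outputs τ ] s) (configurations q k))
        ≡⟨ cong (fromℕ t *_) total-gap ⟩
      fromℕ t * (1# - halting t s)
        ≤⟨ ≤-trans (Good.markov (good t)) (Good.time≤ (good t)) ⟩
      B
        ≡⟨ y*[x/y]≡x (<⇒≢0 0<ε) ⟨
      ε * (B / ε)
        ≤⟨ *-monoˡ-≤ 0≤ε (≤-trans B/ε≤N (fromℕ-mono (ℕₚ.<⇒≤ N<t))) ⟩
      ε * fromℕ t
        ≡⟨ *-comm ε _ ⟩
      fromℕ t * ε ∎)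
      where
      total-gap : ∑ (map (λ τ → μ τ - Pr[ t , P outputs τ ] s) (configurations q k)) ≡ 1# - halting t s
      total-gap = trans (∑-cong (configurations q k) (λ τ → cong (μ τ +_)
          (solve 1 (λ p → :- p := (:- lit 1) :* p) refl (Pr[ t , P outputs τ ] s))))
        (trans (∑-+ μ _ (configurations q k)) (cong₂ _+_ ∑μ≡1 (trans (∑-*ˡ (- 1#) _ (configurations q k))
          (solve 1 (λ p → (:- lit 1) :* p := :- p) refl (halting t s)))))

-- Neighbour lists and the layout of the heap.

drop-∷-∈ : {X : Set} (i : ℕ) (xs : List X) {y : X} {ys : List X} →
           drop i xs ≡ y ∷ ys → ∀ {z} → z ∈ y ∷ ys → z ∈ xs
drop-∷-∈ i xs eq z∈ = subst (_ ∈_) (Listₚ.take++drop≡id i xs) (∈-++⁺ʳ (take i xs) (subst (_ ∈_) (sym eq) z∈))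

pos⇒suc : ∀ {m} → 0 ℕ.< m → ∃ λ x → m ≡ suc x
pos⇒suc {suc x} _ = x , refl

drop-suc : {X : Set} (i : ℕ) (xs : List X) {y : X} {ys : List X} →
           drop i xs ≡ y ∷ ys → drop (suc i) xs ≡ ys
drop-suc zero    (x ∷ xs) refl = refl
drop-suc (suc i) (x ∷ xs) eq   = drop-suc i xs eq

-- The heap holds the input and output list below k, and above it the spin of slot
-- m at cell m and the stack, interleaved so that both can grow.
module Layout (k : ℕ) where

  cell stackCell : ℕ → ℕ
  cell m      = k ℕ.+ (m ℕ.+ m)
  stackCell p = suc (k ℕ.+ (p ℕ.+ p))

  cell-+ : ∀ x y → cell x ℕ.+ (y ℕ.+ y) ≡ cell (y ℕ.+ x)
  cell-+ x y = solve 3 (λ k x y → k :+ (x :+ x) :+ (y :+ y) := k :+ (y :+ x :+ (y :+ x))) refl k x y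
    where open +-*-Solver

  stackCell-suc : ∀ p → 2 ℕ.+ stackCell p ≡ stackCell (suc p)
  stackCell-suc p = cong suc (solve 2 (λ k p → con 2 :+ (k :+ (p :+ p)) := k :+ (con 1 :+ p :+ (con 1 :+ p))) refl k p)
    where open +-*-Solver

  private
    double-< : ∀ {m n} → m ℕ.< n → m ℕ.+ m ℕ.< n ℕ.+ n
    double-< m<n = ℕₚ.+-mono-< m<n m<n

    double-injective : ∀ {m n} → m ℕ.+ m ≡ n ℕ.+ n → m ≡ n
    double-injective {m} {n} eq with ℕₚ.<-cmp m n
    ... | tri< m<n _ _ = contradiction eq (ℕₚ.<⇒≢ (double-< m<n))
    ... | tri≈ _ m≡n _ = m≡n
    ... | tri> _ _ n<m = contradiction (sym eq) (ℕₚ.<⇒≢ (double-< n<m))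

    even≢odd : ∀ m n → m ℕ.+ m ≢ suc (n ℕ.+ n)
    even≢odd (suc m) zero    eq = contradiction (trans (sym (ℕₚ.+-suc m m)) (ℕₚ.suc-injective eq)) λ ()
    even≢odd (suc m) (suc n) eq = even≢odd m n (ℕₚ.suc-injective (trans (sym (ℕₚ.+-suc m m))
      (trans (ℕₚ.suc-injective eq) (cong suc (ℕₚ.+-suc n n)))))

  cell-injective : ∀ {m n} → cell m ≡ cell n → m ≡ n
  cell-injective eq = double-injective (ℕₚ.+-cancelˡ-≡ k _ _ eq)

  stackCell-injective : ∀ {p r} → stackCell p ≡ stackCell r → p ≡ r
  stackCell-injective eq = cell-injective (ℕₚ.suc-injective eq)

  cell≢stackCell : ∀ m p → cell m ≢ stackCell p
  cell≢stackCell m p eq = even≢odd m p (ℕₚ.+-cancelˡ-≡ k _ _ (trans eq (sym (ℕₚ.+-suc k _))))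

  k≤cell : ∀ m → k ℕ.≤ cell m
  k≤cell m = ℕₚ.m≤m+n k _

  k≤stackCell : ∀ p → k ℕ.≤ stackCell p
  k≤stackCell p = ℕₚ.≤-trans (ℕₚ.m≤m+n k _) (ℕₚ.n≤1+n _)

  stackCell∸k∸1 : ∀ p → stackCell p ℕ.∸ k ℕ.∸ 1 ≡ p ℕ.+ p
  stackCell∸k∸1 p = cong (ℕ._∸ 1) (trans (cong (ℕ._∸ k) (sym (ℕₚ.+-suc k (p ℕ.+ p)))) (ℕₚ.m+n∸m≡n k _))

  pushed : (ℕ → ℕ) → ℕ → ℕ → ℕ → ℕ → ℕ → ℕ → ℕ
  pushed H p x y z w =
    H [ stackCell p ↦ x ] [ stackCell (1 ℕ.+ p) ↦ y ] [ stackCell (2 ℕ.+ p) ↦ z ] [ stackCell (3 ℕ.+ p) ↦ w ]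

  module _ {H : ℕ → ℕ} {p x y z w : ℕ} where
    private
      H₁ = H  [ stackCell p ↦ x ]
      H₂ = H₁ [ stackCell (1 ℕ.+ p) ↦ y ]
      H₃ = H₂ [ stackCell (2 ℕ.+ p) ↦ z ]
      H₄ = H₃ [ stackCell (3 ℕ.+ p) ↦ w ]

      below : ∀ i j → i ℕ.< j → stackCell (i ℕ.+ p) ≢ stackCell (j ℕ.+ p)
      below i j i<j eq = ℕₚ.<⇒≢ (ℕₚ.+-monoˡ-< p i<j) (stackCell-injective eq)

    pushed₀ : H₄ (stackCell p) ≡ x
    pushed₀ = trans ([↦]-other H₃ (below 0 3 ℕ.z<s)) (trans ([↦]-other H₂ (below 0 2 ℕ.z<s))
      (trans ([↦]-other H₁ (below 0 1 ℕ.z<s)) ([↦]-same H {stackCell p} refl)))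

    pushed₁ : H₄ (stackCell (1 ℕ.+ p)) ≡ y
    pushed₁ = trans ([↦]-other H₃ (below 1 3 (ℕ.s<s ℕ.z<s))) (trans ([↦]-other H₂ (below 1 2 (ℕ.s<s ℕ.z<s)))
      ([↦]-same H₁ {stackCell (1 ℕ.+ p)} refl))

    pushed₂ : H₄ (stackCell (2 ℕ.+ p)) ≡ z
    pushed₂ = trans ([↦]-other H₃ (below 2 3 (ℕ.s<s (ℕ.s<s ℕ.z<s)))) ([↦]-same H₂ {stackCell (2 ℕ.+ p)} refl)

    pushed₃ : H₄ (stackCell (3 ℕ.+ p)) ≡ w
    pushed₃ = [↦]-same H₃ {stackCell (3 ℕ.+ p)} refl

    pushed-other : ∀ {b} → (∀ r → p ℕ.≤ r → b ≢ stackCell r) → H₄ b ≡ H b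
    pushed-other b≢ =
      trans ([↦]-other H₃ (b≢ _ (ℕₚ.m≤n+m p 3))) (trans ([↦]-other H₂ (b≢ _ (ℕₚ.m≤n+m p 2)))
      (trans ([↦]-other H₁ (b≢ _ (ℕₚ.m≤n+m p 1))) ([↦]-other H (b≢ _ ℕₚ.≤-refl))))

  push-step : ∀ p {m two} → m ≡ stackCell p → two ≡ 2 → two ℕ.+ m ≡ stackCell (suc p)
  push-step p m≡ two≡ = trans (cong₂ ℕ._+_ two≡ m≡) (stackCell-suc p)

  pop-step : ∀ p {m two} → m ≡ stackCell (suc p) → two ≡ 2 → m ℕ.∸ two ≡ stackCell p
  pop-step p m≡ two≡ = trans (cong₂ ℕ._∸_ m≡ two≡) (cong (ℕ._∸ 2) (sym (stackCell-suc p)))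

  store⁴-cong : ∀ {H : ℕ → ℕ} {a a′ b b′ c c′ d d′ x x′ y y′ z z′ w w′} →
    a ≡ a′ → b ≡ b′ → c ≡ c′ → d ≡ d′ → x ≡ x′ → y ≡ y′ → z ≡ z′ → w ≡ w′ →
    H [ a ↦ x ] [ b ↦ y ] [ c ↦ z ] [ d ↦ w ] ≡ H [ a′ ↦ x′ ] [ b′ ↦ y′ ] [ c′ ↦ z′ ] [ d′ ↦ w′ ]
  store⁴-cong refl refl refl refl refl refl refl refl = refl

-- The program.

module Sampler (𝓡 : Reals) where
  open Reals 𝓡
  open Sampling 𝓡

  -- Natural registers: 3 k, 4 zero, 5 2|V|, 6 top of the stack, 7 two, 8 one,
  -- 9 number of spins output so far; for the current slot: 10 cell of its sweep,
  -- 11 vertex, 12 proposed spin, 13 position in the list of neighbours, 14 degree;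
  -- 15 neighbour, 16 address, 17 spin plus one, 18 scratch.
  -- Real registers: 0 θ, 1 Δ, 2 η, 3 one, 4 scratch.  The numbers below are the
  -- addresses of jump targets.
  sampler : ℝ → Program
  sampler η =
    add 5 2 2          ∷
    set 7 2            ∷
    set 8 1            ∷
    -- The address k + 1 is `stackCell 0`: the stack starts empty.
    add 6 8 3          ∷
    fromNat 1 1        ∷
    setʳ 2 η           ∷
    divʳ 0 2 1         ∷
    setʳ 3 1#          ∷
    monus 18 3 9       ∷   -- 8: next vertex of Λ
    jumpZero 18 69     ∷
    load 11 9          ∷
    add 10 3 4         ∷
    add 16 11 11       ∷   -- 12: query
    add 16 10 16       ∷
    load 17 16         ∷
    jumpZero 17 17     ∷
    jump 43            ∷
    deg 14 11          ∷   -- 17: new trial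
    draw 12 11         ∷
    set 13 0           ∷
    monus 18 14 13     ∷   -- 20: next neighbour
    jumpZero 18 39     ∷
    coin 18 0          ∷
    jumpZero 18 63     ∷
    nbr 15 11 13       ∷
    store 6 10         ∷
    add 6 7 6          ∷
    store 6 11         ∷
    add 6 7 6          ∷
    store 6 12         ∷
    add 6 7 6          ∷
    store 6 13         ∷
    add 6 7 6          ∷
    -- Zero exactly when the neighbour is not numbered after the vertex. Its last update then lies
    -- in the next older sweep, and the address of the sweep grows by 2|V|, as consecutive slots are
    -- two cells apart.
    monus 18 15 11     ∷
    jumpZero 18 36     ∷
    jump 37            ∷
    add 10 10 5        ∷
    add 11 15 4        ∷
    jump 12            ∷
    add 16 11 11       ∷   -- 39: accept
    add 16 10 16       ∷
    add 17 8 12        ∷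
    store 16 17        ∷
    monus 18 6 3       ∷   -- 43: return
    -- Top minus k minus 1 is twice the number of stacked entries; it is zero when the query came
    -- from the main loop.
    monus 18 18 8      ∷
    jumpZero 18 65     ∷
    monus 6 6 7        ∷
    load 13 6          ∷
    monus 6 6 7        ∷
    load 12 6          ∷
    monus 6 6 7        ∷
    load 11 6          ∷
    monus 6 6 7        ∷
    load 10 6          ∷
    -- Degree and neighbour are not kept on the stack; they are probed again from the restored
    -- vertex and position.
    deg 14 11          ∷
    nbr 15 11 13       ∷
    monus 17 17 8      ∷
    A-entry 4 11 15 12 17 ∷
    subʳ 4 3 4         ∷
    divʳ 4 4 0         ∷
    coin 18 4          ∷
    jumpZero 18 63     ∷
    jump 17            ∷
    add 13 8 13        ∷   -- 63: passed
    jump 20            ∷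
    monus 17 17 8      ∷   -- 65: output
    store 9 17         ∷
    add 9 8 9          ∷
    jump 8             ∷ []

-- Conditional laws given the memo and the stack, their encoding in memory, and time budgets.

module Soundness (𝓡 : Reals) {q : ℕ} (2≤q : 2 ℕ.≤ q) (𝓢 : Sampling.SpinSystem 𝓡 q)
  .{{_ : NonZero (Graph.order (Sampling.SpinSystem.graph 𝓢))}}
  (η θ : Reals.ℝ 𝓡)
  (η/Δ≡θ : Reals._/_ 𝓡 η (Reals.fromℕ 𝓡 (Graph.maxDegree (Sampling.SpinSystem.graph 𝓢))) ≡ θ)
  (nearlyFree : Hypotheses.NearlyFree 𝓡 𝓢 θ)
  (k : ℕ) (Λ : Vec (Graph.V (Sampling.SpinSystem.graph 𝓢)) k)
  (R : Reals.ℝ 𝓡) (0≤R : Reals._≤_ 𝓡 (Reals.0# 𝓡) R) where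
  open Reals 𝓡
  open Sampling 𝓡
  open SpinSystem 𝓢
  open Hypotheses.NearlyFree nearlyFree
  open Hypotheses.Positive positive
  open OrderedField 𝓡
  open FiniteSums 𝓡
  open Sampler 𝓡
  open Process 𝓡 𝓢 θ nearlyFree
  open Layout k
  open Execution 𝓢
  open Bounds 𝓡 𝓢 (sampler η) k

  Memo : Set
  Memo = ℕ → Maybe (Fin q)

  -- A trial for slot row vertex that waits for the spin of its neighbour at pos.
  record Frame : Set where
    field
      row    : ℕ
      vertex : V
      spin   : Fin q
      pos    : ℕ
      {nb}   : V
      {rest} : List V
      drop≡  : drop pos (neighbours vertex) ≡ nb ∷ rest

    nb∈ : nb ∈ neighbours vertex
    nb∈ = drop-∷-∈ pos (neighbours vertex) drop≡ (here refl)

    rest⊆ : ∀ {u} → u ∈ rest → u ∈ neighbours vertex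
    rest⊆ = drop-∷-∈ pos (neighbours vertex) drop≡ ∘ there

    nb≢ : nb ≢ vertex
    nb≢ nb≡v = loopless vertex (subst (_∈ neighbours vertex) nb≡v nb∈)

    here-slot : ℕ
    here-slot = slot row vertex

    kernel : Kernel
    kernel = waiting vertex spin nb rest

  open Frame

  remaining : ∀ {v} {N : ℕ → ℕ} {i us} → N 13 ≡ i → N 14 ≡ degree v → drop i (neighbours v) ≡ us →
              N 14 ℕ.∸ N 13 ≡ length us
  remaining {v} {i = i} pos≡ degree≡ drop≡ =
    trans (cong₂ ℕ._∸_ degree≡ pos≡) (trans (sym (Listₚ.length-drop i (neighbours v))) (cong length drop≡))

  neighbour≡ : ∀ {v} {N : ℕ → ℕ} {i u us} → N 11 ≡ toℕ v → N 13 ≡ i → drop i (neighbours v) ≡ u ∷ us →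
               at 0 (λ x → maybe′ toℕ 0 (nth (neighbours x) (N 13))) (N 11) ≡ toℕ u
  neighbour≡ {v} vertex≡ pos≡ drop≡ = trans (at-≡ vertex≡)
    (cong (maybe′ toℕ 0) (trans (cong (nth (neighbours v)) pos≡) (cong head drop≡)))

  -- The chain conditioned on what the machine knows: known spins are pinned, the slot of each
  -- suspended trial carries its waiting law, all other slots are fresh.
  kernels : Memo → List Frame → ℕ → Kernel
  kernels memo []       = resolved memo
  kernels memo (f ∷ fs) = kernels memo fs [ here-slot f ↦ kernel f ]

  -- The slot row v has been called for by the topmost of the frames, or by the main
  -- loop in order to output its (j + 1)-st spin.
  data Called (memo : Memo) (j : ℕ) : List Frame → ℕ → V → Set where
    by-main  : ∀ i → toℕ i ≡ j → Called memo j [] 0 (lookup Λ i)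
    by-frame : ∀ {f fs} → Called memo j fs (row f) (vertex f) → memo (here-slot f) ≡ nothing →
               Called memo j (f ∷ fs) (previous (row f) (vertex f) (nb f)) (nb f)

  -- Slots strictly increase towards the top of the stack, since each frame calls for an earlier
  -- update; so all suspended trials sit strictly below the slot being called for.
  kernels-above : ∀ {memo j fs a v m} → Called memo j fs a v → slot a v ℕ.≤ m →
                  kernels memo fs m ≡ resolved memo m
  kernels-above (by-main i _) _ = refl
  kernels-above {memo} (by-frame {f} {fs} called _) slot≤m =
    trans ([↦]-other (kernels memo fs) (ℕₚ.<⇒≢ below ∘ sym)) (kernels-above called (ℕₚ.<⇒≤ below))
    where
    below = ℕₚ.<-≤-trans (slot<slot-previous (row f) (nb≢ f)) slot≤m

  kernels-fresh : ∀ {memo j fs a v} → Called memo j fs a v → memo (slot a v) ≡ nothing →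
                  ∀ σ x → kernels memo fs (slot a v) σ x ≡ glauber v σ x
  kernels-fresh {memo} {fs = fs} {a} {v} called eq σ x = trans
    (cong (λ κ → κ σ x) (trans (kernels-above called ℕₚ.≤-refl) (resolved-nothing memo {slot a v} eq)))
    (cong (λ v → glauber v σ x) (vertexOf-slot a v))

  called-resolve : ∀ {memo j fs a v m s} → Called memo j fs a v → slot a v ℕ.≤ m →
                   Called (memo [ m ↦ just s ]) j fs a v
  called-resolve (by-main i eq) _ = by-main i eq
  called-resolve {memo} (by-frame {f} called eq) slot≤m =
    by-frame (called-resolve called (ℕₚ.<⇒≤ below)) (trans ([↦]-other memo (ℕₚ.<⇒≢ below)) eq)
    where
    below = ℕₚ.<-≤-trans (slot<slot-previous (row f) (nb≢ f)) slot≤m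

  -- The resolved slot differs from the slots of all suspended trials, so pinning it in the memo,
  -- underneath the frames, is the same as pinning it on top of them.
  kernels-resolve : ∀ {memo j fs a v m s} → Called memo j fs a v → slot a v ℕ.≤ m → ∀ i σ x →
                    kernels (memo [ m ↦ just s ]) fs i σ x ≡ (kernels memo fs [ m ↦ pinned s ]) i σ x
  kernels-resolve {memo} {m = m} {s} (by-main _ _) _ i σ x with i ℕₚ.≟ m
  ... | yes refl = trans (cong (λ κ → κ σ x) (resolved-just (memo [ m ↦ just s ]) ([↦]-same memo {m} refl)))
                         (sym (set-same (resolved memo) m (pinned s) σ x))
  ... | no i≢m   = trans (cong (λ r → maybe′ pinned (glauber (vertexOf i)) r σ x) ([↦]-other memo i≢m))
                         (sym (set-other (resolved memo) (pinned s) i≢m σ x))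
  kernels-resolve {memo} {m = m} {s} (by-frame {f} {fs} called _) slot≤m i σ x with i ℕₚ.≟ here-slot f
  ... | yes refl = trans (set-same (kernels (memo [ m ↦ just s ]) fs) (here-slot f) (kernel f) σ x) (sym
      (trans (set-other (kernels memo (f ∷ fs)) (pinned s) (ℕₚ.<⇒≢ below) σ x)
             (set-same (kernels memo fs) (here-slot f) (kernel f) σ x)))
    where
    below = ℕₚ.<-≤-trans (slot<slot-previous (row f) (nb≢ f)) slot≤m
  ... | no i≢f = trans (set-other (kernels (memo [ m ↦ just s ]) fs) (kernel f) i≢f σ x)
      (trans (kernels-resolve called (ℕₚ.<⇒≤ below) i σ x) (sym (commute i≢f)))
    where
    below = ℕₚ.<-≤-trans (slot<slot-previous (row f) (nb≢ f)) slot≤m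
    commute : i ≢ here-slot f →
              (kernels memo (f ∷ fs) [ m ↦ pinned s ]) i σ x ≡ (kernels memo fs [ m ↦ pinned s ]) i σ x
    commute i≢f with i ℕₚ.≟ m
    ... | yes refl = trans (set-same (kernels memo (f ∷ fs)) m (pinned s) σ x)
                           (sym (set-same (kernels memo fs) m (pinned s) σ x))
    ... | no i≢m = trans (set-other (kernels memo (f ∷ fs)) (pinned s) i≢m σ x)
      (trans (set-other (kernels memo fs) (kernel f) i≢f σ x) (sym (set-other (kernels memo fs) (pinned s) i≢m σ x)))

  set-nonneg : ∀ {K : ℕ → Kernel} {m κ} → (∀ i σ x → 0# ≤ K i σ x) → (∀ σ x → 0# ≤ κ σ x) →
               ∀ i σ x → 0# ≤ (K [ m ↦ κ ]) i σ x
  set-nonneg {K} {m} {κ} 0≤K 0≤κ i σ x with i ≡ᵇ m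
  ... | true  = 0≤κ σ x
  ... | false = 0≤K i σ x

  kernels-nonneg : ∀ memo fs i σ x → 0# ≤ kernels memo fs i σ x
  kernels-nonneg memo []       = resolved-nonneg memo
  kernels-nonneg memo (f ∷ fs) =
    set-nonneg (kernels-nonneg memo fs) (waiting-nonneg (vertex f) (spin f) (nb f) (rest⊆ f))

  target : Vec (Fin q) k → Config → ℝ
  target τ σ = 𝟙 (Vecₚ.≡-dec Finₚ._≟_ (restrict σ Λ) τ)

  module Window (M : ℕ) where

    -- The value of the martingale for the output τ when the chain starts from the Gibbs
    -- distribution and runs the slots below `M`.
    Φ : (ℕ → Kernel) → Vec (Fin q) k → ℝ
    Φ K τ = 𝔼 (evolve K M (target τ))

    Φ-cong : ∀ {K K′} → (∀ i σ x → K i σ x ≡ K′ i σ x) → ∀ τ → Φ K τ ≡ Φ K′ τ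
    Φ-cong K≗K′ τ = 𝔼-cong (evolve-cong M (target τ) (λ _ → K≗K′ _))

    Φ-nonneg : ∀ {K} → (∀ i σ x → 0# ≤ K i σ x) → ∀ τ → 0# ≤ Φ K τ
    Φ-nonneg 0≤K τ = 𝔼-nonneg (evolve-nonneg M 0≤K (λ σ → 𝟙-nonneg (Vecₚ.≡-dec Finₚ._≟_ (restrict σ Λ) τ)))

    Φ-mixture : {I : Set} (is : List I) (p : I → ℝ) (κ : I → Kernel) (K : ℕ → Kernel) → ∀ {m} → m ℕ.< M → ∀ τ →
      Φ (K [ m ↦ (λ σ x → ∑ (map (λ i → p i * κ i σ x) is)) ]) τ ≡ ∑ (map (λ i → p i * Φ (K [ m ↦ κ i ]) τ) is)
    Φ-mixture is p κ K {m} m<M τ = begin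
      𝔼 (evolve (K [ m ↦ (λ σ x → ∑ (map (λ i → p i * κ i σ x) is)) ]) M (target τ))
        ≡⟨ 𝔼-cong (evolve-mixture is p κ K M (target τ) m<M) ⟩
      ∑ (map (λ σ → gibbs σ * ∑ (map (λ i → p i * ev i σ) is)) S)
        ≡⟨ ∑-cong S (λ σ → trans (sym (∑-*ˡ (gibbs σ) _ is)) (∑-cong is (λ i → exchange (gibbs σ) (p i) (ev i σ)))) ⟩
      ∑ (map (λ σ → ∑ (map (λ i → p i * (gibbs σ * ev i σ)) is)) S)
        ≡⟨ ∑-swap _ S is ⟩
      ∑ (map (λ i → ∑ (map (λ σ → p i * (gibbs σ * ev i σ)) S)) is)
        ≡⟨ ∑-cong is (λ i → ∑-*ˡ (p i) _ S) ⟩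
      ∑ (map (λ i → p i * 𝔼 (ev i)) is) ∎
      where
      open ≡-Reasoning
      S = configurations q order
      ev = λ i → evolve (K [ m ↦ κ i ]) M (target τ)
      exchange : ∀ a b c → a * (b * c) ≡ b * (a * c)
      exchange = solve 3 (λ a b c → a :* (b :* c) := b :* (a :* c)) refl

    Φ-mixture₂ : ∀ p (κ₁ κ₀ : Kernel) (K : ℕ → Kernel) → ∀ {m} → m ℕ.< M → ∀ τ →
      Φ (K [ m ↦ (λ σ x → p * κ₁ σ x + (1# - p) * κ₀ σ x) ]) τ ≡
      p * Φ (K [ m ↦ κ₁ ]) τ + (1# - p) * Φ (K [ m ↦ κ₀ ]) τ
    Φ-mixture₂ p κ₁ κ₀ K {m} m<M τ = trans
      (Φ-cong (set-cong K m (λ σ x → cong (p * κ₁ σ x +_) (sym (+-identityʳ _)))) τ)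
      (trans (Φ-mixture (true ∷ false ∷ []) (λ b → if b then p else 1# - p) (λ b → if b then κ₁ else κ₀) K m<M τ)
             (cong (p * Φ (K [ m ↦ κ₁ ]) τ +_) (+-identityʳ _)))

    trial-set-nonneg : ∀ memo fs {m v us} c → (∀ {u} → u ∈ us → u ∈ neighbours v) →
                       ∀ τ → 0# ≤ Φ (kernels memo fs [ m ↦ trial v c us ]) τ
    trial-set-nonneg memo fs {v = v} c us⊆ = Φ-nonneg (set-nonneg (kernels-nonneg memo fs) (trial-nonneg v c us⊆))

  depth : List Frame → ℕ
  depth []       = 0
  depth (f ∷ fs) = 4 ℕ.+ depth fs

  -- The address of the first slot of a sweep. The machine keeps this address instead of the number
  -- of the sweep, because natural registers can only be added and subtracted.
  sweep : ℕ → ℕ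
  sweep a = cell (a ℕ.* order)

  cell-slot : ∀ a v → sweep a ℕ.+ (toℕ v ℕ.+ toℕ v) ≡ cell (slot a v)
  cell-slot a v = cell-+ (a ℕ.* order) (toℕ v)

  -- Zero stands for an unknown spin, so the zeros of the initial heap represent the empty memo.
  encode : Maybe (Fin q) → ℕ
  encode = maybe′ (suc ∘ toℕ) 0

  Stacked : (ℕ → ℕ) → List Frame → Set
  Stacked H []       = ⊤
  Stacked H (f ∷ fs) =
      H (stackCell p) ≡ sweep (row f) × H (stackCell (1 ℕ.+ p)) ≡ toℕ (vertex f)
    × H (stackCell (2 ℕ.+ p)) ≡ toℕ (spin f) × H (stackCell (3 ℕ.+ p)) ≡ pos f
    × Stacked H fs
    where p = depth fs

  stacked-cong : ∀ {H H′} fs → (∀ p → p ℕ.< depth fs → H′ (stackCell p) ≡ H (stackCell p)) →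
                 Stacked H fs → Stacked H′ fs
  stacked-cong []       H′≗H _ = tt
  stacked-cong (f ∷ fs) H′≗H (row≡ , vertex≡ , spin≡ , pos≡ , stacked) =
      trans (H′≗H _ (ℕₚ.m≤n+m _ 3)) row≡
    , trans (H′≗H _ (ℕₚ.m≤n+m _ 2)) vertex≡
    , trans (H′≗H _ (ℕₚ.m≤n+m _ 1)) spin≡
    , trans (H′≗H _ (ℕₚ.m≤n+m _ 0)) pos≡
    , stacked-cong fs (λ p p< → H′≗H p (ℕₚ.≤-trans p< (ℕₚ.m≤n+m _ 4))) stacked

  -- The first k cells are shared: an output spin overwrites the vertex of Λ that it answers, so j
  -- separates outputs from inputs still to be read.
  record Mem (memo : Memo) (j : ℕ) (fs : List Frame) (H : ℕ → ℕ) : Set where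
    field
      cells   : ∀ m → H (cell m) ≡ encode (memo m)
      stacked : Stacked H fs
      output  : ∀ i → toℕ i ℕ.< j → ∃ λ s → memo (toℕ (lookup Λ i)) ≡ just s × H (toℕ i) ≡ toℕ s
      input   : ∀ i → j ℕ.≤ toℕ i → H (toℕ i) ≡ toℕ (lookup Λ i)

  below-k : ∀ (i : Fin k) {b} → k ℕ.≤ b → toℕ i ≢ b
  below-k i k≤b = ℕₚ.<⇒≢ (ℕₚ.<-≤-trans (Finₚ.toℕ<n i) k≤b)

  mem-push : ∀ {memo j fs H} f → Mem memo j fs H →
             Mem memo j (f ∷ fs) (pushed H (depth fs) (sweep (row f)) (toℕ (vertex f)) (toℕ (spin f)) (pos f))
  mem-push {fs = fs} {H} f mem = record
    { cells   = λ m → trans (other (λ r _ → cell≢stackCell m r)) (cells m)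
    ; stacked = pushed₀ {H} {depth fs} , pushed₁ {H} {depth fs} , pushed₂ {H} {depth fs} , pushed₃ {H} {depth fs}
              , stacked-cong fs (λ p p< → other (λ r ≤r eq →
                  ℕₚ.<⇒≢ (ℕₚ.<-≤-trans p< ≤r) (stackCell-injective eq))) stacked
    ; output  = λ i i<j → let s , eq , H≡s = output i i<j in
        s , eq , trans (other (λ r _ → below-k i (k≤stackCell r))) H≡s
    ; input   = λ i j≤i → trans (other (λ r _ → below-k i (k≤stackCell r))) (input i j≤i)
    }
    where
    open Mem mem
    other = pushed-other {H} {depth fs} {sweep (row f)} {toℕ (vertex f)} {toℕ (spin f)} {pos f}

  mem-resolve : ∀ {memo j fs H m s} → memo m ≡ nothing → Mem memo j fs H →
                Mem (memo [ m ↦ just s ]) j fs (H [ cell m ↦ suc (toℕ s) ])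
  mem-resolve {memo} {j} {fs} {H} {m} {s} fresh mem = record
    { cells   = cells′
    ; stacked = stacked-cong fs (λ p _ → [↦]-other H (cell≢stackCell m p ∘ sym)) stacked
    ; output  = λ i i<j → let s , eq , H≡s = output i i<j in
        s , trans ([↦]-other memo (λ { refl → contradiction (trans (sym eq) fresh) λ () })) eq
          , trans ([↦]-other H (below-k i (k≤cell m))) H≡s
    ; input   = λ i j≤i → trans ([↦]-other H (below-k i (k≤cell m))) (input i j≤i)
    }
    where
    open Mem mem
    cells′ : ∀ i → (H [ cell m ↦ suc (toℕ s) ]) (cell i) ≡ encode ((memo [ m ↦ just s ]) i)
    cells′ i with i ℕₚ.≟ m
    ... | yes refl = trans ([↦]-same H {cell m} refl) (sym (cong encode ([↦]-same memo {m} refl)))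
    ... | no i≢m   = trans ([↦]-other H (i≢m ∘ cell-injective)) (trans (cells i) (sym (cong encode ([↦]-other memo i≢m))))

  mem-output : ∀ {memo H s} i → memo (toℕ (lookup Λ i)) ≡ just s → Mem memo (toℕ i) [] H →
               Mem memo (suc (toℕ i)) [] (H [ toℕ i ↦ toℕ s ])
  mem-output {memo} {H} {s} i eq mem = record
    { cells   = λ m → trans ([↦]-other H (below-k i (k≤cell m) ∘ sym)) (cells m)
    ; stacked = tt
    ; output  = output′
    ; input   = λ i′ i<i′ → trans ([↦]-other H (ℕₚ.<⇒≢ i<i′ ∘ sym)) (input i′ (ℕₚ.<⇒≤ i<i′))
    }
    where
    open Mem mem
    output′ : ∀ i′ → toℕ i′ ℕ.< suc (toℕ i) → ∃ λ s′ →
              memo (toℕ (lookup Λ i′)) ≡ just s′ × (H [ toℕ i ↦ toℕ s ]) (toℕ i′) ≡ toℕ s′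
    output′ i′ i′<1+i with toℕ i′ ℕₚ.≟ toℕ i
    ... | yes i′≡i = s , trans (cong (memo ∘ toℕ ∘ lookup Λ) (Finₚ.toℕ-injective i′≡i)) eq , [↦]-same H i′≡i
    ... | no i′≢i  = let s′ , eq′ , H≡s′ = output i′ (ℕₚ.≤∧≢⇒< (ℕ.s≤s⁻¹ i′<1+i) i′≢i) in
                     s′ , eq′ , trans ([↦]-other H i′≢i) H≡s′

  Regs : ℕ → List Frame → (ℕ → ℕ) → (ℕ → ℝ) → Set
  Regs j fs N X =
      N 3 ≡ k × N 4 ≡ 0 × N 5 ≡ order ℕ.+ order × N 6 ≡ stackCell (depth fs)
    × N 7 ≡ 2 × N 8 ≡ 1 × N 9 ≡ j × X 0 ≡ θ × X 3 ≡ 1#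

  -- Bounds on the expected time spent on one slot; R bounds a trial with all its
  -- repetitions, and neighbourBudget pays for one neighbour, including with
  -- probability θ a query and a repetition.
  neighbourBudget queryBudget : ℝ
  neighbourBudget = fromℕ 6 + θ * (fromℕ 41 + fromℕ 2 * R)
  queryBudget     = fromℕ 5 + R

  trialBudget : List V → ℝ
  trialBudget []       = fromℕ 6
  trialBudget (_ ∷ us) = neighbourBudget + trialBudget us

  mainBudget : ℕ → ℝ
  mainBudget zero    = fromℕ 2
  mainBudget (suc m) = fromℕ 11 + (queryBudget + mainBudget m)

  stackBudget : ℕ → List Frame → ℝ
  stackBudget j []       = fromℕ 7 + mainBudget (k ℕ.∸ suc j)
  stackBudget j (f ∷ fs) = fromℕ 21 + (R + trialBudget (rest f)) + stackBudget j fs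

  neighbourBudget-nonneg : 0# ≤ neighbourBudget
  neighbourBudget-nonneg = +-nonneg (fromℕ-nonneg 6)
    (*-nonneg 0≤θ (+-nonneg (fromℕ-nonneg 41) (*-nonneg (fromℕ-nonneg 2) 0≤R)))

  queryBudget-nonneg : 0# ≤ queryBudget
  queryBudget-nonneg = +-nonneg (fromℕ-nonneg 5) 0≤R

  trialBudget-nonneg : ∀ us → 0# ≤ trialBudget us
  trialBudget-nonneg []       = fromℕ-nonneg 6
  trialBudget-nonneg (u ∷ us) = +-nonneg neighbourBudget-nonneg (trialBudget-nonneg us)

  mainBudget-nonneg : ∀ m → 0# ≤ mainBudget m
  mainBudget-nonneg zero    = fromℕ-nonneg 2
  mainBudget-nonneg (suc m) = +-nonneg (fromℕ-nonneg 11) (+-nonneg queryBudget-nonneg (mainBudget-nonneg m))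

  stackBudget-nonneg : ∀ j fs → 0# ≤ stackBudget j fs
  stackBudget-nonneg j []       = +-nonneg (fromℕ-nonneg 7) (mainBudget-nonneg (k ℕ.∸ suc j))
  stackBudget-nonneg j (f ∷ fs) =
    +-nonneg (+-nonneg (fromℕ-nonneg 21) (+-nonneg 0≤R (trialBudget-nonneg (rest f)))) (stackBudget-nonneg j fs)

  -- The invariant at the cut points and its preservation.

  module Cuts (M : ℕ) where
    open Window M

    -- `inside` leaves room for t further nested calls, each going back by less than one sweep.
    -- `sweeps` lets the main loop start again from the most recent sweep, and keeps the last update
    -- of every vertex within the window.
    record Inv (t : ℕ) (memo : Memo) (j : ℕ) (fs : List Frame) (a : ℕ) (v : V) (H : ℕ → ℕ) : Set where
      field
        mem    : Mem memo j fs H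
        called : Called memo j fs a v
        sweeps : suc t ℕ.* order ℕ.≤ M
        inside : slot a v ℕ.+ t ℕ.* order ℕ.< M

      slot<M : slot a v ℕ.< M
      slot<M = ℕₚ.≤-<-trans (ℕₚ.m≤m+n _ _) inside

    inv-earlier : ∀ {t t′ memo j fs a v H} → t′ ℕ.≤ t → Inv t memo j fs a v H → Inv t′ memo j fs a v H
    inv-earlier {a = a} {v} t′≤t inv = record
      { mem    = mem
      ; called = called
      ; sweeps = ℕₚ.≤-trans (ℕₚ.*-monoˡ-≤ order (ℕ.s≤s t′≤t)) sweeps
      ; inside = ℕₚ.≤-<-trans (ℕₚ.+-monoʳ-≤ (slot a v) (ℕₚ.*-monoˡ-≤ order t′≤t)) inside
      }
      where open Inv inv

    -- Every loop and every recursive call passes one of these points. The last two indices are the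
    -- bounds claimed there: the martingale for the output probabilities, and the budget for the
    -- remaining expected time.
    data Cut (t : ℕ) : State → (Vec (Fin q) k → ℝ) → ℝ → Set where
      query-cut : ∀ {memo j fs a v N X H} →
        Inv t memo j fs a v H → Regs j fs N X → N 10 ≡ sweep a → N 11 ≡ toℕ v →
        Cut t (mkState 12 N X H) (Φ (kernels memo fs)) (queryBudget + stackBudget j fs)
      round-cut : ∀ {memo j fs a v N X H} →
        Inv t memo j fs a v H → Regs j fs N X → N 10 ≡ sweep a → N 11 ≡ toℕ v →
        memo (slot a v) ≡ nothing →
        Cut t (mkState 17 N X H) (Φ (kernels memo fs)) (R + stackBudget j fs)
      trial-cut : ∀ {memo j fs a v N X H c i us} →
        Inv t memo j fs a v H → Regs j fs N X → N 10 ≡ sweep a → N 11 ≡ toℕ v →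
        memo (slot a v) ≡ nothing →
        N 12 ≡ toℕ c → N 13 ≡ i → N 14 ≡ degree v → drop i (neighbours v) ≡ us →
        Cut t (mkState 20 N X H) (Φ (kernels memo fs [ slot a v ↦ trial v c us ]))
              (trialBudget us + stackBudget j fs)
      return-cut : ∀ {memo j fs a v N X H s} →
        Inv t memo j fs a v H → Regs j fs N X → N 17 ≡ suc (toℕ s) → memo (slot a v) ≡ just s →
        Cut t (mkState 43 N X H) (Φ (kernels memo fs)) (stackBudget j fs)
      main-cut : ∀ {memo j N X H} →
        Mem memo j [] H → suc t ℕ.* order ℕ.≤ M → Regs j [] N X → j ℕ.≤ k →
        Cut t (mkState 8 N X H) (Φ (kernels memo [])) (mainBudget (k ℕ.∸ j))

    module Step (budget : ∀ v → fromℕ (2 ℕ.+ ⌈log₂ q ⌉) + trialBudget (neighbours v) ≤ R)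
      (t : ℕ) (IH : ∀ {t′} → t′ ℕ.< t → ∀ {s r e} → Cut t′ s r e → Good t′ s r e) where

      query-good : ∀ {memo j fs a v N X H} →
        Inv t memo j fs a v H → Regs j fs N X → N 10 ≡ sweep a → N 11 ≡ toℕ v →
        Good t (mkState 12 N X H) (Φ (kernels memo fs)) (queryBudget + stackBudget j fs)
      query-good {memo} {j} {fs} {a} {v} {N} {X} {H} inv regs row≡ vertex≡ with memo (slot a v) in eq
      ... | nothing = good-weaken (λ _ → ≤-refl)
        -- A miss takes 4 steps; the budget allows the 5 steps of a hit.
        (≤-trans (+-monoˡ-≤ (R + stackBudget j fs) (fromℕ-mono (ℕₚ.n≤1+n 4))) (≤-reflexive (sym (+-assoc _ _ _))))
        (good-run (steps 3 refl then jumpZero-0 refl (trans lookup≡ (cong encode eq)))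
          (Φ-nonneg (kernels-nonneg memo fs)) (+-nonneg 0≤R (stackBudget-nonneg j fs))
          (λ t′<t → IH t′<t (round-cut (inv-earlier (ℕₚ.<⇒≤ t′<t) inv) regs row≡ vertex≡ eq)))
        where
        lookup≡ : H (N 10 ℕ.+ (N 11 ℕ.+ N 11)) ≡ encode (memo (slot a v))
        lookup≡ = trans (cong H (trans (cong₂ (λ x y → x ℕ.+ (y ℕ.+ y)) row≡ vertex≡) (cell-slot a v)))
                        (Mem.cells (Inv.mem inv) (slot a v))
      ... | just s = good-weaken (λ _ → ≤-refl)
        (+-monoˡ-≤ (stackBudget j fs) (x≤x+y 0≤R))
        (good-run (steps 3 refl then jumpZero-suc refl lookup≡s then steps 1 refl)
          (Φ-nonneg (kernels-nonneg memo fs)) (stackBudget-nonneg j fs)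
          (λ t′<t → IH t′<t (return-cut (inv-earlier (ℕₚ.<⇒≤ t′<t) inv) regs lookup≡s eq)))
        where
        lookup≡s : H (N 10 ℕ.+ (N 11 ℕ.+ N 11)) ≡ suc (toℕ s)
        lookup≡s = trans (cong H (trans (cong₂ (λ x y → x ℕ.+ (y ℕ.+ y)) row≡ vertex≡) (cell-slot a v)))
                        (trans (Mem.cells (Inv.mem inv) (slot a v)) (cong encode eq))

      -- An unresolved slot carries the Glauber kernel, which by `glauber-trial` is the mixture of
      -- trials over the spin proposed by `draw`. The terms 2 + log q of the budget pay for reading
      -- the degree, drawing, and resetting the position.
      round-good : ∀ {memo j fs a v N X H} →
        Inv t memo j fs a v H → Regs j fs N X → N 10 ≡ sweep a → N 11 ≡ toℕ v →
        memo (slot a v) ≡ nothing →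
        Good t (mkState 17 N X H) (Φ (kernels memo fs)) (R + stackBudget j fs)
      round-good {memo} {j} {fs} {a} {v} {N} {X} {H} inv regs row≡ vertex≡ eq = good-weaken
        (λ τ → ≤-reflexive (trans
          (sym (Φ-mixture (allFin q) (field-λ v) (λ c → trial v c (neighbours v)) (kernels memo fs) slot<M τ))
          (Φ-cong (set-id (kernels memo fs) (λ σ x →
            trans (sym (glauber-trial v σ x)) (sym (kernels-fresh called eq σ x)))) τ)))
        time
        (good-run (steps 1 refl)
          (λ τ → ∑-nonneg (allFin q) (λ c → *-nonneg (λ-nonneg v c) (r-nonneg c τ)))
          (+-nonneg (fromℕ-nonneg (⌈log₂ q ⌉)) (∑-nonneg (allFin q) (λ c → *-nonneg (λ-nonneg v c) e-nonneg)))
          (λ t′<t → good-branch (allFin q) (field-λ v)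
            (λ c → mkState 19 (N [ 14 ↦ at 0 degree (N 11) ] [ 12 ↦ toℕ c ]) X H)
            {λ c → Φ (kernels memo fs [ slot a v ↦ trial v c (neighbours v) ])}
            {λ _ → fromℕ 1 + (trialBudget (neighbours v) + stackBudget j fs)}
            -- The draw must cost at least one unit of time for `markov`; q ≥ 2 ensures it.
            refl (at-≡ vertex≡) (⌈log₂⌉-mono-≤ 2≤q) (λ-nonneg v) (∑λ≡1 v) r-nonneg (λ _ → e-nonneg)
            (λ t″<t′ c → good-run (steps 1 refl) (r-nonneg c)
              (+-nonneg (trialBudget-nonneg (neighbours v)) (stackBudget-nonneg j fs))
              (λ t‴<t″ → let t‴<t = ℕₚ.<-trans t‴<t″ (ℕₚ.<-trans t″<t′ t′<t) in
                IH t‴<t (trial-cut (inv-earlier (ℕₚ.<⇒≤ t‴<t) inv) regs row≡ vertex≡ eq refl refl (at-≡ vertex≡) refl)))))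
        where
        open Inv inv
        r-nonneg : ∀ c τ → 0# ≤ Φ (kernels memo fs [ slot a v ↦ trial v c (neighbours v) ]) τ
        r-nonneg c = Φ-nonneg (set-nonneg (kernels-nonneg memo fs) (trial-nonneg v c id))
        e-nonneg : 0# ≤ fromℕ 1 + (trialBudget (neighbours v) + stackBudget j fs)
        e-nonneg = +-nonneg (fromℕ-nonneg 1) (+-nonneg (trialBudget-nonneg (neighbours v)) (stackBudget-nonneg j fs))
        e : ℝ
        e = fromℕ 1 + (trialBudget (neighbours v) + stackBudget j fs)
        time : fromℕ 1 + (fromℕ ⌈log₂ q ⌉ + ∑ (map (λ c → field-λ v c * e) (allFin q))) ≤ R + stackBudget j fs
        time = ≤-trans (≤-reflexive (trans
          (cong (λ y → fromℕ 1 + (fromℕ ⌈log₂ q ⌉ + y)) (trans (∑-*ʳ e (field-λ v) (allFin q)) (cong (_* e) (∑λ≡1 v))))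
          (solve 3 (λ l t s → lit 1 :+ lit 0 :+ (l :+ lit 1 :* (lit 1 :+ lit 0 :+ (t :+ s))) :=
                              (lit 1 :+ (lit 1 :+ l)) :+ t :+ s) refl
            (fromℕ ⌈log₂ q ⌉) (trialBudget (neighbours v)) (stackBudget j fs))))
          (+-monoˡ-≤ (stackBudget j fs) (budget v))

      -- A trial with no neighbour left has the law pinned at its proposal, so recording the spin in
      -- the memo does not change the martingale.
      accept-good : ∀ {memo j fs a v N X H c i} →
        Inv t memo j fs a v H → Regs j fs N X → N 10 ≡ sweep a → N 11 ≡ toℕ v →
        memo (slot a v) ≡ nothing →
        N 12 ≡ toℕ c → N 13 ≡ i → N 14 ≡ degree v → drop i (neighbours v) ≡ [] →
        Good t (mkState 20 N X H) (Φ (kernels memo fs [ slot a v ↦ trial v c [] ]))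
               (trialBudget [] + stackBudget j fs)
      accept-good {memo} {j} {fs} {a} {v} {N} {X} {H} {c} inv regs row≡ vertex≡ eq spin≡ pos≡ degree≡ drop≡ =
        good-weaken (λ τ → ≤-reflexive (Φ-cong (kernels-resolve called ℕₚ.≤-refl) τ)) ≤-refl
          (good-run (steps 1 refl then jumpZero-0 refl (remaining {v} {N} pos≡ degree≡ drop≡) then steps 4 refl)
            (Φ-nonneg (kernels-nonneg memo′ fs)) (stackBudget-nonneg j fs)
            (λ t′<t → IH t′<t (return-cut (inv-earlier (ℕₚ.<⇒≤ t′<t) inv′) regs spin+1≡ ([↦]-same memo {slot a v} refl))))
        where
        open Inv inv
        memo′ : Memo
        memo′ = memo [ slot a v ↦ just c ]
        spin+1≡ : N 8 ℕ.+ N 12 ≡ suc (toℕ c)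
        spin+1≡ = let (_ , _ , _ , _ , _ , one≡ , _) = regs in cong₂ ℕ._+_ one≡ spin≡
        heap≡ : H [ cell (slot a v) ↦ suc (toℕ c) ] ≡ H [ N 10 ℕ.+ (N 11 ℕ.+ N 11) ↦ N 8 ℕ.+ N 12 ]
        heap≡ = sym (cong₂ (λ b y → H [ b ↦ y ])
          (trans (cong₂ (λ x y → x ℕ.+ (y ℕ.+ y)) row≡ vertex≡) (cell-slot a v)) spin+1≡)
        inv′ : Inv t memo′ j fs a v (H [ N 10 ℕ.+ (N 11 ℕ.+ N 11) ↦ N 8 ℕ.+ N 12 ])
        inv′ = record
          { mem    = subst (Mem memo′ j fs) heap≡ (mem-resolve eq mem)
          ; called = called-resolve called ℕₚ.≤-refl
          ; sweeps = sweeps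
          ; inside = inside
          }

      -- `trial-waiting` splits the law of the slot along the coin of bias θ: heads suspends the
      -- trial as a new frame, tails settles the test at u without its spin.
      ask-good : ∀ {memo j fs a v N X H c i u us} →
        Inv t memo j fs a v H → Regs j fs N X → N 10 ≡ sweep a → N 11 ≡ toℕ v →
        memo (slot a v) ≡ nothing →
        N 12 ≡ toℕ c → N 13 ≡ i → N 14 ≡ degree v → drop i (neighbours v) ≡ u ∷ us →
        Good t (mkState 20 N X H) (Φ (kernels memo fs [ slot a v ↦ trial v c (u ∷ us) ]))
               (trialBudget (u ∷ us) + stackBudget j fs)
      ask-good {memo} {j} {fs} {a} {v} {N} {X} {H} {c} {i} {u} {us}
        inv regs@(k≡ , zero≡ , 2n≡ , top≡ , two≡ , one≡ , j≡ , θ≡ , one≡ʳ) row≡ vertex≡ eq spin≡ pos≡ degree≡ drop≡ =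
        good-weaken (λ τ → ≤-reflexive (outcome τ)) time
          (good-run (steps 1 refl then jumpZero-suc refl (remaining {v} {N} pos≡ degree≡ drop≡))
            (λ τ → clamp-mixture-nonneg _ (heads-nonneg τ) (tails-nonneg τ))
            (+-nonneg (fromℕ-nonneg 1) (clamp-mixture-nonneg _ heads-budget tails-budget))
            (λ t′<t → good-coin refl heads-nonneg heads-budget tails-nonneg tails-budget
              (λ t″<t′ → heads (ℕₚ.<-trans t″<t′ t′<t))
              (λ t″<t′ → good-run (jumpZero-0 refl refl then steps 2 refl) tails-nonneg
                (+-nonneg (trialBudget-nonneg us) (stackBudget-nonneg j fs))
                (λ t‴<t″ → let t‴<t = ℕₚ.<-trans t‴<t″ (ℕₚ.<-trans t″<t′ t′<t) in
                  IH t‴<t (trial-cut (inv-earlier (ℕₚ.<⇒≤ t‴<t) inv) regs row≡ vertex≡ eq spin≡ (cong₂ ℕ._+_ one≡ pos≡) degree≡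
                    (drop-suc i (neighbours v) drop≡))))))
        where
        open Inv inv
        f : Frame
        f = record { row = a ; vertex = v ; spin = c ; pos = i ; drop≡ = drop≡ }

        heads-nonneg : ∀ τ → 0# ≤ Φ (kernels memo (f ∷ fs)) τ
        heads-nonneg = Φ-nonneg (kernels-nonneg memo (f ∷ fs))
        tails-nonneg : ∀ τ → 0# ≤ Φ (kernels memo fs [ slot a v ↦ trial v c us ]) τ
        tails-nonneg = trial-set-nonneg memo fs c (rest⊆ f)
        heads-budget : 0# ≤ fromℕ 15 + (queryBudget + stackBudget j (f ∷ fs))
        heads-budget = +-nonneg (fromℕ-nonneg 15) (+-nonneg queryBudget-nonneg (stackBudget-nonneg j (f ∷ fs)))
        tails-budget : 0# ≤ fromℕ 3 + (trialBudget us + stackBudget j fs)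
        tails-budget = +-nonneg (fromℕ-nonneg 3) (+-nonneg (trialBudget-nonneg us) (stackBudget-nonneg j fs))

        p≡θ : clamp (X 0) ≡ θ
        p≡θ = trans (cong clamp θ≡) (clamp-id 0≤θ θ≤1)

        r₁ r₀ : Vec (Fin q) k → ℝ
        r₁ = Φ (kernels memo (f ∷ fs))
        r₀ = Φ (kernels memo fs [ slot a v ↦ trial v c us ])

        outcome : ∀ τ → clamp (X 0) * r₁ τ + (1# - clamp (X 0)) * r₀ τ ≡
                        Φ (kernels memo fs [ slot a v ↦ trial v c (u ∷ us) ]) τ
        outcome τ = begin
          clamp (X 0) * r₁ τ + (1# - clamp (X 0)) * r₀ τ
            ≡⟨ cong (λ p → p * r₁ τ + (1# - p) * r₀ τ) p≡θ ⟩
          θ * r₁ τ + (1# - θ) * r₀ τ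
            ≡⟨ Φ-mixture₂ θ (waiting v c u us) (trial v c us) (kernels memo fs) slot<M τ ⟨
          Φ (kernels memo fs [ slot a v ↦ (λ σ x → θ * waiting v c u us σ x + (1# - θ) * trial v c us σ x) ]) τ
            ≡⟨ Φ-cong (set-cong (kernels memo fs) (slot a v) (trial-waiting (nb∈ f) c us)) τ ⟨
          Φ (kernels memo fs [ slot a v ↦ trial v c (u ∷ us) ]) τ ∎
          where open ≡-Reasoning

        e₁ e₀ : ℝ
        e₁ = fromℕ 15 + (queryBudget + stackBudget j (f ∷ fs))
        e₀ = fromℕ 3 + (trialBudget us + stackBudget j fs)

        time : fromℕ 2 + (fromℕ 1 + (clamp (X 0) * e₁ + (1# - clamp (X 0)) * e₀)) ≤
               trialBudget (u ∷ us) + stackBudget j fs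
        time = ≤-trans (≤-reflexive (cong (λ p → fromℕ 2 + (fromℕ 1 + (p * e₁ + (1# - p) * e₀))) p≡θ))
          -- In `neighbourBudget`, 6 = 2 + 1 + 3 covers the test, the coin and tails; 41 = 15 + 5 +
          -- 21 covers saving the frame, the query and resuming, and 2 R the trials of the neighbour
          -- and a repetition of this one. The slack 3 θ arises as the 3 steps of tails are also
          -- charged on heads.
          (0≤y-x⇒x≤y (≤-trans (*-nonneg (fromℕ-nonneg 3) 0≤θ) (≤-reflexive
            (solve 4 (λ o r b s → lit 3 :* o := (lit 6 :+ o :* (lit 41 :+ lit 2 :* r) :+ b :+ s) :-
              (lit 2 :+ (lit 1 :+ lit 0 :+ (o :* (lit 15 :+ (lit 5 :+ r :+ (lit 21 :+ (r :+ b) :+ s))) :+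
                                            (lit 1 :- o) :* (lit 3 :+ (b :+ s))))))
              refl θ R (trialBudget us) (stackBudget j fs)))))

        nb≡ : at 0 (λ x → maybe′ toℕ 0 (nth (neighbours x) (N 13))) (N 11) ≡ toℕ u
        nb≡ = neighbour≡ {N = N} vertex≡ pos≡ drop≡

        top₁ = push-step (depth fs) top≡ two≡
        top₂ = push-step (1 ℕ.+ depth fs) top₁ two≡
        top₃ = push-step (2 ℕ.+ depth fs) top₂ two≡
        top₄ = push-step (3 ℕ.+ depth fs) top₃ two≡

        H′ : ℕ → ℕ
        H′ = H [ N 6 ↦ N 10 ] [ N 7 ℕ.+ N 6 ↦ N 11 ] [ N 7 ℕ.+ (N 7 ℕ.+ N 6) ↦ N 12 ]
               [ N 7 ℕ.+ (N 7 ℕ.+ (N 7 ℕ.+ N 6)) ↦ N 13 ]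

        inv′ : ∀ {t′} → t′ ℕ.< t → Inv t′ memo j (f ∷ fs) (previous a v u) u H′
        inv′ {t′} t′<t = record
          { mem    = subst (Mem memo j (f ∷ fs)) (sym (store⁴-cong top≡ top₁ top₂ top₃ row≡ vertex≡ spin≡ pos≡)) (mem-push f mem)
          ; called = by-frame called eq
          ; sweeps = ℕₚ.≤-trans (ℕₚ.*-monoˡ-≤ order (ℕ.s≤s (ℕₚ.<⇒≤ t′<t))) sweeps
          -- The call uses up less than one sweep of the reserve, while t′ < t frees a whole one.
          ; inside = begin-strict
              slot (previous a v u) u ℕ.+ t′ ℕ.* order   <⟨ ℕₚ.+-monoˡ-< _ (slot-previous<slot+n a (nb≢ f)) ⟩
              slot a v ℕ.+ order ℕ.+ t′ ℕ.* order        ≡⟨ ℕₚ.+-assoc (slot a v) order _ ⟩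
              slot a v ℕ.+ suc t′ ℕ.* order              ≤⟨ ℕₚ.+-monoʳ-≤ (slot a v) (ℕₚ.*-monoˡ-≤ order t′<t) ⟩
              slot a v ℕ.+ t ℕ.* order                   <⟨ inside ⟩
              M                                          ∎
          }
          where open ℕₚ.≤-Reasoning

        N₁ N₂ N₃ N₄ N₅ N₆ : ℕ → ℕ
        N₁ = N  [ 18 ↦ N 14 ℕ.∸ N 13 ] [ 18 ↦ 1 ]
                [ 15 ↦ at 0 (λ x → maybe′ toℕ 0 (nth (neighbours x) (N 13))) (N 11) ]
        N₂ = N₁ [ 6 ↦ N 7 ℕ.+ N 6 ]
        N₃ = N₂ [ 6 ↦ N 7 ℕ.+ (N 7 ℕ.+ N 6) ]
        N₄ = N₃ [ 6 ↦ N 7 ℕ.+ (N 7 ℕ.+ (N 7 ℕ.+ N 6)) ]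
        N₅ = N₄ [ 6 ↦ N 7 ℕ.+ (N 7 ℕ.+ (N 7 ℕ.+ (N 7 ℕ.+ N 6))) ]
        N₆ = N₅ [ 18 ↦ N₁ 15 ℕ.∸ N 11 ]

        H₁ H₂ H₃ : ℕ → ℕ
        H₁ = H  [ N 6 ↦ N 10 ]
        H₂ = H₁ [ N 7 ℕ.+ N 6 ↦ N 11 ]
        H₃ = H₂ [ N 7 ℕ.+ (N 7 ℕ.+ N 6) ↦ N 12 ]

        push : mkState 23 (N [ 18 ↦ N 14 ℕ.∸ N 13 ] [ 18 ↦ 1 ]) X H ⟶⟨ 11 ⟩ mkState 34 N₆ X H′
        push =
          jumpZero-suc refl refl then
          steps 1 {s′ = mkState 25 N₁ X H} refl then
          steps 2 {s′ = mkState 27 N₂ X H₁} refl then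
          steps 2 {s′ = mkState 29 N₃ X H₂} refl then
          steps 2 {s′ = mkState 31 N₄ X H₃} refl then
          steps 3 {s′ = mkState 34 N₆ X H′} refl

        heads : ∀ {t′} → t′ ℕ.< t → Good t′ (mkState 23 (N [ 18 ↦ N 14 ℕ.∸ N 13 ] [ 18 ↦ 1 ]) X H)
                  (Φ (kernels memo (f ∷ fs))) (fromℕ 15 + (queryBudget + stackBudget j (f ∷ fs)))
        heads t′<t with v Finₚ.<? u
        ... | yes v<u = good-run
          (push then
           jumpZero-suc refl (trans (cong₂ ℕ._∸_ nb≡ vertex≡) (proj₂ (pos⇒suc (ℕₚ.m<n⇒0<n∸m v<u)))) then steps 3 refl)
          heads-nonneg (+-nonneg queryBudget-nonneg (stackBudget-nonneg j (f ∷ fs)))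
          (λ t″<t′ → IH (ℕₚ.<-trans t″<t′ t′<t) (query-cut (inv′ (ℕₚ.<-trans t″<t′ t′<t))
            (k≡ , zero≡ , 2n≡ , top₄ , two≡ , one≡ , j≡ , θ≡ , one≡ʳ)
            (trans row≡ (cong sweep (sym (previous-> a v<u))))
            (trans (cong₂ ℕ._+_ nb≡ zero≡) (ℕₚ.+-identityʳ _))))
        ... | no v≮u = good-run
          (push then
           jumpZero-0 refl (trans (cong₂ ℕ._∸_ nb≡ vertex≡) (ℕₚ.m≤n⇒m∸n≡0 (ℕₚ.≮⇒≥ v≮u))) then steps 3 refl)
          heads-nonneg (+-nonneg queryBudget-nonneg (stackBudget-nonneg j (f ∷ fs)))
          (λ t″<t′ → IH (ℕₚ.<-trans t″<t′ t′<t) (query-cut (inv′ (ℕₚ.<-trans t″<t′ t′<t))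
            (k≡ , zero≡ , 2n≡ , top₄ , two≡ , one≡ , j≡ , θ≡ , one≡ʳ)
            (trans (cong₂ ℕ._+_ row≡ 2n≡) (trans (cell-+ (a ℕ.* order) order) (cong sweep (sym (previous-≤ a v≮u)))))
            (trans (cong₂ ℕ._+_ nb≡ zero≡) (ℕₚ.+-identityʳ _))))

      return-to-main : ∀ {memo j a v N X H s} →
        Inv t memo j [] a v H → Regs j [] N X → N 17 ≡ suc (toℕ s) → memo (slot a v) ≡ just s →
        Good t (mkState 43 N X H) (Φ (kernels memo [])) (stackBudget j [])
      return-to-main {memo} {N = N} {X} {H} {s} inv@record { called = by-main i refl }
        (k≡ , zero≡ , 2n≡ , top≡ , two≡ , one≡ , j≡ , θ≡ , one≡ʳ) spin≡ eq =
        good-run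
          (steps 2 refl then
           jumpZero-0 refl (trans (cong₂ ℕ._∸_ (cong₂ ℕ._∸_ top≡ k≡) one≡) (stackCell∸k∸1 0)) then
           steps 4 refl)
          (Φ-nonneg (kernels-nonneg memo [])) (mainBudget-nonneg (k ℕ.∸ suc (toℕ i)))
          (λ {t′} t′<t → IH t′<t (main-cut
            (subst (Mem memo (suc (toℕ i)) []) (sym (cong₂ (λ b y → H [ b ↦ y ]) j≡ (cong₂ ℕ._∸_ spin≡ one≡)))
              (mem-output i (trans (cong memo (sym (ℕₚ.+-identityʳ _))) eq) (Inv.mem inv)))
            (ℕₚ.≤-trans (ℕₚ.*-monoˡ-≤ order (ℕ.s≤s (ℕₚ.<⇒≤ t′<t))) (Inv.sweeps inv))
            (k≡ , zero≡ , 2n≡ , top≡ , two≡ , one≡ , cong₂ ℕ._+_ one≡ j≡ , θ≡ , one≡ʳ)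
            (Finₚ.toℕ<n i)))

      -- The waiting law of the frame reads only the spin of its neighbour. That spin is now pinned
      -- at an earlier slot and not updated in between, so `evolve-look-up` allows the constant bias
      -- p of the coin in its place; `Φ-mixture₂` then splits the two outcomes.
      return-to-frame : ∀ {memo j f fs a v N X H s} →
        Inv t memo j (f ∷ fs) a v H → Regs j (f ∷ fs) N X → N 17 ≡ suc (toℕ s) → memo (slot a v) ≡ just s →
        Good t (mkState 43 N X H) (Φ (kernels memo (f ∷ fs))) (stackBudget j (f ∷ fs))
      return-to-frame {memo} {j} {f} {fs} {a} {v} {N} {X} {H} {s} inv@record { called = by-frame called fresh }
        (k≡ , zero≡ , 2n≡ , top≡ , two≡ , one≡ , j≡ , θ≡ , one≡ʳ) spin+1≡ eq =
        good-weaken (λ τ → ≤-reflexive (outcome τ)) time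
          (good-run
            (steps 2 {s′ = mkState 45 N₁ X H} refl then
             jumpZero-suc refl (trans (cong₂ ℕ._∸_ (cong₂ ℕ._∸_ top≡ k≡) one≡) (stackCell∸k∸1 (depth (f ∷ fs)))) then
             steps 2 {s′ = mkState 48 N₂ X H} refl then
             steps 2 {s′ = mkState 50 N₃ X H} refl then
             steps 2 {s′ = mkState 52 N₄ X H} refl then
             steps 2 {s′ = mkState 54 N₅ X H} refl then
             steps 3 {s′ = mkState 57 N₆ X H} refl then
             steps 3 {s′ = mkState 60 N₆ X′ H} refl)
            (λ τ → clamp-mixture-nonneg _ (heads-nonneg τ) (tails-nonneg τ))
            (+-nonneg (fromℕ-nonneg 1) (clamp-mixture-nonneg _ heads-budget tails-budget))
            (λ t′<t → good-coin refl heads-nonneg heads-budget tails-nonneg tails-budget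
              (λ t″<t′ → good-run (jumpZero-suc refl refl then steps 1 refl) heads-nonneg
                (+-nonneg 0≤R (stackBudget-nonneg j fs))
                (λ t‴<t″ → let t‴<t = ℕₚ.<-trans t‴<t″ (ℕₚ.<-trans t″<t′ t′<t) in
                  IH t‴<t (round-cut (inv-earlier (ℕₚ.<⇒≤ t‴<t) inv′) regs′ row≡ vertex≡ fresh)))
              (λ t″<t′ → good-run (jumpZero-0 refl refl then steps 2 refl) tails-nonneg
                (+-nonneg (trialBudget-nonneg (rest f)) (stackBudget-nonneg j fs))
                (λ t‴<t″ → let t‴<t = ℕₚ.<-trans t‴<t″ (ℕₚ.<-trans t″<t′ t′<t) in
                  IH t‴<t (trial-cut (inv-earlier (ℕₚ.<⇒≤ t‴<t) inv′) regs′ row≡ vertex≡ fresh spin≡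
                    (cong₂ ℕ._+_ one≡ pos≡) (at-≡ vertex≡)
                    (drop-suc (pos f) (neighbours (vertex f)) (drop≡ f)))))))
        where
        open Inv inv using (mem; sweeps; inside; slot<M)
        K = kernels memo fs
        m = here-slot f

        N₁ N₂ N₃ N₄ N₅ N₆ : ℕ → ℕ
        N₁ = N  [ 18 ↦ N 6 ℕ.∸ N 3 ] [ 18 ↦ N 6 ℕ.∸ N 3 ℕ.∸ N 8 ]
        N₂ = N₁ [ 6 ↦ N 6 ℕ.∸ N 7 ] [ 13 ↦ H (N 6 ℕ.∸ N 7) ]
        N₃ = N₂ [ 6 ↦ N 6 ℕ.∸ N 7 ℕ.∸ N 7 ] [ 12 ↦ H (N 6 ℕ.∸ N 7 ℕ.∸ N 7) ]
        N₄ = N₃ [ 6 ↦ N 6 ℕ.∸ N 7 ℕ.∸ N 7 ℕ.∸ N 7 ] [ 11 ↦ H (N 6 ℕ.∸ N 7 ℕ.∸ N 7 ℕ.∸ N 7) ]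
        N₅ = N₄ [ 6 ↦ N 6 ℕ.∸ N 7 ℕ.∸ N 7 ℕ.∸ N 7 ℕ.∸ N 7 ] [ 10 ↦ H (N 6 ℕ.∸ N 7 ℕ.∸ N 7 ℕ.∸ N 7 ℕ.∸ N 7) ]
        N₆ = N₅ [ 14 ↦ at 0 degree (N₅ 11) ]
                [ 15 ↦ at 0 (λ x → maybe′ toℕ 0 (nth (neighbours x) (N₅ 13))) (N₅ 11) ]
                [ 17 ↦ N 17 ℕ.∸ N 8 ]

        entry : ℝ
        entry = at 0# (λ x → at 0# (λ y → at 0# (λ b → at 0# (A x y b) (N₆ 17)) (N₆ 12)) (N₆ 15)) (N₆ 11)

        X′ : ℕ → ℝ
        X′ = X [ 4 ↦ entry ] [ 4 ↦ X 3 - entry ] [ 4 ↦ (X 3 - entry) / X 0 ]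

        m<slot : m ℕ.< slot a v
        m<slot = slot<slot-previous (row f) (nb≢ f)

        heads-nonneg : ∀ τ → 0# ≤ Φ K τ
        heads-nonneg = Φ-nonneg (kernels-nonneg memo fs)
        tails-nonneg : ∀ τ → 0# ≤ Φ (K [ m ↦ trial (vertex f) (spin f) (rest f) ]) τ
        tails-nonneg = trial-set-nonneg memo fs (spin f) (rest⊆ f)
        heads-budget : 0# ≤ fromℕ 2 + (R + stackBudget j fs)
        heads-budget = +-nonneg (fromℕ-nonneg 2) (+-nonneg 0≤R (stackBudget-nonneg j fs))
        tails-budget : 0# ≤ fromℕ 3 + (trialBudget (rest f) + stackBudget j fs)
        tails-budget = +-nonneg (fromℕ-nonneg 3) (+-nonneg (trialBudget-nonneg (rest f)) (stackBudget-nonneg j fs))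

        top₃ = pop-step (3 ℕ.+ depth fs) top≡ two≡
        top₂ = pop-step (2 ℕ.+ depth fs) top₃ two≡
        top₁ = pop-step (1 ℕ.+ depth fs) top₂ two≡
        top₀ = pop-step (depth fs) top₁ two≡

        stacked = Mem.stacked mem
        pos≡ : H (N 6 ℕ.∸ N 7) ≡ pos f
        pos≡ = trans (cong H top₃) (proj₁ (proj₂ (proj₂ (proj₂ stacked))))
        spin≡ : H (N 6 ℕ.∸ N 7 ℕ.∸ N 7) ≡ toℕ (spin f)
        spin≡ = trans (cong H top₂) (proj₁ (proj₂ (proj₂ stacked)))
        vertex≡ : H (N 6 ℕ.∸ N 7 ℕ.∸ N 7 ℕ.∸ N 7) ≡ toℕ (vertex f)
        vertex≡ = trans (cong H top₁) (proj₁ (proj₂ stacked))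
        row≡ : H (N 6 ℕ.∸ N 7 ℕ.∸ N 7 ℕ.∸ N 7 ℕ.∸ N 7) ≡ sweep (row f)
        row≡ = trans (cong H top₀) (proj₁ stacked)

        regs′ = k≡ , zero≡ , 2n≡ , top₀ , two≡ , one≡ , j≡ , θ≡ , one≡ʳ

        inv′ : Inv t memo j fs (row f) (vertex f) H
        inv′ = record
          { mem    = record { cells = Mem.cells mem ; stacked = proj₂ (proj₂ (proj₂ (proj₂ stacked)))
                            ; output = Mem.output mem ; input = Mem.input mem }
          ; called = called
          ; sweeps = sweeps
          ; inside = ℕₚ.<-trans (ℕₚ.+-monoˡ-< _ m<slot) inside
          }

        entry≡ : entry ≡ A (vertex f) (nb f) (spin f) s
        entry≡ = trans (at-≡ vertex≡) (trans (at-≡ (neighbour≡ {N = N₅} vertex≡ pos≡ (drop≡ f)))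
          (trans (at-≡ spin≡) (at-≡ (cong₂ ℕ._∸_ spin+1≡ one≡))))

        p = clamp ((X 3 - entry) / X 0)

        p≡ : p ≡ rejection (vertex f) (spin f) (nb f) s
        p≡ = cong clamp (cong₂ _/_ (cong₂ _-_ one≡ʳ entry≡) θ≡)

        outcome : ∀ τ → p * Φ K τ + (1# - p) * Φ (K [ m ↦ trial (vertex f) (spin f) (rest f) ]) τ ≡
                        Φ (kernels memo (f ∷ fs)) τ
        outcome τ = begin
          p * Φ K τ + (1# - p) * Φ (K [ m ↦ κ₀ ]) τ
            ≡⟨ cong (λ y → p * y + (1# - p) * Φ (K [ m ↦ κ₀ ]) τ)
                 (Φ-cong (set-id K (λ σ x → sym (kernels-fresh called fresh σ x))) τ) ⟨
          p * Φ (K [ m ↦ κ₁ ]) τ + (1# - p) * Φ (K [ m ↦ κ₀ ]) τ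
            ≡⟨ Φ-mixture₂ p κ₁ κ₀ K (ℕₚ.<-trans m<slot slot<M) τ ⟨
          Φ (K [ m ↦ (λ σ x → p * κ₁ σ x + (1# - p) * κ₀ σ x) ]) τ
            ≡⟨ 𝔼-cong (evolve-look-up K (target τ) (vertexOf-slot a v) m<slot slot<M (no-update-between (row f) (nb≢ f))
                 (λ σ x → cong (λ κ → κ σ x) (trans (kernels-above called (ℕₚ.<⇒≤ m<slot)) (resolved-just memo {slot a v} eq)))
                 known) ⟩
          Φ (K [ m ↦ kernel f ]) τ ∎
          where
          open ≡-Reasoning
          κ₁ κ₀ : Kernel
          κ₁ = glauber (vertex f)
          κ₀ = trial (vertex f) (spin f) (rest f)
          known : ∀ σ → lookup σ v ≡ s → ∀ x → p * κ₁ σ x + (1# - p) * κ₀ σ x ≡ kernel f σ x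
          known σ σv≡s x = cong (λ p → p * κ₁ σ x + (1# - p) * κ₀ σ x)
            (trans p≡ (cong (rejection (vertex f) (spin f) (nb f)) (sym σv≡s)))

        time : fromℕ 17 + (fromℕ 1 + (p * (fromℕ 2 + (R + stackBudget j fs)) +
                                      (1# - p) * (fromℕ 3 + (trialBudget (rest f) + stackBudget j fs)))) ≤
               stackBudget j (f ∷ fs)
        -- 21 = 17 + 1 + 3 covers restoring the frame, the coin and passing. The frame pays for both
        -- a repetition and the rest of the trial although only one of them happens; the other one
        -- is the slack.
        time = 0≤y-x⇒x≤y (≤-trans
          (+-nonneg p-nonneg (+-nonneg (*-nonneg (x≤y⇒0≤y-x (clamp≤1 _)) 0≤R) (*-nonneg p-nonneg (trialBudget-nonneg (rest f)))))
          (≤-reflexive (solve 4 (λ p r b s → p :+ ((lit 1 :- p) :* r :+ p :* b) :=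
            (lit 21 :+ (r :+ b) :+ s) :- (lit 17 :+ (lit 1 :+ lit 0 :+
              (p :* (lit 2 :+ (r :+ s)) :+ (lit 1 :- p) :* (lit 3 :+ (b :+ s))))))
            refl p R (trialBudget (rest f)) (stackBudget j fs))))
          where
          p-nonneg : 0# ≤ p
          p-nonneg = clamp-nonneg _

      main-good : ∀ {memo j N X H} →
        Mem memo j [] H → suc t ℕ.* order ℕ.≤ M → Regs j [] N X → j ℕ.≤ k →
        Good t (mkState 8 N X H) (Φ (kernels memo [])) (mainBudget (k ℕ.∸ j))
      main-good {memo} {j} {N} {X} {H} mem sweeps regs@(k≡ , zero≡ , 2n≡ , top≡ , two≡ , one≡ , j≡ , θ≡ , one≡ʳ) j≤k
        with j ℕₚ.<? k
      ... | yes j<k = good-weaken (λ _ → ≤-refl) (≤-reflexive (sym budget≡))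
        (good-run (steps 1 refl then jumpZero-suc refl (trans (cong₂ ℕ._∸_ k≡ j≡) k∸j≡) then steps 2 refl)
          (Φ-nonneg (kernels-nonneg memo [])) (+-nonneg queryBudget-nonneg (stackBudget-nonneg j []))
          (λ {t′} t′<t → IH t′<t (query-cut (inv t′<t) regs (cong₂ ℕ._+_ k≡ zero≡)
            (trans (cong H (trans j≡ (sym i≡j))) (Mem.input mem i (ℕₚ.≤-reflexive (sym i≡j)))))))
        where
        i : Fin k
        i = fromℕ< j<k
        i≡j : toℕ i ≡ j
        i≡j = Finₚ.toℕ-fromℕ< j<k
        k∸j≡ : k ℕ.∸ j ≡ suc (k ℕ.∸ suc j)
        k∸j≡ = ℕₚ.+-∸-assoc 1 j<k
        budget≡ : mainBudget (k ℕ.∸ j) ≡ fromℕ 4 + (queryBudget + stackBudget j [])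
        budget≡ = trans (cong mainBudget k∸j≡)
          (solve 2 (λ r b → lit 11 :+ (r :+ b) := lit 4 :+ (r :+ (lit 7 :+ b))) refl queryBudget (mainBudget (k ℕ.∸ suc j)))
        inv : ∀ {t′} → t′ ℕ.< t → Inv t′ memo j [] 0 (lookup Λ i) H
        inv {t′} t′<t = record
          { mem    = mem
          ; called = by-main i i≡j
          ; sweeps = sweeps′
          ; inside = ℕₚ.<-≤-trans (ℕₚ.+-monoˡ-< _
              (subst (ℕ._< order) (sym (ℕₚ.+-identityʳ _)) (Finₚ.toℕ<n (lookup Λ i)))) sweeps′
          }
          where
          sweeps′ = ℕₚ.≤-trans (ℕₚ.*-monoˡ-≤ order (ℕ.s≤s (ℕₚ.<⇒≤ t′<t))) sweeps
      ... | no j≮k = good-weaken (λ _ → ≤-refl) (≤-reflexive (trans (+-identityʳ _) (cong mainBudget (sym k∸j≡0))))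
        (good-run (steps 1 refl then jumpZero-0 refl (trans (cong₂ ℕ._∸_ k≡ j≡) k∸j≡0))
          (Φ-nonneg (kernels-nonneg memo [])) ≤-refl
          (λ {t′} _ → good-halt t′ τ₀ refl heap≡ (Φ-nonneg (kernels-nonneg memo [])) (≤-reflexive (sym Φ≡1)) ≤-refl))
        where
        k∸j≡0 : k ℕ.∸ j ≡ 0
        k∸j≡0 = ℕₚ.m≤n⇒m∸n≡0 (ℕₚ.≮⇒≥ j≮k)
        out : ∀ i → ∃ λ s → memo (toℕ (lookup Λ i)) ≡ just s × H (toℕ i) ≡ toℕ s
        out i = Mem.output mem i (ℕₚ.<-≤-trans (Finₚ.toℕ<n i) (ℕₚ.≮⇒≥ j≮k))
        τ₀ : Vec (Fin q) k
        τ₀ = Vec.tabulate (proj₁ ∘ out)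
        heap≡ : Vec.tabulate (λ i → H (toℕ i)) ≡ Vec.map toℕ τ₀
        heap≡ = trans (Vecₚ.tabulate-cong (proj₂ ∘ proj₂ ∘ out)) (Vecₚ.tabulate-∘ toℕ (proj₁ ∘ out))
        target≡1 : ∀ σ → (∀ v {s} → memo (toℕ v) ≡ just s → lookup σ v ≡ s) → target τ₀ σ ≡ 1#
        target≡1 σ σ∼memo = 𝟙-yes (Vecₚ.≡-dec Finₚ._≟_ (restrict σ Λ) τ₀) (trans
          (cong (Vec.map (lookup σ)) (sym (Vecₚ.tabulate∘lookup Λ)))
          (trans (sym (Vecₚ.tabulate-∘ (lookup σ) (lookup Λ)))
            (Vecₚ.tabulate-cong (λ i → σ∼memo (lookup Λ i) (proj₁ (proj₂ (out i)))))))
        Φ≡1 : Φ (kernels memo []) τ₀ ≡ 1#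
        -- The window contains a full sweep, so every vertex has its last update inside it and
        -- nothing is required of the starting configuration.
        Φ≡1 = trans (𝔼-cong (λ σ → evolve-determined memo (target τ₀) target≡1 M σ
          (λ v _ M≤v → contradiction (ℕₚ.<-≤-trans (Finₚ.toℕ<n v) (ℕₚ.≤-trans (ℕₚ.m≤m+n order _) sweeps))
                                     (ℕₚ.≤⇒≯ M≤v)))) 𝔼-1

      step-good : ∀ {s r e} → Cut t s r e → Good t s r e
      step-good (query-cut inv regs row≡ vertex≡) = query-good inv regs row≡ vertex≡
      step-good (round-cut inv regs row≡ vertex≡ eq) = round-good inv regs row≡ vertex≡ eq
      step-good (trial-cut {us = []} inv regs row≡ vertex≡ eq spin≡ pos≡ degree≡ drop≡) =
        accept-good inv regs row≡ vertex≡ eq spin≡ pos≡ degree≡ drop≡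
      step-good (trial-cut {us = _ ∷ _} inv regs row≡ vertex≡ eq spin≡ pos≡ degree≡ drop≡) =
        ask-good inv regs row≡ vertex≡ eq spin≡ pos≡ degree≡ drop≡
      step-good (return-cut {fs = []} inv regs spin≡ eq) = return-to-main inv regs spin≡ eq
      step-good (return-cut {fs = _ ∷ _} inv regs spin≡ eq) = return-to-frame inv regs spin≡ eq
      step-good (main-cut mem sweeps regs j≤k) = main-good mem sweeps regs j≤k

    sound : (∀ v → fromℕ (2 ℕ.+ ⌈log₂ q ⌉) + trialBudget (neighbours v) ≤ R) →
            ∀ t {s r e} → Cut t s r e → Good t s r e
    sound budget t = <-rec (λ t → ∀ s r e → Cut t s r e → Good t s r e)
      (λ t IH s r e → Step.step-good budget t (λ t′<t → IH t′<t _ _ _)) t _ _ _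

  -- The window is chosen after t. This is harmless, since with an empty memo stationarity makes the
  -- martingale equal to the marginal for every window; the bounds obtained do not depend on t.
  initial-good : (∀ v → fromℕ (2 ℕ.+ ⌈log₂ q ⌉) + trialBudget (neighbours v) ≤ R) →
                 ∀ t → Good t (initial Λ) (marginal Λ) (fromℕ 8 + mainBudget k)
  initial-good budget t = good-weaken (λ τ → ≤-reflexive (Φ≡marginal τ)) ≤-refl
    (good-run (steps 8 refl) (Φ-nonneg (kernels-nonneg (λ _ → nothing) [])) (mainBudget-nonneg k)
      (λ {t′} t′<t → sound budget t′ (main-cut mem (ℕₚ.*-monoˡ-≤ order (ℕ.s≤s (ℕₚ.<⇒≤ t′<t)))
        (refl , refl , refl , cong suc (sym (ℕₚ.+-identityʳ k)) , refl , refl , refl , η/Δ≡θ , refl) ℕ.z≤n)))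
    where
    open Window (suc t ℕ.* order)
    open Cuts (suc t ℕ.* order)

    mem : Mem (λ _ → nothing) 0 [] (at 0 (λ i → toℕ (lookup Λ i)))
    mem = record
      { cells   = λ m → at-≥ (k≤cell m)
      ; stacked = tt
      ; output  = λ _ ()
      ; input   = λ i _ → at-toℕ i
      }

    Φ≡marginal : ∀ τ → Φ (kernels (λ _ → nothing) []) τ ≡ marginal Λ τ
    Φ≡marginal τ = trans (evolve-stationary (suc t ℕ.* order) (target τ)) (trans
      (∑-cong (configurations q order) (λ σ → *-comm (gibbs σ) (target τ σ)))
      (sym (∑-filter (λ σ → Vecₚ.≡-dec Finₚ._≟_ (restrict σ Λ) τ) gibbs (configurations q order))))

  ∑-marginal : ∑ (map (marginal Λ) (configurations q k)) ≡ 1#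
  ∑-marginal = begin
    ∑ (map (marginal Λ) Ts)
      ≡⟨ ∑-cong Ts (λ τ → ∑-filter (λ σ → Vecₚ.≡-dec Finₚ._≟_ (restrict σ Λ) τ) gibbs Ss) ⟩
    ∑ (map (λ τ → ∑ (map (λ σ → target τ σ * gibbs σ) Ss)) Ts)
      ≡⟨ ∑-swap _ Ts Ss ⟩
    ∑ (map (λ σ → ∑ (map (λ τ → target τ σ * gibbs σ) Ts)) Ss)
      ≡⟨ ∑-cong Ss (λ σ → trans (∑-*ʳ (gibbs σ) _ Ts)
           (trans (cong (_* gibbs σ) (∑-configurations-𝟙 (restrict σ Λ))) (*-identityˡ _))) ⟩
    ∑ (map gibbs Ss)
      ≡⟨ ∑-gibbs ⟩
    1# ∎
    where
    open ≡-Reasoning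
    Ss = configurations q order
    Ts = configurations q k

-- Constants and conclusion.

degree≤maxDegree : ∀ (G : Graph) v → Graph.degree G v ℕ.≤ Graph.maxDegree G
degree≤maxDegree G v = go (allFin order) (∈-allFin v)
  where
  open Graph G
  go : ∀ vs → v ∈ vs → degree v ℕ.≤ foldr ℕ._⊔_ 0 (map degree vs)
  go (_ ∷ vs) (here refl)  = ℕₚ.m≤m⊔n _ _
  go (w ∷ vs) (there v∈vs) = ℕₚ.≤-trans (go vs v∈vs) (ℕₚ.m≤n⊔m (degree w) _)

order-nonZero : ∀ (G : Graph) → 1 ℕ.≤ Graph.maxDegree G → NonZero (Graph.order G)
order-nonZero record { order = zero }  ()
order-nonZero record { order = suc _ } _ = _

module Constants (𝓡 : Reals) (δ : Reals.ℝ 𝓡) (0<δ : Reals._<_ 𝓡 (Reals.0# 𝓡) δ) where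
  open Reals 𝓡
  open OrderedField 𝓡

  -- The hypotheses for δ > 1 imply those for δ = 1.
  δ′ η C : ℝ
  δ′ = if does (δ ≤? 1#) then δ else 1#
  η  = (1# - δ′) / fromℕ 2
  C  = fromℕ 26 + fromℕ 56 / δ′

  δ′≤δ : δ′ ≤ δ
  δ′≤δ with δ ≤? 1#
  ... | yes _  = ≤-refl
  ... | no δ≰1 = ≰⇒≥ δ≰1

  δ′≤1 : δ′ ≤ 1#
  δ′≤1 with δ ≤? 1#
  ... | yes δ≤1 = δ≤1
  ... | no _    = ≤-refl

  0<δ′ : 0# < δ′
  0<δ′ with δ ≤? 1#
  ... | yes _ = 0<δ
  ... | no _  = 0<1

  0<2 : 0# < fromℕ 2
  0<2 = <-≤-trans 0<1 (1≤fromℕ {2} (ℕ.s≤s ℕ.z≤n))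

  2η≡1-δ′ : fromℕ 2 * η ≡ 1# - δ′
  2η≡1-δ′ = y*[x/y]≡x (<⇒≢0 0<2)

  0≤η : 0# ≤ η
  0≤η = /-nonneg (x≤y⇒0≤y-x δ′≤1) (proj₁ 0<2)

  η≤1 : η ≤ 1#
  η≤1 = *-cancelˡ-≤ 0<2 (begin
    fromℕ 2 * η   ≡⟨ 2η≡1-δ′ ⟩
    1# - δ′       ≤⟨ x-y≤x (proj₁ 0<δ′) ⟩
    1#            ≤⟨ 1≤fromℕ {2} (ℕ.s≤s ℕ.z≤n) ⟩
    fromℕ 2       ≡⟨ solve 0 (lit 2 := lit 2 :* lit 1) refl ⟩
    fromℕ 2 * 1#  ∎)
    where open ≤-Reasoning

  1≰η : ¬ 1# ≤ η
  1≰η 1≤η = 0≢1 (antisym 0≤1 (0≤y-x⇒x≤y (begin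
    0#                        ≤⟨ x≤y⇒0≤y-x (*-monoˡ-≤ (proj₁ 0<2) 1≤η) ⟩
    fromℕ 2 * η - fromℕ 2 * 1# ≡⟨ cong (λ x → x - fromℕ 2 * 1#) 2η≡1-δ′ ⟩
    1# - δ′ - fromℕ 2 * 1#     ≡⟨ solve 1 (λ d → lit 1 :- d :- lit 2 :* lit 1 := lit 0 :- lit 1 :- d) refl δ′ ⟩
    0# - 1# - δ′               ≤⟨ x-y≤x (proj₁ 0<δ′) ⟩
    0# - 1#                    ∎)))
    where open ≤-Reasoning

module Main (𝓡 : Reals) (δ : Reals.ℝ 𝓡) (0<δ : Reals._<_ 𝓡 (Reals.0# 𝓡) δ)
  {q : ℕ} (2≤q : 2 ℕ.≤ q) (𝓢 : Sampling.SpinSystem 𝓡 q)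
  (1≤Δ : 1 ℕ.≤ Graph.maxDegree (Sampling.SpinSystem.graph 𝓢))
  (normalized : Sampling.Normalized 𝓡 𝓢) (soft : Sampling.Soft 𝓡 δ 𝓢)
  (k : ℕ) (Λ : Vec (Graph.V (Sampling.SpinSystem.graph 𝓢)) k) where
  open Reals 𝓡
  open Sampling 𝓡
  open SpinSystem 𝓢
  open OrderedField 𝓡
  open FiniteSums 𝓡
  open Constants 𝓡 δ 0<δ
  open Sampler 𝓡

  θ D L W R : ℝ
  θ = η / D
  D = fromℕ maxDegree
  L = fromℕ ⌈log₂ q ⌉
  W = fromℕ (maxDegree ℕ.* ⌈log₂ q ⌉)
  R = fromℕ 56 / δ′ * W

  1≤log : 1 ℕ.≤ ⌈log₂ q ⌉
  1≤log = ⌈log₂⌉-mono-≤ 2≤q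

  0<D : 0# < D
  0<D = <-≤-trans 0<1 (1≤fromℕ 1≤Δ)

  0≤θ : 0# ≤ θ
  0≤θ = /-nonneg 0≤η (proj₁ 0<D)

  θ≤η : θ ≤ η
  θ≤η = x≤zy⇒x/y≤z 0<D (begin
    η       ≡⟨ *-identityʳ η ⟨
    η * 1#  ≤⟨ *-monoˡ-≤ 0≤η (1≤fromℕ 1≤Δ) ⟩
    η * D   ∎)
    where open ≤-Reasoning

  1-A≤θ : ∀ {v u} → u ∈ neighbours v → ∀ a b → 1# - A v u a b ≤ θ
  1-A≤θ {v} {u} u∈N a b = begin
    1# - A v u a b
      ≤⟨ +-monoʳ-≤ 1# (neg-mono-≤ (soft v u u∈N a b)) ⟩
    1# - (1# - (1# - δ) / (fromℕ 2 * D))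
      ≡⟨ solve 1 (λ x → lit 1 :- (lit 1 :- x) := x) refl _ ⟩
    (1# - δ) / (fromℕ 2 * D)
      ≤⟨ *-monoʳ-≤ (⁻¹-nonneg (*-nonneg (proj₁ 0<2) (proj₁ 0<D))) (+-monoʳ-≤ 1# (neg-mono-≤ δ′≤δ)) ⟩
    (1# - δ′) / (fromℕ 2 * D)
      ≡⟨ /-* (1# - δ′) (<⇒≢0 0<2) (<⇒≢0 0<D) ⟩
    θ ∎
    where open ≤-Reasoning

  -- A zero entry would give 1 ≤ θ ≤ η, against 2 η = 1 - δ′ < 1.
  A-pos : ∀ {v u} → u ∈ neighbours v → ∀ a b → 0# < A v u a b
  A-pos {v} {u} u∈N a b = A-nonneg u∈N a b , λ 0≡A → 1≰η (begin
    1#              ≡⟨ solve 0 (lit 1 := lit 1 :- lit 0) refl ⟩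
    1# - 0#         ≡⟨ cong (λ x → 1# - x) 0≡A ⟩
    1# - A v u a b  ≤⟨ ≤-trans (1-A≤θ u∈N a b) θ≤η ⟩
    η               ∎)
    where open ≤-Reasoning

  0≤R : 0# ≤ R
  0≤R = *-nonneg (/-nonneg (fromℕ-nonneg 56) (proj₁ 0<δ′)) (fromℕ-nonneg (maxDegree ℕ.* ⌈log₂ q ⌉))

  instance
    nonZero : NonZero order
    nonZero = order-nonZero graph 1≤Δ

  nearlyFree : Hypotheses.NearlyFree 𝓡 𝓢 θ
  nearlyFree = record
    { positive = record { ∑λ≡1 = proj₁ normalized ; A-pos = A-pos }
    ; A≤1      = λ u∈N → proj₁ (proj₂ normalized _ _ u∈N)
    ; 1-A≤θ    = 1-A≤θ
    ; 0≤θ      = 0≤θ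
    ; θ≤1      = ≤-trans θ≤η η≤1
    }

  open Soundness 𝓡 2≤q 𝓢 η θ refl nearlyFree k Λ R 0≤R
  open Bounds 𝓡 𝓢 (sampler η) k
  open Good

  trialBudget-length : ∀ us → trialBudget us ≡ fromℕ 6 + fromℕ (length us) * neighbourBudget
  trialBudget-length []       = solve 1 (λ x → lit 6 := lit 6 :+ lit 0 :* x) refl neighbourBudget
  trialBudget-length (u ∷ us) = trans (cong (neighbourBudget +_) (trialBudget-length us))
    (solve 2 (λ x l → x :+ (lit 6 :+ l :* x) := lit 6 :+ (lit 1 :+ l) :* x) refl neighbourBudget (fromℕ (length us)))

  1≤W : 1# ≤ W
  1≤W = 1≤fromℕ (ℕₚ.*-mono-≤ 1≤Δ 1≤log)

  L≤W : L ≤ W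
  L≤W = fromℕ-mono (ℕₚ.≤-trans (ℕₚ.≤-reflexive (sym (ℕₚ.*-identityˡ ⌈log₂ q ⌉))) (ℕₚ.*-monoˡ-≤ ⌈log₂ q ⌉ 1≤Δ))

  D≤W : D ≤ W
  D≤W = fromℕ-mono (ℕₚ.≤-trans (ℕₚ.≤-reflexive (sym (ℕₚ.*-identityʳ maxDegree))) (ℕₚ.*-monoʳ-≤ maxDegree 1≤log))

  δ′R≡56W : δ′ * R ≡ fromℕ 56 * W
  δ′R≡56W = trans (sym (*-assoc δ′ _ W)) (cong (_* W) (y*[x/y]≡x (<⇒≢0 0<δ′)))

  -- The recursive inequality that `R` has to satisfy. As 1, `L`, `D` and η are all at most `W`, the
  -- direct cost of a trial is at most (8 + 1 + 6 + 41) W = 56 W. Queries and repetitions add 2 η R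
  -- = (1 - δ′) R, and `R` is chosen so that δ′ R = 56 W.
  budget : ∀ v → fromℕ (2 ℕ.+ ⌈log₂ q ⌉) + trialBudget (neighbours v) ≤ R
  budget v = begin
    fromℕ (2 ℕ.+ ⌈log₂ q ⌉) + trialBudget (neighbours v)
      ≡⟨ cong (fromℕ (2 ℕ.+ ⌈log₂ q ⌉) +_) (trialBudget-length (neighbours v)) ⟩
    fromℕ (2 ℕ.+ ⌈log₂ q ⌉) + (fromℕ 6 + fromℕ (degree v) * neighbourBudget)
      ≤⟨ +-monoʳ-≤ _ (+-monoʳ-≤ _ (*-monoʳ-≤ neighbourBudget-nonneg (fromℕ-mono (degree≤maxDegree graph v)))) ⟩
    fromℕ (2 ℕ.+ ⌈log₂ q ⌉) + (fromℕ 6 + D * neighbourBudget)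
      ≡⟨ solve 4 (λ l d o r → (lit 1 :+ (lit 1 :+ l)) :+ (lit 6 :+ d :* (lit 6 :+ o :* (lit 41 :+ lit 2 :* r))) :=
                              lit 8 :+ l :+ lit 6 :* d :+ lit 41 :* (d :* o) :+ lit 2 :* (d :* o) :* r) refl L D θ R ⟩
    fromℕ 8 + L + fromℕ 6 * D + fromℕ 41 * (D * θ) + fromℕ 2 * (D * θ) * R
      ≡⟨ cong (λ y → fromℕ 8 + L + fromℕ 6 * D + fromℕ 41 * y + fromℕ 2 * y * R) (y*[x/y]≡x (<⇒≢0 0<D)) ⟩
    fromℕ 8 + L + fromℕ 6 * D + fromℕ 41 * η + fromℕ 2 * η * R
      ≤⟨ +-mono-≤ (+-mono-≤ (+-mono-≤ (+-mono-≤ 8≤8W L≤W) (*-monoˡ-≤ (fromℕ-nonneg 6) D≤W))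
           (*-monoˡ-≤ (fromℕ-nonneg 41) (≤-trans η≤1 1≤W))) (≤-reflexive (cong (_* R) 2η≡1-δ′)) ⟩
    fromℕ 8 * W + W + fromℕ 6 * W + fromℕ 41 * W + (1# - δ′) * R
      ≡⟨ solve 3 (λ w d r → lit 8 :* w :+ w :+ lit 6 :* w :+ lit 41 :* w :+ (lit 1 :- d) :* r :=
                            r :+ (lit 56 :* w :- d :* r)) refl W δ′ R ⟩
    R + (fromℕ 56 * W - δ′ * R)
      ≡⟨ cong (λ y → R + (y - δ′ * R)) δ′R≡56W ⟨
    R + (δ′ * R - δ′ * R)
      ≡⟨ trans (cong (R +_) (-‿inverseʳ _)) (+-identityʳ R) ⟩
    R ∎
    where
    open ≤-Reasoning
    8≤8W : fromℕ 8 ≤ fromℕ 8 * W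
    8≤8W = ≤-trans (≤-reflexive (solve 0 (lit 8 := lit 8 :* lit 1) refl)) (*-monoˡ-≤ (fromℕ-nonneg 8) 1≤W)

  mainBudget-linear : ∀ m → mainBudget m ≡ fromℕ 2 + fromℕ m * (fromℕ 16 + R)
  mainBudget-linear zero    = solve 1 (λ x → lit 2 := lit 2 :+ lit 0 :* x) refl (fromℕ 16 + R)
  mainBudget-linear (suc m) = trans (cong (λ b → fromℕ 11 + (queryBudget + b)) (mainBudget-linear m))
    (solve 2 (λ r m → lit 11 :+ (lit 5 :+ r :+ (lit 2 :+ m :* (lit 16 :+ r))) :=
                      lit 2 :+ (lit 1 :+ m) :* (lit 16 :+ r)) refl R (fromℕ m))

  -- A fixed cost 8 + 2 and a cost 16 + R per vertex of Λ. Passing from k to k ⊔ 1 lets the fixed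
  -- cost be absorbed even for empty Λ, and 10 + 16 is the 26 in `C`.
  total-budget : fromℕ 8 + mainBudget k ≤ C * fromℕ (maxDegree ℕ.* ⌈log₂ q ⌉ ℕ.* (k ℕ.⊔ 1))
  total-budget = begin
    fromℕ 8 + mainBudget k
      ≡⟨ cong (fromℕ 8 +_) (mainBudget-linear k) ⟩
    fromℕ 8 + (fromℕ 2 + fromℕ k * (fromℕ 16 + R))
      ≤⟨ +-monoʳ-≤ _ (+-monoʳ-≤ _ (*-monoʳ-≤ (+-nonneg (fromℕ-nonneg 16) 0≤R) (fromℕ-mono (ℕₚ.m≤m⊔n k 1)))) ⟩
    fromℕ 8 + (fromℕ 2 + K * (fromℕ 16 + R))
      ≡⟨ solve 2 (λ k r → lit 8 :+ (lit 2 :+ k :* (lit 16 :+ r)) := lit 10 :* lit 1 :+ lit 16 :* k :+ r :* k) refl K R ⟩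
    fromℕ 10 * 1# + fromℕ 16 * K + R * K
      ≤⟨ +-monoˡ-≤ (R * K) (+-mono-≤ (*-monoˡ-≤ (fromℕ-nonneg 10) (≤-trans 1≤K K≤WK)) (*-monoˡ-≤ (fromℕ-nonneg 16) K≤WK)) ⟩
    fromℕ 10 * (W * K) + fromℕ 16 * (W * K) + fromℕ 56 / δ′ * W * K
      ≡⟨ solve 3 (λ c w k → lit 10 :* (w :* k) :+ lit 16 :* (w :* k) :+ c :* w :* k := (lit 26 :+ c) :* (w :* k))
           refl (fromℕ 56 / δ′) W K ⟩
    C * (W * K)
      ≡⟨ cong (C *_) (fromℕ-* (maxDegree ℕ.* ⌈log₂ q ⌉) (k ℕ.⊔ 1)) ⟨
    C * fromℕ (maxDegree ℕ.* ⌈log₂ q ⌉ ℕ.* (k ℕ.⊔ 1)) ∎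
    where
    open ≤-Reasoning
    K : ℝ
    K = fromℕ (k ℕ.⊔ 1)
    1≤K : 1# ≤ K
    1≤K = 1≤fromℕ (ℕₚ.m≤n⊔m k 1)
    K≤WK : K ≤ W * K
    K≤WK = ≤-trans (≤-reflexive (sym (*-identityˡ K))) (*-monoʳ-≤ (fromℕ-nonneg (k ℕ.⊔ 1)) 1≤W)

  perfect : PerfectSample 𝓢 (sampler η) Λ
  perfect = good⇒⟶ (initial-good budget) ∑-marginal

  fast : ExpectedTime≤ 𝓢 (sampler η) Λ (C * fromℕ (maxDegree ℕ.* ⌈log₂ q ⌉ ℕ.* (k ℕ.⊔ 1)))
  fast t = ≤-trans (time≤ (initial-good budget t)) total-budget

theorem1p2 : (𝓡 : Reals) (let open Reals 𝓡) (let open Sampling 𝓡)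
    (δ : ℝ) → 0# < δ →
    Σ Program λ P → Σ ℝ λ C →
    (q : ℕ) → 2 ℕ.≤ q →
    (𝓢 : SpinSystem q) (let open SpinSystem 𝓢) →
    1 ℕ.≤ maxDegree →
    Normalized 𝓢 →
    Soft δ 𝓢 →
    (k : ℕ) (Λ : Vec V k) → Unique Λ →
    PerfectSample 𝓢 P Λ
    × ExpectedTime≤ 𝓢 P Λ
    (C * fromℕ (maxDegree ℕ.* ⌈log₂ q ⌉ ℕ.* (k ℕ.⊔ 1)))
theorem1p2 𝓡 δ 0<δ = Sampler.sampler 𝓡 η , C , λ q 2≤q 𝓢 1≤Δ normalized soft k Λ _ →
  let open Main 𝓡 δ 0<δ 2≤q 𝓢 1≤Δ normalized soft k Λ in perfect , fast
  where open Constants 𝓡 δ 0<δ
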